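{- For every constant $c>0$ there is a constant $C>0$ (depending only on $c$) such that the following holds. Let $p$ be a prime and let $A$ be a nonempty subset of $\mathbb{F}_p$ with $|A|\le c\,p^{1/2}$. Then \[\max\{|A+A|,|AA|\}\ge C^{ -1}|A|^{13/12}\quad\text{and}\quad \max\{|A-A|,|AA|\}\ge C^{ -1}|A|^{13/12}.\]
   Context: $\mathbb{F}_p$ is the field of residue classes modulo the prime $p$. For $A,B\subset\mathbb{F}_p$: $A+B=\{a+b:a\in A,b\in B\}$, $A-B=\{a-b:a\in A,b\in B\}$, $AB=\{ab:a\in A,b\in B\}$. $|X|$ denotes cardinality. -}

module Defs where

open import Data.Nat using (ℕ; zero; suc; _+_; _*_; _∸_)
open import Data.Nat.DivMod using (_%_; m%n<n)
open import Data.Fin using (Fin; toℕ; fromℕ<)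
open import Data.Fin.Properties using (any?)
open import Data.Fin.Subset using (Subset; _∈_)
open import Data.Fin.Subset.Properties using (_∈?_)
open import Data.Vec using (tabulate)
open import Data.Product using (∃; _×_; _,_)
open import Relation.Nullary.Decidable using (does; _×-dec_)
open import Relation.Binary.PropositionalEquality using (_≡_)
open import Data.Fin.Properties using (_≟_)

-- Arithmetic in 𝔽_p, with 𝔽_p represented as Fin p (residues 0 … p-1).
-- (Fin 0 is empty, so the p = 0 case is vacuous.)
reduce : (n : ℕ) → ℕ → Fin (suc n)
reduce n m = fromℕ< (m%n<n m (suc n))

_+ₚ_ : ∀ {p} → Fin p → Fin p → Fin p
_+ₚ_ {suc n} a b = reduce n (toℕ a + toℕ b)

_-ₚ_ : ∀ {p} → Fin p → Fin p → Fin p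
_-ₚ_ {suc n} a b = reduce n (toℕ a + (suc n ∸ toℕ b))

_*ₚ_ : ∀ {p} → Fin p → Fin p → Fin p
_*ₚ_ {suc n} a b = reduce n (toℕ a * toℕ b)

setOp : ∀ {p} → (Fin p → Fin p → Fin p) → Subset p → Subset p → Subset p
setOp f A B = tabulate λ x →
  does (any? λ a → any? λ b → (a ∈? A) ×-dec ((b ∈? B) ×-dec (f a b ≟ x)))

_⊕_ : ∀ {p} → Subset p → Subset p → Subset p
A ⊕ B = setOp _+ₚ_ A B

_⊖_ : ∀ {p} → Subset p → Subset p → Subset p
A ⊖ B = setOp _-ₚ_ A B

_⊗_ : ∀ {p} → Subset p → Subset p → Subset p
A ⊗ B = setOp _*ₚ_ A B

{-# OPTIONS --safe #-}

-- Let M bound |A ± A| and |AA|.  Passing to half of A, Plünnecke's inequality in Petridis's form gives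
-- |X ± X ± X ± X| ≪ M³ / |A|².  By multiplicative energy there is e ∈ X such that many dilates a X meet
-- e X in at least N points; let U be the set of such a.  Choosing N by a weighted pigeonhole costs no
-- logarithm: N⁴|U|³M⁴ ≫ |X|¹¹.  For a ∈ U, most of a U is covered by O(M/N) translates of e X, and
-- by O(M/N) translates of -e X, as sums and differences have the same additive energy.
--
-- Let R be the set of quotients (a - b)/(c - d) of differences of U.  For ξ ∈ R the coverings of c U,
-- d U, a U, b U bound |V + ξ W| by (M/N)⁴|X ± X ± X ± X| for large parts V, W of U.  Since |U|² ≪ p,
-- averaging yields η such that U and η U have small additive energy.  If η ∈ R, then |V + η W| ≫ |U|².
-- Otherwise, walking from 0 ∈ R in steps of ±1, some ξ ∈ R has ξ ± 1 ∉ R; then x + (ξ ± 1) y is injective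
-- on U × U, and Plünnecke's inequality gives |U|³ ≪ |U ± U| |V + ξ W|.  In both cases
-- N⁴|U|³ ≪ M⁵|X ± X ± X ± X|, and multiplying the bounds yields |A|¹³ ≪ M¹².

module Submission where

open import Defs
open import Algebra.Bundles using (CommutativeRing)
import Algebra.Solver.Ring.NaturalCoefficients.Default as NatSolver
open import Algebra.Structures using (IsCommutativeRing)
open import Data.Bool using (true; false)
open import Data.Fin using (Fin; zero; suc; toℕ)
open import Data.Fin.Properties
  using (any?; _≟_; suc-injective; toℕ-injective; toℕ-fromℕ<; toℕ<n)
open import Data.Fin.Subset
  using (Subset; Nonempty; ∣_∣; _∈_; _∉_; _⊆_; _∪_; _∩_; _─_; ⁅_⁆; ⊥; ⊤)
open import Data.Fin.Subset.Properties
open import Data.List using (List; []; _∷_; map; length; cartesianProduct; _++_)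
open import Data.List.Properties using (length-map; length-++)
import Data.List.Membership.Propositional as L
open import Data.List.Membership.Propositional.Properties
  using (∈-map⁺; ∈-map⁻; ∈-cartesianProduct⁺; ∈-cartesianProduct⁻)
open import Data.List.Relation.Unary.All as All using ([]; _∷_)
import Data.List.Relation.Unary.All.Properties as All
open import Data.List.Relation.Unary.AllPairs using ([]; _∷_)
open import Data.List.Relation.Unary.Any using (here; there)
open import Data.List.Relation.Unary.Unique.Propositional using (Unique)
import Data.List.Relation.Unary.Unique.Propositional.Properties as Unique
open import Data.Nat
  using (ℕ; zero; suc; _+_; _*_; _∸_; _^_; _≤_; _<_; _>_; z≤n; s≤s; _⊓_; _⊔_; _≤?_; _/_; _%_; NonZero; >-nonZero)
open import Data.Nat.DivMod
open import Data.Nat.Divisibility using (_∣_; ∣m+n∣m⇒∣n; n∣m*n; ∣⇒≤)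
open import Data.Nat.Induction using (<-wellFounded)
open import Data.Nat.Primality using (Prime; euclidsLemma)
open import Data.Nat.Properties hiding (suc-injective; _≟_; _≤?_)
open import Data.Nat.Solver using (module +-*-Solver)
open +-*-Solver using (solve; con; _:+_; _:*_; _:^_; _:=_)
open import Data.Nat.Tactic.RingSolver using (solve-∀)
open import Data.Product using (Σ; ∃; ∃₂; _×_; _,_; proj₁; proj₂; uncurry)
open import Data.Product.Properties using (≡-dec)
open import Data.Sum using (_⊎_; inj₁; inj₂)
open import Data.Vec using ([]; _∷_; here; there; tabulate)
open import Data.Vec.Properties using ([]=⇒lookup; lookup⇒[]=; lookup∘tabulate)
open import Function using (_∘_; id)
open import Induction.WellFounded using (Acc; acc)
open import Relation.Binary.Definitions using (DecidableEquality)
open import Relation.Binary.PropositionalEquality hiding (J)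
open import Relation.Nullary using (Dec; yes; no; ¬_; contradiction; does)
open import Relation.Nullary.Decidable using (dec-true; _×-dec_; ¬?)

-- Sums and differences are treated at once by a sign σ with σ² = 1. The obstacle is that, apart
-- from the iterated sumset, only X + σ X is known to be small, so every collision count has to take
-- place inside a dilate of it. This dictates the coverings: the points s used for a U satisfy e s =
-- a x with x in X, and then a u + σ e s = a (u + σ x).
--
-- The fourth power of N is the price of the four coverings, one for each entry of a quotient (a -
-- b)/(c - d), with about M / N translates apiece. Since N drops out only at the very end, the
-- pigeonhole has to bound exactly the product N⁴ |U|³ from below.
--
-- The averaged η serves twice. If the quotients fill the whole field, the walk never leaves them,
-- and η, being a quotient, supplies the bound. If η is not a quotient, it certifies that the walk
-- leaves them somewhere.
--
-- All inequalities are between natural numbers with denominators cleared, and equations in the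
-- field are cross-multiplied, so neither fractions nor inverses appear.

private variable
  ι κ : Set
  ν : ℕ

-- Finite sums and double counting

∑ : List ι → (ι → ℕ) → ℕ
∑ []       f = 0
∑ (i ∷ is) f = f i + ∑ is f

∑-mono : (L : List ι) {f g : ι → ℕ} → (∀ {i} → i L.∈ L → f i ≤ g i) → ∑ L f ≤ ∑ L g
∑-mono []      h = z≤n
∑-mono (i ∷ L) h = +-mono-≤ (h (here refl)) (∑-mono L (h ∘ there))

∑-cong : (L : List ι) {f g : ι → ℕ} → (∀ i → f i ≡ g i) → ∑ L f ≡ ∑ L g
∑-cong []      h = refl
∑-cong (i ∷ L) h = cong₂ _+_ (h i) (∑-cong L h)

∑-+ : (L : List ι) (f g : ι → ℕ) → ∑ L (λ i → f i + g i) ≡ ∑ L f + ∑ L g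
∑-+ []      f g = refl
∑-+ (i ∷ L) f g rewrite ∑-+ L f g = lemma (f i) (g i) (∑ L f) (∑ L g)
  where
  lemma : ∀ a b c d → a + b + (c + d) ≡ a + c + (b + d)
  lemma = solve-∀

∑-*ˡ : (L : List ι) (k : ℕ) (f : ι → ℕ) → ∑ L (λ i → k * f i) ≡ k * ∑ L f
∑-*ˡ []      k f = sym (*-zeroʳ k)
∑-*ˡ (i ∷ L) k f rewrite ∑-*ˡ L k f = sym (*-distribˡ-+ k (f i) (∑ L f))

∑-const : (L : List ι) (k : ℕ) → ∑ L (λ _ → k) ≡ length L * k
∑-const []      k = refl
∑-const (i ∷ L) k = cong (k +_) (∑-const L k)

∑-swap : (L : List ι) (K : List κ) (f : ι → κ → ℕ) →
  ∑ L (λ i → ∑ K (λ j → f i j)) ≡ ∑ K (λ j → ∑ L (λ i → f i j))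
∑-swap []      K f = sym (trans (∑-const K 0) (*-zeroʳ (length K)))
∑-swap (i ∷ L) K f rewrite ∑-swap L K f = sym (∑-+ K (f i) (λ j → ∑ L (λ i → f i j)))

∑-++ : (L K : List ι) (f : ι → ℕ) → ∑ (L ++ K) f ≡ ∑ L f + ∑ K f
∑-++ []      K f = refl
∑-++ (i ∷ L) K f rewrite ∑-++ L K f = sym (+-assoc (f i) _ _)

∑-map : (h : ι → κ) (L : List ι) (f : κ → ℕ) → ∑ (map h L) f ≡ ∑ L (f ∘ h)
∑-map h []      f = refl
∑-map h (i ∷ L) f = cong (f (h i) +_) (∑-map h L f)

∑-product : (L : List ι) (K : List κ) (f : ι × κ → ℕ) →
  ∑ (cartesianProduct L K) f ≡ ∑ L (λ i → ∑ K (λ j → f (i , j)))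
∑-product []      K f = refl
∑-product (i ∷ L) K f = trans (∑-++ (map (i ,_) K) _ f)
  (cong₂ _+_ (∑-map (i ,_) K f) (∑-product L K f))

∑-member : (L : List ι) (f : ι → ℕ) {i : ι} → i L.∈ L → f i ≤ ∑ L f
∑-member (i ∷ L) f (here refl) = m≤m+n _ _
∑-member (j ∷ L) f (there i∈L) = ≤-trans (∑-member L f i∈L) (m≤n+m _ _)

average : (L : List ι) (f : ι → ℕ) → 0 < length L → ∃ λ i → i L.∈ L × ∑ L f ≤ length L * f i
average (i ∷ [])      f _ = i , here refl , ≤-refl
average (i ∷ L@(_ ∷ _)) f _ with average L f (s≤s z≤n)
... | j , j∈L , le with ≤-total (f i) (f j)
... | inj₁ fi≤fj = j , there j∈L , +-mono-≤ fi≤fj le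
... | inj₂ fj≤fi = i , here refl , +-monoʳ-≤ (f i) (≤-trans le (*-monoʳ-≤ (length L) fj≤fi))

average-≤ : (L : List ι) (f : ι → ℕ) → 0 < length L → ∃ λ i → i L.∈ L × length L * f i ≤ ∑ L f
average-≤ (i ∷ [])      f _ = i , here refl , ≤-refl
average-≤ (i ∷ L@(_ ∷ _)) f _ with average-≤ L f (s≤s z≤n)
... | j , j∈L , le with ≤-total (f i) (f j)
... | inj₂ fj≤fi = j , there j∈L , +-mono-≤ fj≤fi le
... | inj₁ fi≤fj = i , here refl , +-monoʳ-≤ (f i) (≤-trans (*-monoʳ-≤ (length L) fi≤fj) le)

𝟙 : {P : Set} → Dec P → ℕ
𝟙 (yes _) = 1
𝟙 (no _)  = 0

𝟙-yes : {P : Set} → (d : Dec P) → P → 𝟙 d ≡ 1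
𝟙-yes (yes _) p = refl
𝟙-yes (no ¬p) p = contradiction p ¬p

𝟙-no : {P : Set} → (d : Dec P) → ¬ P → 𝟙 d ≡ 0
𝟙-no (yes p) ¬p = contradiction p ¬p
𝟙-no (no _)  ¬p = refl

𝟙≤1 : {P : Set} → (d : Dec P) → 𝟙 d ≤ 1
𝟙≤1 (yes _) = ≤-refl
𝟙≤1 (no _)  = z≤n

𝟙-mono : {P Q : Set} (d : Dec P) (e : Dec Q) → (P → Q) → 𝟙 d ≤ 𝟙 e
𝟙-mono (no _)  e h = z≤n
𝟙-mono (yes p) e h = ≤-reflexive (sym (𝟙-yes e (h p)))

∑-𝟙≤1 : {L : List ι} → Unique L → {R : ι → Set} (R? : ∀ i → Dec (R i)) →
  (∀ {i j} → R i → R j → i ≡ j) → ∑ L (λ i → 𝟙 (R? i)) ≤ 1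
∑-𝟙≤1 [] R? uniq = z≤n
∑-𝟙≤1 {L = i ∷ L} (i∉L ∷ uL) {R} R? uniq with R? i
... | no  _ = ∑-𝟙≤1 uL R? uniq
... | yes r = s≤s (≤-trans
  (∑-mono L {g = λ _ → 0} λ {j} j∈L → ≤-reflexive (𝟙-no (R? j)
    λ r′ → All.lookup i∉L j∈L (uniq r r′)))
  (≤-reflexive (trans (∑-const L 0) (*-zeroʳ (length L)))))

1≤∑-𝟙 : (L : List ι) {R : ι → Set} (R? : ∀ i → Dec (R i)) → ∀ {i} → i L.∈ L → R i →
  1 ≤ ∑ L (λ i → 𝟙 (R? i))
1≤∑-𝟙 L R? {i} i∈L r = ≤-trans (≤-reflexive (sym (𝟙-yes (R? i) r)))
  (∑-member L (λ i → 𝟙 (R? i)) i∈L)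

-- Counting the related pairs in both orders: each i meets at least one j, and each j at most one i.
-- A relation instead of a function makes it unnecessary to select one of several possible images.
length-≤ : {L : List ι} {K : List κ} → Unique L → {R : ι → κ → Set} (R? : ∀ i j → Dec (R i j)) →
  (∀ {i} → i L.∈ L → ∃ λ j → j L.∈ K × R i j) → (∀ {i i′ j} → R i j → R i′ j → i ≡ i′) →
  length L ≤ length K
length-≤ {L = L} {K} uL R? total inj = begin
  length L                            ≡⟨ *-identityʳ _ ⟨
  length L * 1                        ≡⟨ ∑-const L 1 ⟨
  ∑ L (λ _ → 1)                       ≤⟨ ∑-mono L (λ i∈L → let j , j∈K , r = total i∈L in 1≤∑-𝟙 K (R? _) j∈K r) ⟩
  ∑ L (λ i → ∑ K (λ j → 𝟙 (R? i j)))  ≡⟨ ∑-swap L K _ ⟩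
  ∑ K (λ j → ∑ L (λ i → 𝟙 (R? i j)))  ≤⟨ ∑-mono K (λ {j} _ → ∑-𝟙≤1 uL (λ i → R? i j) inj) ⟩
  ∑ K (λ _ → 1)                       ≡⟨ ∑-const K 1 ⟩
  length K * 1                        ≡⟨ *-identityʳ _ ⟩
  length K                            ∎
  where open ≤-Reasoning

2ab≤a²+b² : ∀ a b → 2 * (a * b) ≤ a * a + b * b
2ab≤a²+b² a b with ≤-total a b
... | inj₁ a≤b with m≤n⇒∃[o]m+o≡n a≤b
...   | d , refl = ≤-trans (m≤m+n _ (d * d)) (≤-reflexive (eq a d))
  where
  eq : ∀ a d → 2 * (a * (a + d)) + d * d ≡ a * a + (a + d) * (a + d)
  eq = solve-∀
2ab≤a²+b² a b | inj₂ b≤a with m≤n⇒∃[o]m+o≡n b≤a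
...   | d , refl = ≤-trans (m≤m+n _ (d * d)) (≤-reflexive (eq b d))
  where
  eq : ∀ a d → 2 * ((a + d) * a) + d * d ≡ (a + d) * (a + d) + a * a
  eq = solve-∀

-- Induction on the list. The cross term 2 x s of the square is bounded summand by summand with
-- `2ab≤a²+b²`, so no subtraction enters.
cauchy-schwarz : (L : List ι) (f : ι → ℕ) → ∑ L f * ∑ L f ≤ length L * ∑ L (λ i → f i * f i)
cauchy-schwarz []      f = z≤n
cauchy-schwarz (i ∷ L) f = begin
  (x + s) * (x + s)                          ≡⟨ eq₁ x s ⟩
  x * x + 2 * (x * s) + s * s                ≤⟨ +-mono-≤ (+-monoʳ-≤ (x * x) cross) (cauchy-schwarz L f) ⟩
  x * x + (l * (x * x) + q) + l * q          ≡⟨ eq₂ (x * x) l q ⟩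
  (1 + l) * (x * x + q)                      ∎
  where
  open ≤-Reasoning
  x = f i ; s = ∑ L f ; l = length L ; q = ∑ L (λ j → f j * f j)
  eq₁ : ∀ x s → (x + s) * (x + s) ≡ x * x + 2 * (x * s) + s * s
  eq₁ = solve-∀
  eq₂ : ∀ a l q → a + (l * a + q) + l * q ≡ (1 + l) * (a + q)
  eq₂ = solve-∀
  cross : 2 * (x * s) ≤ l * (x * x) + q
  cross = begin
    2 * (x * s)                            ≡⟨ *-assoc 2 x s ⟨
    2 * x * s                              ≡⟨ ∑-*ˡ L (2 * x) f ⟨
    ∑ L (λ j → 2 * x * f j)                ≤⟨ ∑-mono L (λ {j} _ → ≤-trans (≤-reflexive (*-assoc 2 x (f j))) (2ab≤a²+b² x (f j))) ⟩
    ∑ L (λ j → x * x + f j * f j)          ≡⟨ ∑-+ L (λ _ → x * x) (λ j → f j * f j) ⟩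
    ∑ L (λ _ → x * x) + q                  ≡⟨ cong (_+ q) (∑-const L (x * x)) ⟩
    l * (x * x) + q                        ∎

-- Cauchy–Schwarz for the fibres of f.
collisions : (L : List ι) (M : List κ) → Unique M → (_≟_ : DecidableEquality κ) (f : ι → κ) →
  (∀ {i} → i L.∈ L → f i L.∈ M) →
  length L * length L ≤ length M * ∑ L (λ i → ∑ L (λ j → 𝟙 (f i ≟ f j)))
collisions L M uM _≟_ f f∈M = begin
  length L * length L                   ≤⟨ *-mono-≤ L≤ L≤ ⟩
  ∑ M r * ∑ M r                         ≤⟨ cauchy-schwarz M r ⟩
  length M * ∑ M (λ z → r z * r z)      ≤⟨ *-monoʳ-≤ (length M) squares ⟩
  length M * ∑ L (λ i → ∑ L (λ j → 𝟙 (f i ≟ f j))) ∎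
  where
  open ≤-Reasoning
  r : _ → ℕ
  r z = ∑ L (λ i → 𝟙 (f i ≟ z))
  L≤ : length L ≤ ∑ M r
  L≤ = begin
    length L                               ≡⟨ *-identityʳ _ ⟨
    length L * 1                           ≡⟨ ∑-const L 1 ⟨
    ∑ L (λ _ → 1)                          ≤⟨ ∑-mono L (λ i∈L → 1≤∑-𝟙 M (_ ≟_) (f∈M i∈L) refl) ⟩
    ∑ L (λ i → ∑ M (λ z → 𝟙 (f i ≟ z)))    ≡⟨ ∑-swap L M _ ⟩
    ∑ M r                                  ∎
  product≤ : ∀ i j → ∑ M (λ z → 𝟙 (f i ≟ z) * 𝟙 (f j ≟ z)) ≤ 𝟙 (f i ≟ f j)
  product≤ i j with f i ≟ f j
  ... | yes eq = ≤-trans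
        (∑-mono M {g = λ z → 𝟙 (f i ≟ z)} (λ {z} _ → ≤-trans
          (*-monoʳ-≤ (𝟙 (f i ≟ z)) (𝟙≤1 (f j ≟ z))) (≤-reflexive (*-identityʳ _))))
        (∑-𝟙≤1 uM (f i ≟_) (λ p q → trans (sym p) q))
  ... | no ≢ = ≤-trans
        (∑-mono M {g = λ _ → 0} (λ {z} _ → ≤-reflexive (zero-product z)))
        (≤-reflexive (trans (∑-const M 0) (*-zeroʳ (length M))))
    where
    zero-product : ∀ z → 𝟙 (f i ≟ z) * 𝟙 (f j ≟ z) ≡ 0
    zero-product z with f i ≟ z | f j ≟ z
    ... | yes p | yes q = contradiction (trans p (sym q)) ≢
    ... | yes _ | no  _ = refl
    ... | no  _ | _     = refl
  squares : ∑ M (λ z → r z * r z) ≤ ∑ L (λ i → ∑ L (λ j → 𝟙 (f i ≟ f j)))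
  squares = begin
    ∑ M (λ z → r z * r z)
      ≡⟨ ∑-cong M (λ z → trans (sym (∑-*ˡ L (r z) _)) (∑-cong L λ i → trans (*-comm (r z) _) (sym (∑-*ˡ L (𝟙 (f i ≟ z)) (λ j → 𝟙 (f j ≟ z)))))) ⟩
    ∑ M (λ z → ∑ L (λ i → ∑ L (λ j → 𝟙 (f i ≟ z) * 𝟙 (f j ≟ z))))
      ≡⟨ ∑-swap M L _ ⟩
    ∑ L (λ i → ∑ M (λ z → ∑ L (λ j → 𝟙 (f i ≟ z) * 𝟙 (f j ≟ z))))
      ≡⟨ ∑-cong L (λ i → ∑-swap M L _) ⟩
    ∑ L (λ i → ∑ L (λ j → ∑ M (λ z → 𝟙 (f i ≟ z) * 𝟙 (f j ≟ z))))
      ≤⟨ ∑-mono L (λ {i} _ → ∑-mono L (λ {j} _ → product≤ i j)) ⟩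
    ∑ L (λ i → ∑ L (λ j → 𝟙 (f i ≟ f j))) ∎

-- Finite subsets: enumeration and cardinality

elems : Subset ν → List (Fin ν)
elems []          = []
elems (true  ∷ A) = zero ∷ map suc (elems A)
elems (false ∷ A) = map suc (elems A)

length-elems : (A : Subset ν) → length (elems A) ≡ ∣ A ∣
length-elems []          = refl
length-elems (true  ∷ A) = cong suc (trans (length-map suc (elems A)) (length-elems A))
length-elems (false ∷ A) = trans (length-map suc (elems A)) (length-elems A)

∈-elems⁺ : {A : Subset ν} {x : Fin ν} → x ∈ A → x L.∈ elems A
∈-elems⁺ {A = true  ∷ A} here      = here refl
∈-elems⁺ {A = true  ∷ A} (there x) = there (∈-map⁺ suc (∈-elems⁺ x))
∈-elems⁺ {A = false ∷ A} (there x) = ∈-map⁺ suc (∈-elems⁺ x)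

∈-elems⁻ : {A : Subset ν} {x : Fin ν} → x L.∈ elems A → x ∈ A
∈-elems⁻ {A = true  ∷ A} (here refl) = here
∈-elems⁻ {A = true  ∷ A} (there x)   with ∈-map⁻ suc x
... | _ , y , refl = there (∈-elems⁻ y)
∈-elems⁻ {A = false ∷ A} x           with ∈-map⁻ suc x
... | _ , y , refl = there (∈-elems⁻ y)

elems-unique : (A : Subset ν) → Unique (elems A)
elems-unique []          = []
elems-unique (true  ∷ A) = All.map⁺ (All.universal (λ _ ()) (elems A)) ∷ Unique.map⁺ suc-injective (elems-unique A)
elems-unique (false ∷ A) = Unique.map⁺ suc-injective (elems-unique A)

∑-⊆ : {A B : Subset ν} → A ⊆ B → (f : Fin ν → ℕ) → ∑ (elems A) f ≤ ∑ (elems B) f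
∑-⊆ {A = []} {[]} A⊆B f = z≤n
∑-⊆ {A = s ∷ A} {t ∷ B} A⊆B f with ≤-trans (≤-reflexive (∑-map suc (elems A) f))
  (≤-trans (∑-⊆ {A = A} {B} (drop-∷-⊆ A⊆B) (f ∘ suc)) (≤-reflexive (sym (∑-map suc (elems B) f))))
∑-⊆ {A = false ∷ A} {false ∷ B} A⊆B f | le = le
∑-⊆ {A = false ∷ A} {true  ∷ B} A⊆B f | le = ≤-trans le (m≤n+m _ _)
∑-⊆ {A = true  ∷ A} {true  ∷ B} A⊆B f | le = +-monoʳ-≤ (f zero) le
∑-⊆ {A = true  ∷ A} {false ∷ B} A⊆B f | le with () ← A⊆B here

∑-1 : (A : Subset ν) → ∑ (elems A) (λ _ → 1) ≡ ∣ A ∣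
∑-1 A = trans (∑-const (elems A) 1) (trans (*-identityʳ _) (length-elems A))

length-product : (L : List ι) (K : List κ) → length (cartesianProduct L K) ≡ length L * length K
length-product []      K = refl
length-product (i ∷ L) K = trans (length-++ (map (i ,_) K)) (cong₂ _+_ (length-map (i ,_) K) (length-product L K))

setOp? : (f : Fin ν → Fin ν → Fin ν) (A B : Subset ν) →
  ∀ x → Dec (∃₂ λ a b → a ∈ A × b ∈ B × f a b ≡ x)
setOp? f A B x = any? λ a → any? λ b → (a ∈? A) ×-dec ((b ∈? B) ×-dec (f a b ≟ x))

abstract
  -- Abstract, so that a set given by a nested search stays opaque to conversion; it is accessible
  -- only through its membership lemmas, and `setOp-⟪⟫` links it to the tabulated `setOp`.
  ⟪_⟫ : {P : Fin ν → Set} → (∀ x → Dec (P x)) → Subset ν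
  ⟪ P? ⟫ = tabulate (does ∘ P?)

  ∈-⟪⟫⁺ : {P : Fin ν → Set} (P? : ∀ x → Dec (P x)) → ∀ {x} → P x → x ∈ ⟪ P? ⟫
  ∈-⟪⟫⁺ P? {x} px = lookup⇒[]= x _ (trans (lookup∘tabulate _ x) (dec-true (P? x) px))

  ∈-⟪⟫⁻ : {P : Fin ν → Set} (P? : ∀ x → Dec (P x)) → ∀ {x} → x ∈ ⟪ P? ⟫ → P x
  ∈-⟪⟫⁻ P? {x} x∈ with P? x | trans (sym (lookup∘tabulate (does ∘ P?) x)) ([]=⇒lookup x∈)
  ... | yes px | _ = px
  ... | no  _  | ()

  setOp-⟪⟫ : (f : Fin ν → Fin ν → Fin ν) (A B : Subset ν) → setOp f A B ≡ ⟪ setOp? f A B ⟫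
  setOp-⟪⟫ f A B = refl

module _ (f : Fin ν → Fin ν → Fin ν) {A B : Subset ν} where

  ∈-setOp⁺ : ∀ {a b x} → a ∈ A → b ∈ B → f a b ≡ x → x ∈ setOp f A B
  ∈-setOp⁺ {x = x} a∈A b∈B eq =
    subst (x ∈_) (sym (setOp-⟪⟫ f A B)) (∈-⟪⟫⁺ (setOp? f A B) (_ , _ , a∈A , b∈B , eq))

  ∈-setOp⁻ : ∀ {x} → x ∈ setOp f A B → ∃₂ λ a b → a ∈ A × b ∈ B × f a b ≡ x
  ∈-setOp⁻ {x} x∈ = ∈-⟪⟫⁻ (setOp? f A B) (subst (x ∈_) (setOp-⟪⟫ f A B) x∈)

setOp-mono : (f : Fin ν → Fin ν → Fin ν) {A A′ B B′ : Subset ν} → A ⊆ A′ → B ⊆ B′ →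
  setOp f A B ⊆ setOp f A′ B′
setOp-mono f A⊆ B⊆ x∈ = let a , b , a∈ , b∈ , eq = ∈-setOp⁻ f x∈ in ∈-setOp⁺ f (A⊆ a∈) (B⊆ b∈) eq

∣∣≤length : (A : Subset ν) (K : List κ) {R : Fin ν → κ → Set} (R? : ∀ i j → Dec (R i j)) →
  (∀ {i} → i ∈ A → ∃ λ j → j L.∈ K × R i j) → (∀ {i i′ j} → R i j → R i′ j → i ≡ i′) →
  ∣ A ∣ ≤ length K
∣∣≤length A K R? total inj = ≤-trans (≤-reflexive (sym (length-elems A)))
  (length-≤ (elems-unique A) R? (total ∘ ∈-elems⁻) inj)

pairs : Subset ν → Subset ν → List (Fin ν × Fin ν)
pairs A B = cartesianProduct (elems A) (elems B)

length-pairs : (A B : Subset ν) → length (pairs A B) ≡ ∣ A ∣ * ∣ B ∣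
length-pairs A B = trans (length-product (elems A) (elems B)) (cong₂ _*_ (length-elems A) (length-elems B))

∈-pairs⁺ : {A B : Subset ν} {a b : Fin ν} → a ∈ A → b ∈ B → (a , b) L.∈ pairs A B
∈-pairs⁺ a∈A b∈B = ∈-cartesianProduct⁺ (∈-elems⁺ a∈A) (∈-elems⁺ b∈B)

∣setOp∣≤ : (f : Fin ν → Fin ν → Fin ν) (A B : Subset ν) → ∣ setOp f A B ∣ ≤ ∣ A ∣ * ∣ B ∣
∣setOp∣≤ f A B = ≤-trans
  (∣∣≤length (setOp f A B) (pairs A B) (λ x ab → uncurry f ab ≟ x)
    (λ x∈ → let a , b , a∈A , b∈B , eq = ∈-setOp⁻ f x∈ in (a , b) , ∈-pairs⁺ a∈A b∈B , eq)
    (λ p q → trans (sym p) q))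
  (≤-reflexive (length-pairs A B))

∣∪∣+∣∩∣ : (A B : Subset ν) → ∣ A ∪ B ∣ + ∣ A ∩ B ∣ ≡ ∣ A ∣ + ∣ B ∣
∣∪∣+∣∩∣ []          []          = refl
∣∪∣+∣∩∣ (true  ∷ A) (true  ∷ B) = cong suc (trans (+-suc _ _) (trans (cong suc (∣∪∣+∣∩∣ A B)) (sym (+-suc _ _))))
∣∪∣+∣∩∣ (true  ∷ A) (false ∷ B) = cong suc (∣∪∣+∣∩∣ A B)
∣∪∣+∣∩∣ (false ∷ A) (true  ∷ B) = trans (cong suc (∣∪∣+∣∩∣ A B)) (sym (+-suc _ _))
∣∪∣+∣∩∣ (false ∷ A) (false ∷ B) = ∣∪∣+∣∩∣ A B

∣∪∣≤ : (A B : Subset ν) → ∣ A ∪ B ∣ ≤ ∣ A ∣ + ∣ B ∣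
∣∪∣≤ A B = ≤-trans (m≤m+n _ _) (≤-reflexive (∣∪∣+∣∩∣ A B))

disjoint-∪ : (A B : Subset ν) → (∀ {x} → x ∈ A → x ∉ B) → ∣ A ∪ B ∣ ≡ ∣ A ∣ + ∣ B ∣
disjoint-∪ {ν} A B disj = trans (sym (+-identityʳ _)) (trans (cong (∣ A ∪ B ∣ +_) (sym empty)) (∣∪∣+∣∩∣ A B))
  where
  empty : ∣ A ∩ B ∣ ≡ 0
  empty = trans (cong ∣_∣ (Empty-unique λ { (x , x∈) → let a , b = x∈p∩q⁻ A B x∈ in disj a b })) (∣⊥∣≡0 ν)

─-notin : (A B : Subset ν) {x : Fin ν} → x ∈ A ─ B → x ∉ B
─-notin (_ ∷ A) (_    ∷ B) (there x∈) (there y∈) = ─-notin A B x∈ y∈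
─-notin (true ∷ A) (true ∷ B) () here
─-notin (false ∷ A) (true ∷ B) () here

∣─∣+∣∩∣ : (A B : Subset ν) → ∣ A ─ B ∣ + ∣ A ∩ B ∣ ≡ ∣ A ∣
∣─∣+∣∩∣ []          []          = refl
∣─∣+∣∩∣ (true  ∷ A) (true  ∷ B) = trans (+-suc _ _) (cong suc (∣─∣+∣∩∣ A B))
∣─∣+∣∩∣ (true  ∷ A) (false ∷ B) = cong suc (∣─∣+∣∩∣ A B)
∣─∣+∣∩∣ (false ∷ A) (true  ∷ B) = ∣─∣+∣∩∣ A B
∣─∣+∣∩∣ (false ∷ A) (false ∷ B) = ∣─∣+∣∩∣ A B

Nonempty⇒∣∣>0 : {A : Subset ν} → Nonempty A → 0 < ∣ A ∣
Nonempty⇒∣∣>0 {A = A} (x , x∈A) = ≤-trans (≤-reflexive (sym (∣⁅x⁆∣≡1 x)))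
  (p⊆q⇒∣p∣≤∣q∣ λ y∈ → subst (_∈ A) (sym (x∈⁅y⁆⇒x≡y x y∈)) x∈A)

∣∣>0⇒Nonempty : (A : Subset ν) → 0 < ∣ A ∣ → Nonempty A
∣∣>0⇒Nonempty {ν} A 0<∣A∣ with nonempty? A
... | yes ne = ne
... | no  em = contradiction (subst (λ B → 0 < ∣ B ∣) (Empty-unique em) 0<∣A∣)
  (subst (λ k → ¬ 0 < k) (sym (∣⊥∣≡0 ν)) λ ())

-- Greedy selection and coverings

greedy : {S : Set} (P Q : S → Set) (μ : S → ℕ) (b : ℕ) → (∀ s → μ s ≤ b) →
  (∀ s → P s → Q s ⊎ ∃ λ s′ → P s′ × μ s < μ s′) → ∀ s → P s → ∃ λ s → P s × Q s
greedy {S} P Q μ b bounded step s₀ = go s₀ (<-wellFounded _)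
  where
  -- The distance of μ from its bound falls with every step, so the iteration ends, and it can only
  -- end where Q holds.
  go : ∀ s → Acc _<_ (b ∸ μ s) → P s → ∃ λ s → P s × Q s
  go s (acc rec) ps with step s ps
  ... | inj₁ qs = s , ps , qs
  ... | inj₂ (s′ , ps′ , μ<) = go s′ (rec (∸-monoʳ-< μ< (bounded s′))) ps′

sift : (X : Subset ν) {P : Fin ν → Set} → (∀ x → Dec (P x)) → Subset ν
sift X P? = ⟪ (λ x → (x ∈? X) ×-dec P? x) ⟫

module _ {X : Subset ν} {P : Fin ν → Set} (P? : ∀ x → Dec (P x)) where

  ∈-sift⁺ : ∀ {x} → x ∈ X → P x → x ∈ sift X P?
  ∈-sift⁺ x∈X px = ∈-⟪⟫⁺ (λ x → (x ∈? X) ×-dec P? x) (x∈X , px)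

  ∈-sift⁻ : ∀ {x} → x ∈ sift X P? → x ∈ X × P x
  ∈-sift⁻ = ∈-⟪⟫⁻ (λ x → (x ∈? X) ×-dec P? x)

  ∑-sift : ∑ (elems X) (λ x → 𝟙 (P? x)) ≤ ∣ sift X P? ∣
  ∑-sift = begin
    ∑ (elems X) (λ x → 𝟙 (P? x))
      ≤⟨ ∑-mono (elems X) (λ {x} x∈X → hit x (∈-elems⁻ x∈X)) ⟩
    ∑ (elems X) (λ x → ∑ (elems S) (λ y → 𝟙 (x ≟ y)))
      ≡⟨ ∑-swap (elems X) (elems S) _ ⟩
    ∑ (elems S) (λ y → ∑ (elems X) (λ x → 𝟙 (x ≟ y)))
      ≤⟨ ∑-mono (elems S) (λ {y} _ → ∑-𝟙≤1 (elems-unique X) (_≟ y) λ p q → trans p (sym q)) ⟩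
    ∑ (elems S) (λ _ → 1)
      ≡⟨ ∑-1 S ⟩
    ∣ S ∣ ∎
    where
    open ≤-Reasoning
    S = sift X P?
    hit : ∀ x → x ∈ X → 𝟙 (P? x) ≤ ∑ (elems S) (λ y → 𝟙 (x ≟ y))
    hit x x∈X with P? x
    ... | no  _  = z≤n
    ... | yes px = 1≤∑-𝟙 (elems S) (x ≟_) (∈-elems⁺ (∈-sift⁺ x∈X px)) refl

sift⊆ : (X : Subset ν) {P : Fin ν → Set} (P? : ∀ x → Dec (P x)) → sift X P? ⊆ X
sift⊆ X P? x∈ = proj₁ (∈-sift⁻ P? x∈)

-- When a solution is unique, a sum over solutions may be replaced by the indicator that one exists;
-- this turns energies into cardinalities.
∑-𝟙≤𝟙 : {L : List ι} → Unique L → {R : ι → Set} (R? : ∀ i → Dec (R i)) →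
  (∀ {i j} → R i → R j → i ≡ j) → {Q : Set} (Q? : Dec Q) → (∀ {i} → i L.∈ L → R i → Q) →
  ∑ L (λ i → 𝟙 (R? i)) ≤ 𝟙 Q?
∑-𝟙≤𝟙 uL R? uniq (yes _) R⇒Q = ∑-𝟙≤1 uL R? uniq
∑-𝟙≤𝟙 {L = L} uL R? uniq (no ¬q) R⇒Q = ≤-trans
  (∑-mono L {g = λ _ → 0} λ {i} i∈L → ≤-reflexive (𝟙-no (R? i) (¬q ∘ R⇒Q i∈L)))
  (≤-reflexive (trans (∑-const L 0) (*-zeroʳ (length L))))

-- Here ρ t u s stands for "u lies in the translate of S by t, at the point given by s".
module Covering (U S : Subset ν) (N M : ℕ) (neU : Nonempty U) (0<N : 0 < N) (N≤∣S∣ : N ≤ ∣ S ∣)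
  {ρ : Fin ν → Fin ν → Fin ν → Set} (ρ? : ∀ t u s → Dec (ρ t u s))
  (functional : ∀ {t u s s′} → ρ t u s → ρ t u s′ → s ≡ s′)
  (popular : ∀ Y → Y ⊆ U → Nonempty Y → ∃ λ t →
    ∣ Y ∣ * ∣ S ∣ ≤ M * ∑ (elems Y) (λ u → ∑ (elems S) (λ s → 𝟙 (ρ? t u s)))) where

  In : Fin ν → Fin ν → Set
  In t u = ∃ λ s → s ∈ S × ρ t u s

  In? : ∀ t u → Dec (In t u)
  In? t u = any? λ s → (s ∈? S) ×-dec ρ? t u s

  Covered : Subset ν → Fin ν → Set
  Covered T u = ∃ λ t → t ∈ T × In t u

  covered? : ∀ T u → Dec (Covered T u)
  covered? T u = any? λ t → (t ∈? T) ×-dec In? t u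

  covered : Subset ν → Subset ν
  covered T = sift U (covered? T)

  -- While Q fails, more than a quarter of U is uncovered, so a translate popular for the remainder
  -- gains at least N |U| / 4M points. P adds up these gains, and as no more than |U| points can be
  -- covered, it bounds the number of translates by 4M / N. A quarter is small enough that two such
  -- coverings still share half of U.
  P Q : Subset ν → Set
  P T = ∣ T ∣ * N * ∣ U ∣ ≤ ∣ covered T ∣ * (M * 4)
  Q T = 4 * ∣ U ─ covered T ∣ ≤ ∣ U ∣

  popular-translate : ∀ Y → Y ⊆ U → Nonempty Y → ∃ λ t → ∣ Y ∣ * ∣ S ∣ ≤ M * ∣ sift Y (In? t) ∣
  popular-translate Y Y⊆U neY = let t , le = popular Y Y⊆U neY in t , ≤-trans le (*-monoʳ-≤ M
    (≤-trans
      (∑-mono (elems Y) λ {u} _ → ∑-𝟙≤𝟙 (elems-unique S) (ρ? t u) functional (In? t u)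
        λ {s} s∈S r → s , ∈-elems⁻ s∈S , r)
      (∑-sift (In? t))))

  step : ∀ T → P T → Q T ⊎ ∃ λ T′ → P T′ × ∣ covered T ∣ < ∣ covered T′ ∣
  step T pT with 4 * ∣ U ─ covered T ∣ ≤? ∣ U ∣
  ... | yes q = inj₁ q
  ... | no  ≰ = inj₂ (extend (popular-translate Y Y⊆U neY))
    where
    open ≤-Reasoning
    Y = U ─ covered T
    Y⊆U : Y ⊆ U
    Y⊆U = p─q⊆p U (covered T)
    0<∣Y∣ : 0 < ∣ Y ∣
    0<∣Y∣ = n≢0⇒n>0 λ ∣Y∣≡0 → ≰ (≤-trans (≤-reflexive (cong (4 *_) ∣Y∣≡0)) z≤n)
    neY : Nonempty Y
    neY = ∣∣>0⇒Nonempty Y 0<∣Y∣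
    extend : (∃ λ t → ∣ Y ∣ * ∣ S ∣ ≤ M * ∣ sift Y (In? t) ∣) → ∃ λ T′ → P T′ × ∣ covered T ∣ < ∣ covered T′ ∣
    extend (t , le) = T′ , pT′ , ≤-trans (m<m+n ∣ covered T ∣ 0<∣Yₜ∣) more
      where
      T′ = T ∪ ⁅ t ⁆
      Yₜ = sift Y (In? t)
      0<∣Yₜ∣ : 0 < ∣ Yₜ ∣
      0<∣Yₜ∣ = n≢0⇒n>0 λ ∣Yₜ∣≡0 → contradiction (begin-strict
        0                  <⟨ *-mono-< 0<∣Y∣ (≤-trans 0<N N≤∣S∣) ⟩
        ∣ Y ∣ * ∣ S ∣      ≤⟨ le ⟩
        M * ∣ Yₜ ∣         ≡⟨ cong (M *_) ∣Yₜ∣≡0 ⟩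
        M * 0              ≡⟨ *-zeroʳ M ⟩
        0                  ∎) λ ()
      include : covered T ∪ Yₜ ⊆ covered T′
      include x∈ with x∈p∪q⁻ (covered T) Yₜ x∈
      ... | inj₁ x∈T = let x∈U , t₀ , t₀∈ , i = ∈-sift⁻ (covered? T) x∈T in
              ∈-sift⁺ (covered? T′) x∈U (t₀ , x∈p∪q⁺ (inj₁ t₀∈) , i)
      ... | inj₂ x∈Y = let x∈Y′ , i = ∈-sift⁻ (In? t) x∈Y in
              ∈-sift⁺ (covered? T′) (Y⊆U x∈Y′) (t , x∈p∪q⁺ (inj₂ (x∈⁅x⁆ t)) , i)
      more : ∣ covered T ∣ + ∣ Yₜ ∣ ≤ ∣ covered T′ ∣
      more = begin
        ∣ covered T ∣ + ∣ Yₜ ∣     ≡⟨ disjoint-∪ (covered T) Yₜ (λ x∈T x∈Y → ─-notin U (covered T) (sift⊆ Y (In? t) x∈Y) x∈T) ⟨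
        ∣ covered T ∪ Yₜ ∣         ≤⟨ p⊆q⇒∣p∣≤∣q∣ include ⟩
        ∣ covered T′ ∣             ∎
      pT′ : P T′
      pT′ = begin
        ∣ T′ ∣ * N * ∣ U ∣                       ≤⟨ *-monoˡ-≤ ∣ U ∣ (*-monoˡ-≤ N (≤-trans (∣∪∣≤ T ⁅ t ⁆) (≤-reflexive (cong (∣ T ∣ +_) (∣⁅x⁆∣≡1 t))))) ⟩
        (∣ T ∣ + 1) * N * ∣ U ∣                  ≡⟨ eq₁ (∣ T ∣) N (∣ U ∣) ⟩
        ∣ T ∣ * N * ∣ U ∣ + N * ∣ U ∣            ≤⟨ +-mono-≤ pT (*-mono-≤ N≤∣S∣ (<⇒≤ (≰⇒> ≰))) ⟩
        ∣ covered T ∣ * (M * 4) + ∣ S ∣ * (4 * ∣ Y ∣)   ≡⟨ cong (∣ covered T ∣ * (M * 4) +_) (eq₂ ∣ S ∣ ∣ Y ∣) ⟩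
        ∣ covered T ∣ * (M * 4) + ∣ Y ∣ * ∣ S ∣ * 4     ≤⟨ +-monoʳ-≤ (∣ covered T ∣ * (M * 4)) (*-monoˡ-≤ 4 le) ⟩
        ∣ covered T ∣ * (M * 4) + M * ∣ Yₜ ∣ * 4        ≡⟨ eq₃ (∣ covered T ∣) (∣ Yₜ ∣) M ⟩
        (∣ covered T ∣ + ∣ Yₜ ∣) * (M * 4)              ≤⟨ *-monoˡ-≤ (M * 4) more ⟩
        ∣ covered T′ ∣ * (M * 4)                 ∎
        where
        eq₁ : ∀ t ν u → (t + 1) * ν * u ≡ t * ν * u + ν * u
        eq₁ = solve-∀
        eq₂ : ∀ s y → s * (4 * y) ≡ y * s * 4
        eq₂ = solve-∀
        eq₃ : ∀ c y m → c * (m * 4) + m * y * 4 ≡ (c + y) * (m * 4)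
        eq₃ = solve-∀

  cover : ∃₂ λ T V → V ⊆ U × ∣ T ∣ * N ≤ M * 4 × 3 * ∣ U ∣ ≤ 4 * ∣ V ∣ ×
    (∀ {v} → v ∈ V → ∃₂ λ t s → t ∈ T × s ∈ S × ρ t v s)
  cover = finish (greedy P Q (∣_∣ ∘ covered) ν (∣p∣≤n ∘ covered) step ⊥
      (≤-trans (≤-reflexive (cong (λ k → k * N * ∣ U ∣) (∣⊥∣≡0 ν))) z≤n))
    where
    open ≤-Reasoning
    finish : (∃ λ T → P T × Q T) → ∃₂ λ T V → V ⊆ U × ∣ T ∣ * N ≤ M * 4 × 3 * ∣ U ∣ ≤ 4 * ∣ V ∣ ×
      (∀ {v} → v ∈ V → ∃₂ λ t s → t ∈ T × s ∈ S × ρ t v s)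
    finish (T , pT , qT) = T , covered T , sift⊆ U (covered? T) , few , most ,
      λ v∈ → let _ , t , t∈T , s , s∈S , r = ∈-sift⁻ (covered? T) v∈ in t , s , t∈T , s∈S , r
      where
      few : ∣ T ∣ * N ≤ M * 4
      few = *-cancelʳ-≤ _ _ ∣ U ∣ {{>-nonZero (Nonempty⇒∣∣>0 neU)}} (begin
        ∣ T ∣ * N * ∣ U ∣          ≤⟨ pT ⟩
        ∣ covered T ∣ * (M * 4)    ≤⟨ *-monoˡ-≤ (M * 4) (p⊆q⇒∣p∣≤∣q∣ (sift⊆ U (covered? T))) ⟩
        ∣ U ∣ * (M * 4)            ≡⟨ *-comm ∣ U ∣ (M * 4) ⟩
        M * 4 * ∣ U ∣              ∎)
      most : 3 * ∣ U ∣ ≤ 4 * ∣ covered T ∣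
      most = +-cancelˡ-≤ ∣ U ∣ _ _ (begin
        4 * ∣ U ∣                                           ≡⟨ cong (4 *_) (∣─∣+∣∩∣ U (covered T)) ⟨
        4 * (∣ U ─ covered T ∣ + ∣ U ∩ covered T ∣)         ≡⟨ *-distribˡ-+ 4 (∣ U ─ covered T ∣) (∣ U ∩ covered T ∣) ⟩
        4 * ∣ U ─ covered T ∣ + 4 * ∣ U ∩ covered T ∣       ≤⟨ +-mono-≤ qT (*-monoʳ-≤ 4 (∣p∩q∣≤∣q∣ U (covered T))) ⟩
        ∣ U ∣ + 4 * ∣ covered T ∣                           ∎)

-- A pigeonhole principle without logarithmic loss

-- The ceiling of (b + 1) / a is one more than b / a rounded down. Its minimality turns a threshold
-- for a multiple of f into an integral threshold N for f, without losing an element of the level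
-- set.
ceiling-quotient : ∀ a b .{{_ : NonZero a}} → ∃ λ N → b ≤ a * N × (∀ k → b ≤ a * k → N ≤ k)
ceiling-quotient a zero    = 0 , z≤n , λ _ _ → z≤n
ceiling-quotient a (suc b) = suc (b / a) , upper , λ k b<ak → *-cancelˡ-< a (b / a) k
  (≤-trans (s≤s (≤-trans (≤-reflexive (*-comm a (b / a))) (m/n*n≤m b a))) b<ak)
  where
  open ≤-Reasoning
  upper : b < a * suc (b / a)
  upper = begin-strict
    b                       ≡⟨ m≡m%n+[m/n]*n b a ⟩
    b % a + b / a * a       <⟨ +-monoˡ-< (b / a * a) (m%n<n b a) ⟩
    a + b / a * a           ≡⟨ cong (a +_) (*-comm (b / a) a) ⟩
    a + a * (b / a)         ≡⟨ *-suc a (b / a) ⟨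
    a * suc (b / a)         ∎

n<2^n : ∀ n → n < 2 ^ n
n<2^n zero    = s≤s z≤n
n<2^n (suc n) = begin-strict
  suc n             ≤⟨ n<2^n n ⟩
  2 ^ n             <⟨ m<m+n (2 ^ n) (m^n>0 2 n) ⟩
  2 ^ n + 2 ^ n     ≡⟨ cong (2 ^ n +_) (+-identityʳ (2 ^ n)) ⟨
  2 ^ suc n         ∎
  where open ≤-Reasoning

module _ {I : Set} (q : ℕ) where

  layers : ℕ → ℕ → ℕ
  layers zero    v = 0
  layers (suc J) v = layers J v + 2 ^ J * 𝟙 (2 ^ J * q ≤? v)

  -- The cap rises from 2^J q to twice that, and the growth is paid for by the layer of weight 2^J.
  -- The summand 1 pays for values below q, which reach no layer.
  layer-cake : ∀ J v → v ⊓ (2 ^ J * q) ≤ q * (1 + layers J v)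
  layer-cake zero    v = ≤-trans (m⊓n≤n v (1 * q)) (≤-reflexive (*-comm 1 q))
  layer-cake (suc J) v with 2 ^ J * q ≤? v
  ... | yes le = begin
    v ⊓ (2 ^ suc J * q)                  ≤⟨ m⊓n≤n v _ ⟩
    2 * 2 ^ J * q                        ≡⟨ eq₁ (2 ^ J) q ⟩
    2 ^ J * q + 2 ^ J * q                ≡⟨ cong (_+ 2 ^ J * q) (m≥n⇒m⊓n≡n le) ⟨
    v ⊓ (2 ^ J * q) + 2 ^ J * q          ≤⟨ +-monoˡ-≤ _ (layer-cake J v) ⟩
    q * (1 + layers J v) + 2 ^ J * q     ≡⟨ eq₂ q (layers J v) (2 ^ J) ⟩
    q * (1 + (layers J v + 2 ^ J * 1))   ∎
    where
    open ≤-Reasoning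
    eq₁ : ∀ u q → 2 * u * q ≡ u * q + u * q
    eq₁ = solve-∀
    eq₂ : ∀ q l u → q * (1 + l) + u * q ≡ q * (1 + (l + u * 1))
    eq₂ = solve-∀
  ... | no ≰ = begin
    v ⊓ (2 ^ suc J * q)                  ≤⟨ m⊓n≤m v _ ⟩
    v                                    ≡⟨ m≤n⇒m⊓n≡m (<⇒≤ (≰⇒> ≰)) ⟨
    v ⊓ (2 ^ J * q)                      ≤⟨ layer-cake J v ⟩
    q * (1 + layers J v)                 ≡⟨ cong (λ l → q * (1 + l)) (trans (cong (layers J v +_) (*-zeroʳ (2 ^ J))) (+-identityʳ _)) ⟨
    q * (1 + (layers J v + 2 ^ J * 0))   ∎
    where open ≤-Reasoning

  module _ (L : List I) (v : I → ℕ) where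

    level : ℕ → ℕ
    level j = ∑ L (λ i → 𝟙 (2 ^ j * q ≤? v i))

    levels : ℕ → ℕ
    levels zero    = 0
    levels (suc J) = levels J + 2 ^ J * level J

    ∑-layers : ∀ J → ∑ L (λ i → layers J (v i)) ≡ levels J
    ∑-layers zero    = trans (∑-const L 0) (*-zeroʳ (length L))
    ∑-layers (suc J) = trans (∑-+ L (λ i → layers J (v i)) _) (cong₂ _+_ (∑-layers J) (∑-*ˡ L (2 ^ J) _))

    -- The weights (4/5)^j have bounded sum 5, so no logarithm is lost.
    search : ∀ x J → (∃ λ j → 2 ^ j * x ≤ 5 * 5 ^ j * level j) ⊎ (5 ^ J * levels J + 2 ^ J * 2 ^ J * x ≤ 5 ^ J * x)
    search x zero    = inj₂ ≤-refl
    search x (suc J) with search x J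
    ... | inj₁ found = inj₁ found
    ... | inj₂ small with 2 ^ J * x ≤? 5 * 5 ^ J * level J
    ...   | yes le = inj₁ (J , le)
    ...   | no  ≰  = inj₂ (begin
      5 * w * (levels J + u * level J) + 2 * u * (2 * u) * x      ≡⟨ eq₁ u w (levels J) (level J) x ⟩
      5 * (w * levels J) + u * (5 * w * level J) + 4 * (u * u * x) ≤⟨ +-monoˡ-≤ _ (+-monoʳ-≤ (5 * (w * levels J)) (*-monoʳ-≤ u (<⇒≤ (≰⇒> ≰)))) ⟩
      5 * (w * levels J) + u * (u * x) + 4 * (u * u * x)          ≡⟨ eq₂ u w (levels J) x ⟩
      5 * (w * levels J + u * u * x)                              ≤⟨ *-monoʳ-≤ 5 small ⟩
      5 * (w * x)                                                 ≡⟨ *-assoc 5 w x ⟨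
      5 * w * x                                                   ∎)
      where
      open ≤-Reasoning
      u = 2 ^ J ; w = 5 ^ J
      eq₁ : ∀ u w s l x → 5 * w * (s + u * l) + 2 * u * (2 * u) * x ≡ 5 * (w * s) + u * (5 * w * l) + 4 * (u * u * x)
      eq₁ = solve-∀
      eq₂ : ∀ u w s x → 5 * (w * s) + u * (u * x) + 4 * (u * u * x) ≡ 5 * (w * s + u * u * x)
      eq₂ = solve-∀

    -- Without a popular level, `search` gives levels J ≤ (1 - (4/5)^J) x, which is less than x for
    -- every J. But for J = ∑ L v the cap 2^J q exceeds all values, and the layer cake yields x ≤
    -- levels J; the term `length L` in the hypothesis covers the 1 lost for each element.
    find-level : ∀ x → 0 < x → 0 < q → q * (x + length L) ≤ ∑ L v → ∃ λ j → 2 ^ j * x ≤ 5 * 5 ^ j * level j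
    find-level x 0<x 0<q large with search x (∑ L v)
    ... | inj₁ found = found
    ... | inj₂ small = contradiction (begin-strict
      5 ^ J * x                                 ≤⟨ *-monoʳ-≤ (5 ^ J) x≤levels ⟩
      5 ^ J * levels J                          <⟨ m<m+n _ (*-mono-< (*-mono-< (m^n>0 2 J) (m^n>0 2 J)) 0<x) ⟩
      5 ^ J * levels J + 2 ^ J * 2 ^ J * x      ≤⟨ small ⟩
      5 ^ J * x                                 ∎) (<-irrefl refl)
      where
      open ≤-Reasoning
      J = ∑ L v
      v≤ : ∀ {i} → i L.∈ L → v i ≤ q * (1 + layers J (v i))
      v≤ {i} i∈L = ≤-trans (≤-reflexive (sym (m≤n⇒m⊓n≡m (begin
        v i             ≤⟨ ∑-member L v i∈L ⟩
        J               ≤⟨ <⇒≤ (n<2^n J) ⟩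
        2 ^ J           ≡⟨ *-identityʳ _ ⟨
        2 ^ J * 1       ≤⟨ *-monoʳ-≤ (2 ^ J) 0<q ⟩
        2 ^ J * q       ∎)))) (layer-cake J (v i))
      x≤levels : x ≤ levels J
      x≤levels = +-cancelʳ-≤ (length L) _ _ (*-cancelˡ-≤ q {{>-nonZero 0<q}} (begin
        q * (x + length L)                               ≤⟨ large ⟩
        ∑ L v                                            ≤⟨ ∑-mono L v≤ ⟩
        ∑ L (λ i → q * (1 + layers J (v i)))             ≡⟨ ∑-*ˡ L q _ ⟩
        q * ∑ L (λ i → 1 + layers J (v i))               ≡⟨ cong (q *_) (∑-+ L (λ _ → 1) _) ⟩
        q * (∑ L (λ _ → 1) + ∑ L (λ i → layers J (v i))) ≡⟨ cong (q *_) (cong₂ _+_ (trans (∑-const L 1) (*-identityʳ _)) (∑-layers J)) ⟩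
        q * (length L + levels J)                        ≡⟨ cong (q *_) (+-comm (length L) (levels J)) ⟩
        q * (levels J + length L)                        ∎))

-- The energy controls N l, where l is the size of the level set, while the goal concerns N⁴ l³ = N
-- (N l)³. From one layer to the next N doubles and the guaranteed value of N l shrinks by 4/5 only;
-- as 2 (4/5)³ > 1, the spare factor N absorbs the decay. The constant 2000 is 5³ 2⁴.
popular-level : {I : Set} (L : List I) (f : I → ℕ) (M : ℕ) → 0 < length L → 0 < M →
  length L ^ 3 ≤ M * ∑ L f →
  ∃ λ N → length L ^ 11 ≤ N ^ 4 * ∑ L (λ i → 𝟙 (N ≤? f i)) ^ 3 * M ^ 4 * 2000
popular-level L f M 0<x 0<M energy = conclude (find-level (x * x) L v x 0<x (*-mono-< 0<x 0<x) large)
  where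
  open ≤-Reasoning
  x = length L
  v : _ → ℕ
  -- The factor 2 provides a total of 2 x³: half of it may be lost to values below the base
  -- threshold q = x².
  v i = 2 * M * f i
  large : x * x * (x + x) ≤ ∑ L v
  large = begin
    x * x * (x + x)     ≡⟨ eq x ⟩
    2 * x ^ 3           ≤⟨ *-monoʳ-≤ 2 energy ⟩
    2 * (M * ∑ L f)     ≡⟨ *-assoc 2 M _ ⟨
    2 * M * ∑ L f       ≡⟨ ∑-*ˡ L (2 * M) f ⟨
    ∑ L v               ∎
    where
    eq : ∀ x → x * x * (x + x) ≡ 2 * x ^ 3
    eq = solve 1 (λ x → x :* x :* (x :+ x) := con 2 :* x :^ 3) refl
  conclude : (∃ λ j → 2 ^ j * x ≤ 5 * 5 ^ j * level (x * x) L v j) →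
    ∃ λ N → x ^ 11 ≤ N ^ 4 * ∑ L (λ i → 𝟙 (N ≤? f i)) ^ 3 * M ^ 4 * 2000
  conclude (j , popular) with ceiling-quotient (2 * M) (2 ^ j * (x * x)) {{>-nonZero (*-mono-< (s≤s (z≤n {1})) 0<M)}}
  ... | N , ≤N , N≤ = N , *-cancelˡ-≤ (u ^ 7) {{>-nonZero (m^n>0 u {{>-nonZero (m^n>0 2 j)}} 7)}} (begin
    u ^ 7 * x ^ 11                                     ≡⟨ eq₁ u x ⟩
    (u * x) ^ 3 * (u * (x * x)) ^ 4                    ≤⟨ *-mono-≤ (^-monoˡ-≤ 3 (≤-trans popular (*-monoʳ-≤ (5 * w) level≤))) (^-monoˡ-≤ 4 ≤N) ⟩
    (5 * w * l) ^ 3 * (2 * M * N) ^ 4                  ≡⟨ eq₂ 5 2 w l M N ⟩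
    w ^ 3 * (N ^ 4 * l ^ 3 * M ^ 4 * 2000)             ≤⟨ *-monoˡ-≤ _ w³≤u⁷ ⟩
    u ^ 7 * (N ^ 4 * l ^ 3 * M ^ 4 * 2000)             ∎)
    where
    u = 2 ^ j ; w = 5 ^ j
    l = ∑ L (λ i → 𝟙 (N ≤? f i))
    level≤ : level (x * x) L v j ≤ l
    level≤ = ∑-mono L λ {i} _ → 𝟙-mono (2 ^ j * (x * x) ≤? v i) (N ≤? f i) (N≤ (f i))
    -- This is 5³ = 125 ≤ 128 = 2⁷, the numerical margin that permits the ratio 4/5 of the weights.
    w³≤u⁷ : w ^ 3 ≤ u ^ 7
    w³≤u⁷ = begin
      (5 ^ j) ^ 3     ≡⟨ ^-*-assoc 5 j 3 ⟩
      5 ^ (j * 3)     ≡⟨ cong (5 ^_) (*-comm j 3) ⟩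
      5 ^ (3 * j)     ≡⟨ ^-*-assoc 5 3 j ⟨
      125 ^ j         ≤⟨ ^-monoˡ-≤ j (m≤m+n 125 3) ⟩
      128 ^ j         ≡⟨ ^-*-assoc 2 7 j ⟩
      2 ^ (7 * j)     ≡⟨ cong (2 ^_) (*-comm 7 j) ⟩
      2 ^ (j * 7)     ≡⟨ ^-*-assoc 2 j 7 ⟨
      (2 ^ j) ^ 7     ∎
    eq₁ : ∀ u x → u ^ 7 * x ^ 11 ≡ (u * x) ^ 3 * (u * (x * x)) ^ 4
    eq₁ = solve 2 (λ u x → u :^ 7 :* x :^ 11 := (u :* x) :^ 3 :* (u :* (x :* x)) :^ 4) refl
    eq₂ : ∀ a b w l M N → (a * w * l) ^ 3 * (b * M * N) ^ 4 ≡ w ^ 3 * (N ^ 4 * l ^ 3 * M ^ 4 * (a ^ 3 * b ^ 4))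
    eq₂ = solve 6 (λ a b w l M N → (a :* w :* l) :^ 3 :* (b :* M :* N) :^ 4 :=
      w :^ 3 :* (N :^ 4 :* l :^ 3 :* M :^ 4 :* (a :^ 3 :* b :^ 4))) refl

-- The factors come from the pivot, the popular level, Plünnecke's inequality and |A| ≤ 2 |X|.
-- It is abstract, and starts with k + 1 rather than 1 + k, lest it be unfolded in unary.
abstract
  constant : ℕ → ℕ
  constant k = (k + 1) * 8192 * (2000 * 64 * 1024)

  0<constant : ∀ k → 0 < constant k
  0<constant k = *-mono-< {0} {(k + 1) * 8192} {0} {2000 * 64 * 1024}
    (*-mono-< {0} {k + 1} {0} {8192} (m≤n+m 1 k) (s≤s z≤n)) (s≤s z≤n)

  ≤constant : ∀ k {x y} → x ≤ y * ((k + 1) * 8192 * (2000 * 64 * 1024)) → x ≤ y * constant k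
  ≤constant k le = le

-- The hypothesis domain says, without subtraction, that (c - d)(x - y) = 0 only if c = d or x = y.
module SumProduct {p} (_∔_ _·_ : Fin p → Fin p → Fin p) (neg : Fin p → Fin p) (0ᶠ 1ᶠ : Fin p)
  (isCommutativeRing : IsCommutativeRing _≡_ _∔_ _·_ neg 0ᶠ 1ᶠ)
  (domain : ∀ {c d x y} → (c · x) ∔ (d · y) ≡ (d · x) ∔ (c · y) → c ≡ d ⊎ x ≡ y) where

  ring : CommutativeRing _ _
  ring = record { isCommutativeRing = isCommutativeRing }

  module F = CommutativeRing ring
  open import Algebra.Properties.Ring F.ring using (-0#≈0#; -‿+-comm; -‿involutive; -1*x≈-x)
    renaming (+-cancelˡ to ∔-cancelˡ; +-cancelʳ to ∔-cancelʳ)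
  open NatSolver F.commutativeSemiring using ()
    renaming (solve to solveᶠ; _:+_ to _:+ᶠ_; _:*_ to _:*ᶠ_; _:=_ to _:=ᶠ_)

  -- Sumsets and Plünnecke's inequality

  infixl 6 _⊞_
  infixl 7 _⊡_

  abstract
    _⊞_ : Subset p → Subset p → Subset p
    _⊞_ = setOp _∔_

    _⊡_ : Fin p → Subset p → Subset p
    c ⊡ A = setOp _·_ ⁅ c ⁆ A

    ∈-⊞⁺ : ∀ {A B a b x} → a ∈ A → b ∈ B → a ∔ b ≡ x → x ∈ A ⊞ B
    ∈-⊞⁺ = ∈-setOp⁺ _∔_

    ∈-⊞⁻ : ∀ {A B x} → x ∈ A ⊞ B → ∃₂ λ a b → a ∈ A × b ∈ B × a ∔ b ≡ x
    ∈-⊞⁻ = ∈-setOp⁻ _∔_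

    ∣⊞∣≤ : ∀ A B → ∣ A ⊞ B ∣ ≤ ∣ A ∣ * ∣ B ∣
    ∣⊞∣≤ = ∣setOp∣≤ _∔_

    ∈-⊡⁺ : ∀ {c A a x} → a ∈ A → c · a ≡ x → x ∈ c ⊡ A
    ∈-⊡⁺ {c} a∈A eq = ∈-setOp⁺ _·_ (x∈⁅x⁆ c) a∈A eq

    ∈-⊡⁻ : ∀ {c A x} → x ∈ c ⊡ A → ∃ λ a → a ∈ A × c · a ≡ x
    ∈-⊡⁻ {c} x∈ with ∈-setOp⁻ _·_ x∈
    ... | d , a , d∈ , a∈A , eq = a , a∈A , trans (cong (_· a) (sym (x∈⁅y⁆⇒x≡y c d∈))) eq

    ∣⊡∣≤ : ∀ c A → ∣ c ⊡ A ∣ ≤ ∣ A ∣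
    ∣⊡∣≤ c A = ≤-trans (∣setOp∣≤ _·_ ⁅ c ⁆ A) (≤-reflexive (trans (cong (_* ∣ A ∣) (∣⁅x⁆∣≡1 c)) (*-identityˡ _)))

  ⊞-mono : ∀ {A A′ B B′} → A ⊆ A′ → B ⊆ B′ → A ⊞ B ⊆ A′ ⊞ B′
  ⊞-mono A⊆ B⊆ x∈ with ∈-⊞⁻ x∈
  ... | a , b , a∈ , b∈ , eq = ∈-⊞⁺ (A⊆ a∈) (B⊆ b∈) eq

  ⊞-comm⊆ : ∀ A B → A ⊞ B ⊆ B ⊞ A
  ⊞-comm⊆ A B x∈ with ∈-⊞⁻ x∈
  ... | a , b , a∈ , b∈ , eq = ∈-⊞⁺ b∈ a∈ (trans (F.+-comm b a) eq)

  ⊞-assoc⊆ : ∀ A B C → (A ⊞ B) ⊞ C ⊆ A ⊞ (B ⊞ C)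
  ⊞-assoc⊆ A B C x∈ with ∈-⊞⁻ x∈
  ... | ab , c , ab∈ , c∈ , eq with ∈-⊞⁻ ab∈
  ... | a , b , a∈ , b∈ , refl = ∈-⊞⁺ a∈ (∈-⊞⁺ b∈ c∈ refl) (trans (sym (F.+-assoc a b c)) eq)

  ⊞-swap : ∀ A B C → (A ⊞ B) ⊞ C ≡ (A ⊞ C) ⊞ B
  ⊞-swap A B C = ⊆-antisym (half A B C) (half A C B)
    where
    half : ∀ A B C → (A ⊞ B) ⊞ C ⊆ (A ⊞ C) ⊞ B
    half A B C x∈ with ∈-⊞⁻ x∈
    ... | ab , c , ab∈ , c∈ , eq with ∈-⊞⁻ ab∈
    ... | a , b , a∈ , b∈ , refl = ∈-⊞⁺ (∈-⊞⁺ a∈ c∈ refl) b∈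
      (trans (F.+-assoc a c b) (trans (cong (a ∔_) (F.+-comm c b)) (trans (sym (F.+-assoc a b c)) eq)))

  ⊞-∪ : ∀ A B C → (A ∪ B) ⊞ C ≡ (A ⊞ C) ∪ (B ⊞ C)
  ⊞-∪ A B C = ⊆-antisym to from
    where
    to : (A ∪ B) ⊞ C ⊆ (A ⊞ C) ∪ (B ⊞ C)
    to x∈ with ∈-⊞⁻ x∈
    ... | a , c , a∈ , c∈ , eq with x∈p∪q⁻ A B a∈
    ... | inj₁ a∈A = x∈p∪q⁺ (inj₁ (∈-⊞⁺ a∈A c∈ eq))
    ... | inj₂ a∈B = x∈p∪q⁺ (inj₂ (∈-⊞⁺ a∈B c∈ eq))
    from : (A ⊞ C) ∪ (B ⊞ C) ⊆ (A ∪ B) ⊞ C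
    from x∈ with x∈p∪q⁻ (A ⊞ C) (B ⊞ C) x∈
    ... | inj₁ x∈A = ⊞-mono (λ {a} a∈ → x∈p∪q⁺ (inj₁ a∈)) id x∈A
    ... | inj₂ x∈B = ⊞-mono (λ {a} a∈ → x∈p∪q⁺ (inj₂ a∈)) id x∈B

  ∣⊞⁅⁆∣≤ : ∀ A c → ∣ A ⊞ ⁅ c ⁆ ∣ ≤ ∣ A ∣
  ∣⊞⁅⁆∣≤ A c = ≤-trans (∣⊞∣≤ A ⁅ c ⁆) (≤-reflexive (trans (cong (∣ A ∣ *_) (∣⁅x⁆∣≡1 c)) (*-identityʳ _)))

  ⊞-shift-back : ∀ A c → (A ⊞ ⁅ c ⁆) ⊞ ⁅ neg c ⁆ ≡ A
  ⊞-shift-back A c = ⊆-antisym to from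
    where
    cancel : ∀ a → (a ∔ c) ∔ neg c ≡ a
    cancel a = trans (F.+-assoc a c (neg c)) (trans (cong (a ∔_) (F.-‿inverseʳ c)) (F.+-identityʳ a))
    to : (A ⊞ ⁅ c ⁆) ⊞ ⁅ neg c ⁆ ⊆ A
    to x∈ with ∈-⊞⁻ x∈
    ... | ac , n , ac∈ , n∈ , refl with ∈-⊞⁻ ac∈
    ... | a , c′ , a∈ , c∈ , refl rewrite x∈⁅y⁆⇒x≡y _ n∈ | x∈⁅y⁆⇒x≡y _ c∈ = subst (_∈ A) (sym (cancel a)) a∈
    from : A ⊆ (A ⊞ ⁅ c ⁆) ⊞ ⁅ neg c ⁆
    from {a} a∈ = ∈-⊞⁺ (∈-⊞⁺ a∈ (x∈⁅x⁆ c) refl) (x∈⁅x⁆ (neg c)) (cancel a)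

  ∣⊞⁅⁆∣ : ∀ A c → ∣ A ⊞ ⁅ c ⁆ ∣ ≡ ∣ A ∣
  ∣⊞⁅⁆∣ A c = ≤-antisym (∣⊞⁅⁆∣≤ A c)
    (≤-trans (≤-reflexive (cong ∣_∣ (sym (⊞-shift-back A c)))) (∣⊞⁅⁆∣≤ (A ⊞ ⁅ c ⁆) (neg c)))

  ⊆-shift : ∀ {Z A c} → Z ⊆ A ⊞ ⁅ c ⁆ → Z ⊞ ⁅ neg c ⁆ ⊆ A
  ⊆-shift {A = A} {c} Z⊆ {x} x∈ = subst (x ∈_) (⊞-shift-back A c) (⊞-mono Z⊆ id x∈)

  ∣A∣≤∣A⊞B∣ : ∀ {A B} → Nonempty B → ∣ A ∣ ≤ ∣ A ⊞ B ∣
  ∣A∣≤∣A⊞B∣ {A} {B} (b , b∈B) = ≤-trans (≤-reflexive (sym (∣⊞⁅⁆∣ A b)))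
    (p⊆q⇒∣p∣≤∣q∣ (⊞-mono id λ y∈ → subst (_∈ B) (sym (x∈⁅y⁆⇒x≡y b y∈)) b∈B))

  fromList : List (Fin p) → Subset p
  fromList []       = ⊥
  fromList (x ∷ xs) = fromList xs ∪ ⁅ x ⁆

  fromList-elems : ∀ A → fromList (elems A) ≡ A
  fromList-elems A = ⊆-antisym (λ x∈ → ∈-elems⁻ (to (elems A) x∈)) (λ x∈ → from (∈-elems⁺ x∈))
    where
    to : ∀ xs {x} → x ∈ fromList xs → x L.∈ xs
    to []       x∈ = contradiction x∈ ∉⊥
    to (y ∷ xs) x∈ with x∈p∪q⁻ (fromList xs) ⁅ y ⁆ x∈
    ... | inj₁ x∈xs = there (to xs x∈xs)
    ... | inj₂ x∈y  = here (x∈⁅y⁆⇒x≡y y x∈y)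
    from : ∀ {xs x} → x L.∈ xs → x ∈ fromList xs
    from (here refl) = x∈p∪q⁺ (inj₂ (x∈⁅x⁆ _))
    from (there x∈)  = x∈p∪q⁺ (inj₁ (from x∈))

  -- The three properties of g S = |S + B| that Petridis's argument uses; they are stable under
  -- nonnegative linear combinations.
  record Sumset-like (g : Subset p → ℕ) : Set where
    field
      empty     : g ⊥ ≡ 0
      translate : ∀ A c → g (A ⊞ ⁅ c ⁆) ≡ g A
      submodular : ∀ Y T Z → Z ⊆ Y → Z ⊆ T → g (Y ∪ T) + g Z ≤ g Y + g T

  ⊥⊞ : ∀ B → ⊥ ⊞ B ≡ ⊥
  ⊥⊞ B = Empty-unique λ { (x , x∈) → let a , b , a∈ , _ = ∈-⊞⁻ x∈ in ∉⊥ a∈ }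

  ⊞⊥ : ∀ B → B ⊞ ⊥ ≡ ⊥
  ⊞⊥ B = Empty-unique λ { (x , x∈) → let a , b , _ , b∈ , _ = ∈-⊞⁻ x∈ in ∉⊥ b∈ }

  -- Submodularity holds because (Y ∪ T) + B is the union of Y + B and T + B, while Z + B lies in
  -- their intersection.
  sumset-like : ∀ B → Sumset-like (λ S → ∣ S ⊞ B ∣)
  sumset-like B = record
    { empty      = trans (cong ∣_∣ (⊥⊞ B)) (∣⊥∣≡0 p)
    ; translate  = λ A c → trans (cong ∣_∣ (⊞-swap A ⁅ c ⁆ B)) (∣⊞⁅⁆∣ (A ⊞ B) c)
    ; submodular = λ Y T Z Z⊆Y Z⊆T → begin
        ∣ (Y ∪ T) ⊞ B ∣ + ∣ Z ⊞ B ∣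
          ≤⟨ +-mono-≤ (≤-reflexive (cong ∣_∣ (⊞-∪ Y T B)))
               (p⊆q⇒∣p∣≤∣q∣ λ x∈ → x∈p∩q⁺ (⊞-mono Z⊆Y id x∈ , ⊞-mono Z⊆T id x∈)) ⟩
        ∣ (Y ⊞ B) ∪ (T ⊞ B) ∣ + ∣ (Y ⊞ B) ∩ (T ⊞ B) ∣
          ≡⟨ ∣∪∣+∣∩∣ (Y ⊞ B) (T ⊞ B) ⟩
        ∣ Y ⊞ B ∣ + ∣ T ⊞ B ∣ ∎
    }
    where open ≤-Reasoning

  combination : ∀ {g h} (v w : ℕ) → Sumset-like g → Sumset-like h → Sumset-like (λ S → v * g S + w * h S)
  combination {g} {h} v w G H = record
    { empty      = trans (cong₂ (λ a b → v * a + w * b) G.empty H.empty) (cong₂ _+_ (*-zeroʳ v) (*-zeroʳ w))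
    ; translate  = λ A c → cong₂ (λ a b → v * a + w * b) (G.translate A c) (H.translate A c)
    ; submodular = λ Y T Z Z⊆Y Z⊆T → begin
        v * g (Y ∪ T) + w * h (Y ∪ T) + (v * g Z + w * h Z)   ≡⟨ regroup v w (g (Y ∪ T)) (h (Y ∪ T)) (g Z) (h Z) ⟩
        v * (g (Y ∪ T) + g Z) + w * (h (Y ∪ T) + h Z)
          ≤⟨ +-mono-≤ (*-monoʳ-≤ v (G.submodular Y T Z Z⊆Y Z⊆T)) (*-monoʳ-≤ w (H.submodular Y T Z Z⊆Y Z⊆T)) ⟩
        v * (g Y + g T) + w * (h Y + h T)                     ≡⟨ regroup v w (g Y) (h Y) (g T) (h T) ⟨
        v * g Y + w * h Y + (v * g T + w * h T)               ∎
    }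
    where
    open ≤-Reasoning
    module G = Sumset-like G
    module H = Sumset-like H
    regroup : ∀ v w a b c d → v * a + w * b + (v * c + w * d) ≡ v * (a + c) + w * (b + d)
    regroup = solve-∀

  -- Induction on C. A new element c adds T = X + c to Y = X + C, and submodularity saves g Z on the
  -- overlap Z = Y ∩ T. The shift Z - c is a subset of X, so minimality of the ratio g X / |X| makes
  -- this saving at least (g X / |X|) |Z|, just what |Y| + |T| counts twice.
  petridis : ∀ {g} → Sumset-like g → ∀ X → (∀ Z → Z ⊆ X → g X * ∣ Z ∣ ≤ g Z * ∣ X ∣) →
    ∀ C → g (X ⊞ C) * ∣ X ∣ ≤ g X * ∣ X ⊞ C ∣
  petridis {g} G X minimal C =
    subst (λ C → g (X ⊞ C) * ∣ X ∣ ≤ g X * ∣ X ⊞ C ∣) (fromList-elems C) (go (elems C))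
    where
    open Sumset-like G
    open ≤-Reasoning
    go : ∀ cs → g (X ⊞ fromList cs) * ∣ X ∣ ≤ g X * ∣ X ⊞ fromList cs ∣
    go []       = ≤-trans (≤-reflexive (cong (_* ∣ X ∣) (trans (cong g (⊞⊥ X)) empty))) z≤n
    go (c ∷ cs) = subst (λ S → g S * ∣ X ∣ ≤ g X * ∣ S ∣) (sym split)
      (+-cancelʳ-≤ (g X * ∣ Z ∣) _ _ (begin
        g (Y ∪ T) * ∣ X ∣ + g X * ∣ Z ∣        ≤⟨ +-monoʳ-≤ _ minimal-Z ⟩
        g (Y ∪ T) * ∣ X ∣ + g Z * ∣ X ∣        ≡⟨ *-distribʳ-+ ∣ X ∣ (g (Y ∪ T)) (g Z) ⟨
        (g (Y ∪ T) + g Z) * ∣ X ∣              ≤⟨ *-monoˡ-≤ ∣ X ∣ (submodular Y T Z (p∩q⊆p Y T) (p∩q⊆q Y T)) ⟩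
        (g Y + g T) * ∣ X ∣                    ≡⟨ *-distribʳ-+ ∣ X ∣ (g Y) (g T) ⟩
        g Y * ∣ X ∣ + g T * ∣ X ∣              ≤⟨ +-mono-≤ (go cs) (≤-reflexive (cong₂ _*_ (translate X c) (sym (∣⊞⁅⁆∣ X c)))) ⟩
        g X * ∣ Y ∣ + g X * ∣ T ∣              ≡⟨ *-distribˡ-+ (g X) ∣ Y ∣ ∣ T ∣ ⟨
        g X * (∣ Y ∣ + ∣ T ∣)                  ≡⟨ cong (g X *_) (∣∪∣+∣∩∣ Y T) ⟨
        g X * (∣ Y ∪ T ∣ + ∣ Z ∣)              ≡⟨ *-distribˡ-+ (g X) ∣ Y ∪ T ∣ ∣ Z ∣ ⟩
        g X * ∣ Y ∪ T ∣ + g X * ∣ Z ∣          ∎))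
      where
      Y = X ⊞ fromList cs
      T = X ⊞ ⁅ c ⁆
      Z = Y ∩ T
      flip⊞ : ∀ A → X ⊞ A ≡ A ⊞ X
      flip⊞ A = ⊆-antisym (⊞-comm⊆ X A) (⊞-comm⊆ A X)
      split : X ⊞ fromList (c ∷ cs) ≡ Y ∪ T
      split = trans (flip⊞ _) (trans (⊞-∪ (fromList cs) ⁅ c ⁆ X) (sym (cong₂ _∪_ (flip⊞ (fromList cs)) (flip⊞ ⁅ c ⁆))))
      minimal-Z : g X * ∣ Z ∣ ≤ g Z * ∣ X ∣
      minimal-Z = begin
        g X * ∣ Z ∣                      ≡⟨ cong (g X *_) (∣⊞⁅⁆∣ Z (neg c)) ⟨
        g X * ∣ Z ⊞ ⁅ neg c ⁆ ∣          ≤⟨ minimal (Z ⊞ ⁅ neg c ⁆) (⊆-shift (p∩q⊆q Y T)) ⟩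
        g (Z ⊞ ⁅ neg c ⁆) * ∣ X ∣        ≡⟨ cong (_* ∣ X ∣) (translate Z (neg c)) ⟩
        g Z * ∣ X ∣                      ∎

  -- As long as some subset Z of X has a smaller ratio g Z / |Z|, X is replaced by it. Strictness of
  -- the comparison excludes both an empty Z and Z = X, so the size drops, and the ratio never
  -- exceeds that of A.
  minimizer : (g : Subset p → ℕ) → ∀ A → Nonempty A → ∃ λ X → X ⊆ A × Nonempty X ×
    g X * ∣ A ∣ ≤ g A * ∣ X ∣ × (∀ Z → Z ⊆ X → g X * ∣ Z ∣ ≤ g Z * ∣ X ∣)
  minimizer g A neA = go A (<-wellFounded _) id neA ≤-refl
    where
    go : ∀ X → Acc _<_ ∣ X ∣ → X ⊆ A → Nonempty X → g X * ∣ A ∣ ≤ g A * ∣ X ∣ →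
      ∃ λ X → X ⊆ A × Nonempty X × g X * ∣ A ∣ ≤ g A * ∣ X ∣ × (∀ Z → Z ⊆ X → g X * ∣ Z ∣ ≤ g Z * ∣ X ∣)
    go X (acc rec) X⊆A neX le with anySubset? (λ Z → (Z ⊆? X) ×-dec (g Z * ∣ X ∣ <? g X * ∣ Z ∣))
    ... | no none = X , X⊆A , neX , le , λ Z Z⊆X → ≮⇒≥ λ lt → none (Z , Z⊆X , lt)
    ... | yes (Z , Z⊆X , lt) = go Z (rec ∣Z∣<∣X∣) (X⊆A ∘ Z⊆X) (∣∣>0⇒Nonempty Z 0<∣Z∣) le′
      where
      open ≤-Reasoning
      0<∣X∣ = Nonempty⇒∣∣>0 neX
      0<∣Z∣ : 0 < ∣ Z ∣
      0<∣Z∣ = n≢0⇒n>0 λ ∣Z∣≡0 → contradiction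
        (≤-trans lt (≤-reflexive (trans (cong (g X *_) ∣Z∣≡0) (*-zeroʳ (g X))))) λ ()
      ∣Z∣<∣X∣ : ∣ Z ∣ < ∣ X ∣
      ∣Z∣<∣X∣ = ≰⇒> λ ∣X∣≤∣Z∣ → <-irrefl refl (subst (λ S → g S * ∣ X ∣ < g X * ∣ S ∣) (equal ∣X∣≤∣Z∣) lt)
        where
        equal : ∣ X ∣ ≤ ∣ Z ∣ → Z ≡ X
        equal ∣X∣≤∣Z∣ = ⊆-antisym Z⊆X λ {x} x∈X → case-∈ x x∈X (x ∈? Z)
          where
          case-∈ : ∀ x → x ∈ X → Dec (x ∈ Z) → x ∈ Z
          case-∈ x x∈X (yes x∈Z) = x∈Z
          case-∈ x x∈X (no x∉Z)  = contradiction (p⊂q⇒∣p∣<∣q∣ (Z⊆X , x , x∈X , x∉Z)) (≤⇒≯ ∣X∣≤∣Z∣)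
      le′ : g Z * ∣ A ∣ ≤ g A * ∣ Z ∣
      le′ = *-cancelʳ-≤ _ _ ∣ X ∣ {{>-nonZero 0<∣X∣}} (begin
        g Z * ∣ A ∣ * ∣ X ∣    ≡⟨ swap (g Z) ∣ A ∣ ∣ X ∣ ⟩
        g Z * ∣ X ∣ * ∣ A ∣    ≤⟨ *-monoˡ-≤ ∣ A ∣ (<⇒≤ lt) ⟩
        g X * ∣ Z ∣ * ∣ A ∣    ≡⟨ swap (g X) ∣ Z ∣ ∣ A ∣ ⟩
        g X * ∣ A ∣ * ∣ Z ∣    ≤⟨ *-monoˡ-≤ ∣ Z ∣ le ⟩
        g A * ∣ X ∣ * ∣ Z ∣    ≡⟨ swap (g A) ∣ X ∣ ∣ Z ∣ ⟩
        g A * ∣ Z ∣ * ∣ X ∣    ∎)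
        where
        swap : ∀ a b c → a * b * c ≡ a * c * b
        swap = solve-∀

  -- One X has to serve both summands, so the weighted sum g of the two sumset sizes is minimised.
  -- The weights make both terms of g A equal to a₁ a₂; discarding either term on the left then
  -- costs only the factor 2.
  plünnecke : ∀ A B₁ B₂ → Nonempty A → Nonempty B₁ → Nonempty B₂ → ∃ λ X → X ⊆ A × Nonempty X ×
    ∀ C → ∣ A ∣ * ∣ (X ⊞ C) ⊞ B₁ ∣ ≤ 2 * ∣ A ⊞ B₁ ∣ * ∣ X ⊞ C ∣
        × ∣ A ∣ * ∣ (X ⊞ C) ⊞ B₂ ∣ ≤ 2 * ∣ A ⊞ B₂ ∣ * ∣ X ⊞ C ∣
  plünnecke A B₁ B₂ neA ne₁ ne₂ =
    let X , X⊆A , neX , le , minimal = minimizer g A neA in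
    X , X⊆A , neX , bounds X neX le minimal
    where
    open ≤-Reasoning
    n = ∣ A ∣ ; a₁ = ∣ A ⊞ B₁ ∣ ; a₂ = ∣ A ⊞ B₂ ∣
    g : Subset p → ℕ
    g S = a₂ * ∣ S ⊞ B₁ ∣ + a₁ * ∣ S ⊞ B₂ ∣
    0<a₁ = ≤-trans (Nonempty⇒∣∣>0 neA) (∣A∣≤∣A⊞B∣ {A} ne₁)
    0<a₂ = ≤-trans (Nonempty⇒∣∣>0 neA) (∣A∣≤∣A⊞B∣ {A} ne₂)
    eq₁ : ∀ a n x → a * (n * x) ≡ a * x * n
    eq₁ = solve-∀
    eq₂ : ∀ a b x → (b * a + a * b) * x ≡ b * (2 * a * x)
    eq₂ = solve-∀
    eq₃ : ∀ a b x → (b * a + a * b) * x ≡ a * (2 * b * x)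
    eq₃ = solve-∀
    swap : ∀ a b c → a * b * c ≡ a * c * b
    swap = solve-∀
    bounds : ∀ X → Nonempty X → g X * n ≤ g A * ∣ X ∣ → (∀ Z → Z ⊆ X → g X * ∣ Z ∣ ≤ g Z * ∣ X ∣) →
      ∀ C → n * ∣ (X ⊞ C) ⊞ B₁ ∣ ≤ 2 * a₁ * ∣ X ⊞ C ∣ × n * ∣ (X ⊞ C) ⊞ B₂ ∣ ≤ 2 * a₂ * ∣ X ⊞ C ∣
    bounds X neX le minimal C =
        *-cancelˡ-≤ a₂ {{>-nonZero 0<a₂}} (begin
          a₂ * (n * b₁)                ≡⟨ eq₁ a₂ n b₁ ⟩
          a₂ * b₁ * n                  ≤⟨ *-monoˡ-≤ n (m≤m+n (a₂ * b₁) (a₁ * b₂)) ⟩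
          g (X ⊞ C) * n                ≤⟨ main ⟩
          g A * ∣ X ⊞ C ∣              ≡⟨ eq₂ a₁ a₂ ∣ X ⊞ C ∣ ⟩
          a₂ * (2 * a₁ * ∣ X ⊞ C ∣)    ∎)
      , *-cancelˡ-≤ a₁ {{>-nonZero 0<a₁}} (begin
          a₁ * (n * b₂)                ≡⟨ eq₁ a₁ n b₂ ⟩
          a₁ * b₂ * n                  ≤⟨ *-monoˡ-≤ n (m≤n+m (a₁ * b₂) (a₂ * b₁)) ⟩
          g (X ⊞ C) * n                ≤⟨ main ⟩
          g A * ∣ X ⊞ C ∣              ≡⟨ eq₃ a₁ a₂ ∣ X ⊞ C ∣ ⟩
          a₁ * (2 * a₂ * ∣ X ⊞ C ∣)    ∎)
      where
      b₁ = ∣ (X ⊞ C) ⊞ B₁ ∣ ; b₂ = ∣ (X ⊞ C) ⊞ B₂ ∣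
      main : g (X ⊞ C) * n ≤ g A * ∣ X ⊞ C ∣
      main = *-cancelʳ-≤ _ _ ∣ X ∣ {{>-nonZero (Nonempty⇒∣∣>0 neX)}} (begin
        g (X ⊞ C) * n * ∣ X ∣        ≡⟨ swap (g (X ⊞ C)) n ∣ X ∣ ⟩
        g (X ⊞ C) * ∣ X ∣ * n        ≤⟨ *-monoˡ-≤ n (petridis (combination a₂ a₁ (sumset-like B₁) (sumset-like B₂)) X minimal C) ⟩
        g X * ∣ X ⊞ C ∣ * n          ≡⟨ swap (g X) ∣ X ⊞ C ∣ n ⟩
        g X * n * ∣ X ⊞ C ∣          ≤⟨ *-monoˡ-≤ ∣ X ⊞ C ∣ le ⟩
        g A * ∣ X ∣ * ∣ X ⊞ C ∣      ≡⟨ swap (g A) ∣ X ∣ ∣ X ⊞ C ∣ ⟩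
        g A * ∣ X ⊞ C ∣ * ∣ X ∣      ∎)

  ⊞-assoc : ∀ A B C → (A ⊞ B) ⊞ C ≡ A ⊞ (B ⊞ C)
  ⊞-assoc A B C = ⊆-antisym (⊞-assoc⊆ A B C) λ x∈ →
    ⊞-comm⊆ C (A ⊞ B) (⊞-mono id (⊞-comm⊆ B A) (⊞-assoc⊆ C B A (⊞-mono (⊞-comm⊆ B C) id (⊞-comm⊆ A (B ⊞ C) x∈))))

  ⊞-identityʳ : ∀ A → A ⊞ ⁅ 0ᶠ ⁆ ≡ A
  ⊞-identityʳ A = ⊆-antisym to from
    where
    to : A ⊞ ⁅ 0ᶠ ⁆ ⊆ A
    to x∈ with ∈-⊞⁻ x∈
    ... | a , z , a∈ , z∈ , refl rewrite x∈⁅y⁆⇒x≡y _ z∈ = subst (_∈ A) (sym (F.+-identityʳ a)) a∈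
    from : A ⊆ A ⊞ ⁅ 0ᶠ ⁆
    from {a} a∈ = ∈-⊞⁺ a∈ (x∈⁅x⁆ 0ᶠ) (F.+-identityʳ a)

  -- Two applications with the same X: C = B₁ removes B₂ from the triple sumset, and C = {0} removes
  -- B₁ from what is left.
  plünnecke-two : ∀ A B₁ B₂ → Nonempty A → Nonempty B₁ → Nonempty B₂ → ∃ λ X → X ⊆ A × Nonempty X ×
    ∣ A ∣ ^ 2 * ∣ X ⊞ B₁ ⊞ B₂ ∣ ≤ 4 * (∣ A ⊞ B₁ ∣ * ∣ A ⊞ B₂ ∣ * ∣ X ∣)
  plünnecke-two A B₁ B₂ neA ne₁ ne₂ =
    let X , X⊆A , neX , bounds = plünnecke A B₁ B₂ neA ne₁ ne₂ in
    X , X⊆A , neX , bound X (proj₁ (bounds ⁅ 0ᶠ ⁆)) (proj₂ (bounds B₁))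
    where
    open ≤-Reasoning
    n = ∣ A ∣ ; a₁ = ∣ A ⊞ B₁ ∣ ; a₂ = ∣ A ⊞ B₂ ∣
    eq₁ : ∀ n x → n ^ 2 * x ≡ n * (n * x)
    eq₁ = solve 2 (λ n x → n :^ 2 :* x := n :* (n :* x)) refl
    eq₂ : ∀ n a x → n * (a * x) ≡ a * (n * x)
    eq₂ = solve-∀
    eq₃ : ∀ a b x → 2 * b * (2 * a * x) ≡ 4 * (a * b * x)
    eq₃ = solve-∀
    bound : ∀ X → n * ∣ X ⊞ ⁅ 0ᶠ ⁆ ⊞ B₁ ∣ ≤ 2 * a₁ * ∣ X ⊞ ⁅ 0ᶠ ⁆ ∣ →
      n * ∣ X ⊞ B₁ ⊞ B₂ ∣ ≤ 2 * a₂ * ∣ X ⊞ B₁ ∣ → n ^ 2 * ∣ X ⊞ B₁ ⊞ B₂ ∣ ≤ 4 * (a₁ * a₂ * ∣ X ∣)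
    bound X first second = begin
      n ^ 2 * ∣ X ⊞ B₁ ⊞ B₂ ∣        ≡⟨ eq₁ n ∣ X ⊞ B₁ ⊞ B₂ ∣ ⟩
      n * (n * ∣ X ⊞ B₁ ⊞ B₂ ∣)      ≤⟨ *-monoʳ-≤ n second ⟩
      n * (2 * a₂ * ∣ X ⊞ B₁ ∣)      ≡⟨ eq₂ n (2 * a₂) ∣ X ⊞ B₁ ∣ ⟩
      2 * a₂ * (n * ∣ X ⊞ B₁ ∣)      ≤⟨ *-monoʳ-≤ (2 * a₂)
        (subst (λ S → n * ∣ S ⊞ B₁ ∣ ≤ 2 * a₁ * ∣ S ∣) (⊞-identityʳ X) first) ⟩
      2 * a₂ * (2 * a₁ * ∣ X ∣)      ≡⟨ eq₃ a₁ a₂ ∣ X ∣ ⟩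
      4 * (a₁ * a₂ * ∣ X ∣)          ∎

  -- Petridis's minimiser may be small; removing minimisers one after another collects half of A.
  plünnecke-large : ∀ A B → Nonempty A → Nonempty B → ∃ λ X → X ⊆ A × ∣ A ∣ ≤ 2 * ∣ X ∣ ×
    ∣ X ⊞ B ⊞ B ⊞ B ∣ * ∣ A ∣ ^ 3 ≤ ∣ A ⊞ B ∣ ^ 3 * ∣ X ∣ * 64
  plünnecke-large A B neA neB =
    let X , (X⊆A , bound) , half = greedy P Q ∣_∣ p ∣p∣≤n step ⊥ base in X , X⊆A , half , bound
    where
    open ≤-Reasoning
    n = ∣ A ∣ ; a = ∣ A ⊞ B ∣
    3B : Subset p → Subset p
    3B X = X ⊞ B ⊞ B ⊞ B
    P Q : Subset p → Set
    P X = X ⊆ A × ∣ 3B X ∣ * n ^ 3 ≤ a ^ 3 * ∣ X ∣ * 64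
    Q X = n ≤ 2 * ∣ X ∣
    base : P ⊥
    base = ⊥⊆ , ≤-trans (≤-reflexive (cong (_* n ^ 3) (trans (cong ∣_∣ 3B⊥) (∣⊥∣≡0 p)))) z≤n
      where
      3B⊥ : 3B ⊥ ≡ ⊥
      3B⊥ = trans (cong (λ S → S ⊞ B ⊞ B) (⊥⊞ B)) (trans (cong (_⊞ B) (⊥⊞ B)) (⊥⊞ B))
    3B-∪ : ∀ X Y → 3B (X ∪ Y) ≡ 3B X ∪ 3B Y
    3B-∪ X Y = trans (cong (λ S → S ⊞ B ⊞ B) (⊞-∪ X Y B))
      (trans (cong (_⊞ B) (⊞-∪ (X ⊞ B) (Y ⊞ B) B)) (⊞-∪ (X ⊞ B ⊞ B) (Y ⊞ B ⊞ B) B))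
    step : ∀ X → P X → Q X ⊎ ∃ λ X′ → P X′ × ∣ X ∣ < ∣ X′ ∣
    step X (X⊆A , bound) with n ≤? 2 * ∣ X ∣
    ... | yes half = inj₁ half
    ... | no  ≰    = extend (plünnecke (A ─ X) B B neA′ neB neB)
      where
      A′ = A ─ X
      n≤ : n ≤ ∣ A′ ∣ + ∣ X ∣
      n≤ = ≤-trans (≤-reflexive (sym (∣─∣+∣∩∣ A X))) (+-monoʳ-≤ ∣ A′ ∣ (∣p∩q∣≤∣q∣ A X))
      n≤2A′ : n ≤ 2 * ∣ A′ ∣
      n≤2A′ = +-cancelʳ-≤ n _ _ (begin
        n + n                         ≤⟨ +-mono-≤ n≤ n≤ ⟩
        ∣ A′ ∣ + ∣ X ∣ + (∣ A′ ∣ + ∣ X ∣)   ≡⟨ eq ∣ A′ ∣ ∣ X ∣ ⟩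
        2 * ∣ A′ ∣ + 2 * ∣ X ∣        ≤⟨ +-monoʳ-≤ (2 * ∣ A′ ∣) (<⇒≤ (≰⇒> ≰)) ⟩
        2 * ∣ A′ ∣ + n                ∎)
        where
        eq : ∀ a x → a + x + (a + x) ≡ 2 * a + 2 * x
        eq = solve-∀
      neA′ : Nonempty A′
      neA′ = ∣∣>0⇒Nonempty A′ (n≢0⇒n>0 λ A′≡0 → contradiction
        (≤-trans (Nonempty⇒∣∣>0 neA) (≤-trans n≤2A′ (≤-reflexive (cong (2 *_) A′≡0)))) λ ())
      extend : (∃ λ X′ → X′ ⊆ A′ × Nonempty X′ ×
        ∀ C → ∣ A′ ∣ * ∣ X′ ⊞ C ⊞ B ∣ ≤ 2 * ∣ A′ ⊞ B ∣ * ∣ X′ ⊞ C ∣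
            × ∣ A′ ∣ * ∣ X′ ⊞ C ⊞ B ∣ ≤ 2 * ∣ A′ ⊞ B ∣ * ∣ X′ ⊞ C ∣) →
        Q X ⊎ ∃ λ X′ → P X′ × ∣ X ∣ < ∣ X′ ∣
      extend (X′ , X′⊆A′ , neX′ , bounds) = inj₂ (X ∪ X′ , (∪⊆A , bound∪) , X<)
        where
        disjoint : ∣ X ∪ X′ ∣ ≡ ∣ X ∣ + ∣ X′ ∣
        disjoint = disjoint-∪ X X′ λ x∈X x∈X′ → ─-notin A X (X′⊆A′ x∈X′) x∈X
        X< : ∣ X ∣ < ∣ X ∪ X′ ∣
        X< = ≤-trans (m<m+n ∣ X ∣ (Nonempty⇒∣∣>0 neX′)) (≤-reflexive (sym disjoint))
        ∪⊆A : X ∪ X′ ⊆ A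
        ∪⊆A x∈ with x∈p∪q⁻ X X′ x∈
        ... | inj₁ x∈X  = X⊆A x∈X
        ... | inj₂ x∈X′ = p─q⊆p A X (X′⊆A′ x∈X′)
        -- Each summand B costs a factor 2 from `plünnecke` and another 2 because |A| ≤ 2 |A′|.
        -- Three summands account for 64 = 4³.
        one : ∀ C → n * ∣ X′ ⊞ C ⊞ B ∣ ≤ 4 * a * ∣ X′ ⊞ C ∣
        one C = begin
          n * ∣ X′ ⊞ C ⊞ B ∣                    ≤⟨ *-monoˡ-≤ ∣ X′ ⊞ C ⊞ B ∣ n≤2A′ ⟩
          2 * ∣ A′ ∣ * ∣ X′ ⊞ C ⊞ B ∣           ≡⟨ *-assoc 2 ∣ A′ ∣ _ ⟩
          2 * (∣ A′ ∣ * ∣ X′ ⊞ C ⊞ B ∣)         ≤⟨ *-monoʳ-≤ 2 (proj₁ (bounds C)) ⟩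
          2 * (2 * ∣ A′ ⊞ B ∣ * ∣ X′ ⊞ C ∣)     ≤⟨ *-monoʳ-≤ 2 (*-monoˡ-≤ ∣ X′ ⊞ C ∣ (*-monoʳ-≤ 2
                                                   (p⊆q⇒∣p∣≤∣q∣ (⊞-mono {A = A′} {B = B} (p─q⊆p A X) id)))) ⟩
          2 * (2 * a * ∣ X′ ⊞ C ∣)              ≡⟨ eq a ∣ X′ ⊞ C ∣ ⟩
          4 * a * ∣ X′ ⊞ C ∣                    ∎
          where
          eq : ∀ a x → 2 * (2 * a * x) ≡ 4 * a * x
          eq = solve-∀
        step₁ : n * ∣ X′ ⊞ B ∣ ≤ 4 * a * ∣ X′ ∣
        step₁ = subst (λ S → n * ∣ S ⊞ B ∣ ≤ 4 * a * ∣ S ∣) (⊞-identityʳ X′) (one ⁅ 0ᶠ ⁆)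
        step₃ : n * ∣ 3B X′ ∣ ≤ 4 * a * ∣ X′ ⊞ B ⊞ B ∣
        step₃ = subst (λ S → n * ∣ S ⊞ B ∣ ≤ 4 * a * ∣ S ∣) (sym (⊞-assoc X′ B B)) (one (B ⊞ B))
        bound′ : ∣ 3B X′ ∣ * n ^ 3 ≤ a ^ 3 * ∣ X′ ∣ * 64
        bound′ = begin
          ∣ 3B X′ ∣ * n ^ 3                     ≡⟨ eq₁ ∣ 3B X′ ∣ n ⟩
          n * n * (n * ∣ 3B X′ ∣)               ≤⟨ *-monoʳ-≤ (n * n) step₃ ⟩
          n * n * (4 * a * ∣ X′ ⊞ B ⊞ B ∣)      ≡⟨ eq₂ n a ∣ X′ ⊞ B ⊞ B ∣ ⟩
          4 * a * n * (n * ∣ X′ ⊞ B ⊞ B ∣)      ≤⟨ *-monoʳ-≤ (4 * a * n) (one B) ⟩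
          4 * a * n * (4 * a * ∣ X′ ⊞ B ∣)      ≡⟨ eq₃ n a ∣ X′ ⊞ B ∣ ⟩
          16 * a * a * (n * ∣ X′ ⊞ B ∣)         ≤⟨ *-monoʳ-≤ (16 * a * a) step₁ ⟩
          16 * a * a * (4 * a * ∣ X′ ∣)         ≡⟨ eq₄ a ∣ X′ ∣ ⟩
          a ^ 3 * ∣ X′ ∣ * 64                   ∎
          where
          eq₁ : ∀ x n → x * n ^ 3 ≡ n * n * (n * x)
          eq₁ = solve 2 (λ x n → x :* n :^ 3 := n :* n :* (n :* x)) refl
          eq₂ : ∀ n a x → n * n * (4 * a * x) ≡ 4 * a * n * (n * x)
          eq₂ = solve-∀
          eq₃ : ∀ n a x → 4 * a * n * (4 * a * x) ≡ 16 * a * a * (n * x)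
          eq₃ = solve-∀
          eq₄ : ∀ a x → 16 * a * a * (4 * a * x) ≡ a ^ 3 * x * 64
          eq₄ = solve 2 (λ a x → con 16 :* a :* a :* (con 4 :* a :* x) := a :^ 3 :* x :* con 64) refl
        bound∪ : ∣ 3B (X ∪ X′) ∣ * n ^ 3 ≤ a ^ 3 * ∣ X ∪ X′ ∣ * 64
        bound∪ = begin
          ∣ 3B (X ∪ X′) ∣ * n ^ 3                     ≡⟨ cong (λ S → ∣ S ∣ * n ^ 3) (3B-∪ X X′) ⟩
          ∣ 3B X ∪ 3B X′ ∣ * n ^ 3                    ≤⟨ *-monoˡ-≤ (n ^ 3) (∣∪∣≤ (3B X) (3B X′)) ⟩
          (∣ 3B X ∣ + ∣ 3B X′ ∣) * n ^ 3              ≡⟨ *-distribʳ-+ (n ^ 3) ∣ 3B X ∣ ∣ 3B X′ ∣ ⟩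
          ∣ 3B X ∣ * n ^ 3 + ∣ 3B X′ ∣ * n ^ 3        ≤⟨ +-mono-≤ bound bound′ ⟩
          a ^ 3 * ∣ X ∣ * 64 + a ^ 3 * ∣ X′ ∣ * 64    ≡⟨ eq (a ^ 3) ∣ X ∣ ∣ X′ ∣ 64 ⟩
          a ^ 3 * (∣ X ∣ + ∣ X′ ∣) * 64               ≡⟨ cong (λ k → a ^ 3 * k * 64) disjoint ⟨
          a ^ 3 * ∣ X ∪ X′ ∣ * 64                     ∎
          where
          eq : ∀ a x y k → a * x * k + a * y * k ≡ a * (x + y) * k
          eq = solve-∀

  -- Multiplicative and additive energy

  ·-cancelˡ : ∀ {a x y} → a ≢ 0ᶠ → a · x ≡ a · y → x ≡ y
  ·-cancelˡ {a} {x} {y} a≢0 eq with domain {a} {0ᶠ} {x} {y} (begin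
      (a · x) ∔ (0ᶠ · y)     ≡⟨ cong ((a · x) ∔_) (F.zeroˡ y) ⟩
      (a · x) ∔ 0ᶠ           ≡⟨ F.+-identityʳ (a · x) ⟩
      a · x                  ≡⟨ eq ⟩
      a · y                  ≡⟨ F.+-identityˡ (a · y) ⟨
      0ᶠ ∔ (a · y)           ≡⟨ cong (_∔ (a · y)) (F.zeroˡ x) ⟨
      (0ᶠ · x) ∔ (a · y)     ∎)
    where open ≡-Reasoning
  ... | inj₁ a≡0 = contradiction a≡0 a≢0
  ... | inj₂ x≡y = x≡y

  ∈-pairs⁻ : ∀ (A B : Subset p) {a b} → (a , b) L.∈ pairs A B → a ∈ A × b ∈ B
  ∈-pairs⁻ A B ab∈ = let a∈ , b∈ = ∈-cartesianProduct⁻ (elems A) (elems B) ab∈ in ∈-elems⁻ a∈ , ∈-elems⁻ b∈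

  pairs-collisions : (A B Z : Subset p) (f : Fin p × Fin p → Fin p) →
    (∀ {a b} → a ∈ A → b ∈ B → f (a , b) ∈ Z) →
    (∣ A ∣ * ∣ B ∣) * (∣ A ∣ * ∣ B ∣) ≤ ∣ Z ∣ * ∑ (pairs A B) (λ i → ∑ (pairs A B) (λ j → 𝟙 (f i ≟ f j)))
  pairs-collisions A B Z f f∈Z = ≤-trans
    (≤-reflexive (sym (cong₂ _*_ (length-pairs A B) (length-pairs A B))))
    (≤-trans
      (collisions (pairs A B) (elems Z) (elems-unique Z) _≟_ f
        (λ ab∈ → let a∈ , b∈ = ∈-pairs⁻ A B ab∈ in ∈-elems⁺ (f∈Z a∈ b∈)))
      (≤-reflexive (cong (_* _) (length-elems Z))))

  -- For b ≠ 0 this is b⁻¹ (b X ∩ a X), and so has the size of the intersection of the two dilates.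
  common : Subset p → Fin p → Fin p → Subset p
  common X b a = sift X (λ t → any? λ s → (s ∈? X) ×-dec (b · t ≟ a · s))

  ∈-common⁻ : ∀ X b a {t} → t ∈ common X b a → t ∈ X × ∃ λ s → s ∈ X × b · t ≡ a · s
  ∈-common⁻ X b a = ∈-sift⁻ (λ t → any? λ s → (s ∈? X) ×-dec (b · t ≟ a · s))

  -- By Cauchy-Schwarz the equation b t = a s has at least |X|⁴ / |XX| solutions in X, and some b
  -- takes part in an average share of them. As a ≠ 0, t and a determine s, so for fixed a the
  -- solutions are counted by `common X b a`.
  multiplicative-energy : ∀ X → Nonempty X → 0ᶠ ∉ X → ∃ λ b → b ∈ X ×
    ∣ X ∣ ^ 3 ≤ ∣ setOp _·_ X X ∣ * ∑ (elems X) (λ a → ∣ common X b a ∣)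
  multiplicative-energy X neX 0∉X = finish (average (elems X) g (≤-trans 0<x (≤-reflexive (sym (length-elems X)))))
    where
    open ≤-Reasoning
    x = ∣ X ∣
    0<x = Nonempty⇒∣∣>0 neX
    XX = setOp _·_ X X
    P = pairs X X
    g : Fin p → ℕ
    g b = ∑ (elems X) (λ t → ∑ P (λ { (a , s) → 𝟙 (b · t ≟ a · s) }))
    energy : (x * x) * (x * x) ≤ ∣ XX ∣ * ∑ (elems X) g
    energy = ≤-trans
      (pairs-collisions X X XX (uncurry _·_) (λ a∈ b∈ → ∈-setOp⁺ _·_ a∈ b∈ refl))
      (≤-reflexive (cong (∣ XX ∣ *_) (∑-product (elems X) (elems X) _)))
    g≤ : ∀ b → g b ≤ ∑ (elems X) (λ a → ∣ common X b a ∣)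
    g≤ b = begin
      g b
        ≡⟨ ∑-cong (elems X) (λ t → ∑-product (elems X) (elems X) _) ⟩
      ∑ (elems X) (λ t → ∑ (elems X) (λ a → ∑ (elems X) (λ s → 𝟙 (b · t ≟ a · s))))
        ≡⟨ ∑-swap (elems X) (elems X) _ ⟩
      ∑ (elems X) (λ a → ∑ (elems X) (λ t → ∑ (elems X) (λ s → 𝟙 (b · t ≟ a · s))))
        ≤⟨ ∑-mono (elems X) (λ {a} a∈ → ∑-mono (elems X) λ {t} _ → ∑-𝟙≤𝟙 (elems-unique X) (λ s → b · t ≟ a · s)
             (λ p q → ·-cancelˡ (λ a≡0 → 0∉X (subst (_∈ X) a≡0 (∈-elems⁻ a∈))) (trans (sym p) q))
             (any? λ s → (s ∈? X) ×-dec (b · t ≟ a · s)) (λ {s} s∈ eq → s , ∈-elems⁻ s∈ , eq)) ⟩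
      ∑ (elems X) (λ a → ∑ (elems X) (λ t → 𝟙 (any? λ s → (s ∈? X) ×-dec (b · t ≟ a · s))))
        ≤⟨ ∑-mono (elems X) (λ {a} _ → ∑-sift (λ t → any? λ s → (s ∈? X) ×-dec (b · t ≟ a · s))) ⟩
      ∑ (elems X) (λ a → ∣ common X b a ∣) ∎
    finish : (∃ λ b → b L.∈ elems X × ∑ (elems X) g ≤ length (elems X) * g b) → ∃ λ b → b ∈ X ×
      x ^ 3 ≤ ∣ XX ∣ * ∑ (elems X) (λ a → ∣ common X b a ∣)
    finish (b , b∈ , le) = b , ∈-elems⁻ b∈ , *-cancelˡ-≤ x {{>-nonZero 0<x}} (begin
      x * x ^ 3                      ≡⟨ eq₁ x ⟩
      (x * x) * (x * x)              ≤⟨ energy ⟩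
      ∣ XX ∣ * ∑ (elems X) g         ≤⟨ *-monoʳ-≤ ∣ XX ∣ le ⟩
      ∣ XX ∣ * (length (elems X) * g b)   ≡⟨ cong (λ l → ∣ XX ∣ * (l * g b)) (length-elems X) ⟩
      ∣ XX ∣ * (x * g b)             ≤⟨ *-monoʳ-≤ ∣ XX ∣ (*-monoʳ-≤ x (g≤ b)) ⟩
      ∣ XX ∣ * (x * f)               ≡⟨ eq₂ ∣ XX ∣ x f ⟩
      x * (∣ XX ∣ * f)               ∎)
      where
      f = ∑ (elems X) (λ a → ∣ common X b a ∣)
      eq₁ : ∀ x → x * x ^ 3 ≡ (x * x) * (x * x)
      eq₁ = solve 1 (λ x → x :* x :^ 3 := (x :* x) :* (x :* x)) refl
      eq₂ : ∀ m x f → m * (x * f) ≡ x * (m * f)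
      eq₂ = solve-∀

  average-collisions : (A B : Subset p) (M : ℕ) (g : Fin p × Fin p → ℕ) → Nonempty A → Nonempty B →
    (∣ A ∣ * ∣ B ∣) * (∣ A ∣ * ∣ B ∣) ≤ M * ∑ (pairs A B) g → ∃ λ i → ∣ A ∣ * ∣ B ∣ ≤ M * g i
  average-collisions A B M g neA neB le = finish (average (pairs A B) g (≤-trans 0<l (≤-reflexive (sym (length-pairs A B)))))
    where
    open ≤-Reasoning
    l = ∣ A ∣ * ∣ B ∣
    0<l = *-mono-< (Nonempty⇒∣∣>0 neA) (Nonempty⇒∣∣>0 neB)
    finish : (∃ λ i → i L.∈ pairs A B × ∑ (pairs A B) g ≤ length (pairs A B) * g i) → ∃ λ i → l ≤ M * g i
    finish (i , _ , avg) = i , *-cancelˡ-≤ l {{>-nonZero 0<l}} (begin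
      l * l                                 ≤⟨ le ⟩
      M * ∑ (pairs A B) g                   ≤⟨ *-monoʳ-≤ M avg ⟩
      M * (length (pairs A B) * g i)        ≡⟨ cong (λ k → M * (k * g i)) (length-pairs A B) ⟩
      M * (l * g i)                         ≡⟨ eq M l (g i) ⟩
      l * (M * g i)                         ∎)
      where
      eq : ∀ m x f → m * (x * f) ≡ x * (m * f)
      eq = solve-∀

  module Translates (σ : Fin p) (σσ≡1 : σ · σ ≡ 1ᶠ) (X U S : Subset p) (U⊆X : U ⊆ X) (neS : Nonempty S)
    (a b : Fin p) (b≢0 : b ≢ 0ᶠ) (S-common : ∀ {s} → s ∈ S → ∃ λ x → x ∈ X × b · s ≡ a · x)
    (M : ℕ) (∣X+σX∣≤M : ∣ X ⊞ σ ⊡ X ∣ ≤ M) where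

    -- `Plus` places a u in t + σ b S and `Minus` in t - σ b S. The latter is stated with the
    -- summand moved across, so that t is itself a value of `key`.
    Plus Minus : Fin p → Fin p → Fin p → Set
    Plus  t u s = a · u ≡ t ∔ (σ · (b · s))
    Minus t u s = (a · u) ∔ (σ · (b · s)) ≡ t

    plus? : ∀ t u s → Dec (Plus t u s)
    plus? t u s = a · u ≟ t ∔ (σ · (b · s))

    minus? : ∀ t u s → Dec (Minus t u s)
    minus? t u s = (a · u) ∔ (σ · (b · s)) ≟ t

    σ-cancel : ∀ {s s′} → σ · (b · s) ≡ σ · (b · s′) → s ≡ s′
    σ-cancel {s} {s′} eq = ·-cancelˡ b≢0 (trans (sym (undo (b · s))) (trans (cong (σ ·_) eq) (undo (b · s′))))
      where
      undo : ∀ y → σ · (σ · y) ≡ y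
      undo y = trans (sym (F.*-assoc σ σ y)) (trans (cong (_· y) σσ≡1) (F.*-identityˡ y))

    plus-functional : ∀ {t u s s′} → Plus t u s → Plus t u s′ → s ≡ s′
    plus-functional {t} p q = σ-cancel (∔-cancelˡ t _ _ (trans (sym p) q))

    minus-functional : ∀ {t u s s′} → Minus t u s → Minus t u s′ → s ≡ s′
    minus-functional {t} {u} p q = σ-cancel (∔-cancelˡ (a · u) _ _ (trans p (sym q)))

    key : Fin p × Fin p → Fin p
    key (u , s) = (a · u) ∔ (σ · (b · s))

    -- Since b S lies in a X, all values of `key` lie in a (X + σ X), a set of at most M elements,
    -- whatever Y is.
    energy : ∀ Y → Y ⊆ U → (∣ Y ∣ * ∣ S ∣) * (∣ Y ∣ * ∣ S ∣) ≤
      M * ∑ (pairs Y S) (λ i → ∑ (pairs Y S) (λ j → 𝟙 (key i ≟ key j)))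
    energy Y Y⊆U = ≤-trans (pairs-collisions Y S (a ⊡ (X ⊞ σ ⊡ X)) key key∈)
      (*-monoˡ-≤ _ (≤-trans (∣⊡∣≤ a (X ⊞ σ ⊡ X)) ∣X+σX∣≤M))
      where
      key∈ : ∀ {u s} → u ∈ Y → s ∈ S → key (u , s) ∈ a ⊡ (X ⊞ σ ⊡ X)
      key∈ {u} {s} u∈ s∈ = let x , x∈X , eq = S-common s∈ in
        ∈-⊡⁺ (∈-⊞⁺ (U⊆X (Y⊆U u∈)) (∈-⊡⁺ x∈X refl) refl)
          (trans (solveᶠ 4 (λ a u σ x → a :*ᶠ (u :+ᶠ σ :*ᶠ x) :=ᶠ a :*ᶠ u :+ᶠ σ :*ᶠ (a :*ᶠ x)) refl a u σ x)
            (cong (λ y → (a · u) ∔ (σ · y)) (sym eq)))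

    -- Averaging over one of the two colliding pairs leaves a single value t of `key` with many
    -- representations.
    popular-minus : ∀ Y → Y ⊆ U → Nonempty Y → ∃ λ t →
      ∣ Y ∣ * ∣ S ∣ ≤ M * ∑ (elems Y) (λ u → ∑ (elems S) (λ s → 𝟙 (minus? t u s)))
    popular-minus Y Y⊆U neY = finish (average-collisions Y S M _ neY neS (energy Y Y⊆U))
      where
      finish : (∃ λ i → ∣ Y ∣ * ∣ S ∣ ≤ M * ∑ (pairs Y S) (λ j → 𝟙 (key i ≟ key j))) → ∃ λ t →
        ∣ Y ∣ * ∣ S ∣ ≤ M * ∑ (elems Y) (λ u → ∑ (elems S) (λ s → 𝟙 (minus? t u s)))
      finish (i , le) = key i , ≤-trans le (*-monoʳ-≤ M (≤-trans
        (≤-reflexive (∑-product (elems Y) (elems S) _))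
        (∑-mono (elems Y) λ {u} _ → ∑-mono (elems S) λ {s} _ → 𝟙-mono (key i ≟ key (u , s)) (minus? (key i) u s) sym)))

    -- A solution of a u + σ b s = a u′ + σ b s′ is also one of a u - σ b s′ = a u′ - σ b s:
    -- sums and differences have the same energy.
    popular-plus : ∀ Y → Y ⊆ U → Nonempty Y → ∃ λ t →
      ∣ Y ∣ * ∣ S ∣ ≤ M * ∑ (elems Y) (λ u → ∑ (elems S) (λ s → 𝟙 (plus? t u s)))
    popular-plus Y Y⊆U neY = finish (average-collisions Y S M g neY neS
        (≤-trans (energy Y Y⊆U) (≤-reflexive (cong (M *_) exchange))))
      where
      open ≡-Reasoning
      g : Fin p × Fin p → ℕ
      g (u , s′) = ∑ (elems Y) (λ u′ → ∑ (elems S) (λ s → 𝟙 (key (u , s) ≟ key (u′ , s′))))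
      exchange : ∑ (pairs Y S) (λ i → ∑ (pairs Y S) (λ j → 𝟙 (key i ≟ key j))) ≡ ∑ (pairs Y S) g
      exchange = begin
        ∑ (pairs Y S) (λ i → ∑ (pairs Y S) (λ j → 𝟙 (key i ≟ key j)))
          ≡⟨ ∑-product (elems Y) (elems S) _ ⟩
        ∑ (elems Y) (λ u → ∑ (elems S) (λ s → ∑ (pairs Y S) (λ j → 𝟙 (key (u , s) ≟ key j))))
          ≡⟨ ∑-cong (elems Y) (λ u → ∑-cong (elems S) λ s →
               trans (∑-product (elems Y) (elems S) _) (∑-swap (elems Y) (elems S) _)) ⟩
        ∑ (elems Y) (λ u → ∑ (elems S) (λ s → ∑ (elems S) (λ s′ → ∑ (elems Y) (λ u′ → 𝟙 (key (u , s) ≟ key (u′ , s′))))))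
          ≡⟨ ∑-cong (elems Y) (λ u → ∑-swap (elems S) (elems S) _) ⟩
        ∑ (elems Y) (λ u → ∑ (elems S) (λ s′ → ∑ (elems S) (λ s → ∑ (elems Y) (λ u′ → 𝟙 (key (u , s) ≟ key (u′ , s′))))))
          ≡⟨ ∑-cong (elems Y) (λ u → ∑-cong (elems S) λ s′ → ∑-swap (elems S) (elems Y) _) ⟩
        ∑ (elems Y) (λ u → ∑ (elems S) (λ s′ → g (u , s′)))
          ≡⟨ ∑-product (elems Y) (elems S) g ⟨
        ∑ (pairs Y S) g ∎
      move : ∀ {a₁ a₂ b₁ b₂} → a₁ ∔ b₁ ≡ a₂ ∔ b₂ → a₂ ≡ (a₁ ∔ neg b₂) ∔ b₁
      move {a₁} {a₂} {b₁} {b₂} eq = ∔-cancelʳ b₂ _ _ (begin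
        a₂ ∔ b₂                            ≡⟨ eq ⟨
        a₁ ∔ b₁                            ≡⟨ F.+-identityʳ _ ⟨
        (a₁ ∔ b₁) ∔ 0ᶠ                     ≡⟨ cong ((a₁ ∔ b₁) ∔_) (F.-‿inverseˡ b₂) ⟨
        (a₁ ∔ b₁) ∔ (neg b₂ ∔ b₂)          ≡⟨ solveᶠ 4 (λ a b n c → (a :+ᶠ b) :+ᶠ (n :+ᶠ c) :=ᶠ ((a :+ᶠ n) :+ᶠ b) :+ᶠ c) refl a₁ b₁ (neg b₂) b₂ ⟩
        ((a₁ ∔ neg b₂) ∔ b₁) ∔ b₂          ∎)
      finish : (∃ λ i → ∣ Y ∣ * ∣ S ∣ ≤ M * g i) → ∃ λ t →
        ∣ Y ∣ * ∣ S ∣ ≤ M * ∑ (elems Y) (λ u → ∑ (elems S) (λ s → 𝟙 (plus? t u s)))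
      finish ((u , s′) , le) = t , ≤-trans le (*-monoʳ-≤ M
        (∑-mono (elems Y) λ {u′} _ → ∑-mono (elems S) λ {s} _ → 𝟙-mono (key (u , s) ≟ key (u′ , s′)) (plus? t u′ s) move))
        where
        t = (a · u) ∔ neg (σ · (b · s′))

  pairs-unique : (A B : Subset p) → Unique (pairs A B)
  pairs-unique A B = Unique.cartesianProduct⁺ (elems-unique A) (elems-unique B)

  ∑-pairs-⊆ : ∀ {A A′ B B′ : Subset p} → A ⊆ A′ → B ⊆ B′ → (f : Fin p × Fin p → ℕ) →
    ∑ (pairs A B) f ≤ ∑ (pairs A′ B′) f
  ∑-pairs-⊆ {A} {A′} {B} {B′} A⊆ B⊆ f = begin
    ∑ (pairs A B) f                                        ≡⟨ ∑-product (elems A) (elems B) f ⟩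
    ∑ (elems A) (λ a → ∑ (elems B) (λ b → f (a , b)))      ≤⟨ ∑-mono (elems A) (λ {a} _ → ∑-⊆ B⊆ _) ⟩
    ∑ (elems A) (λ a → ∑ (elems B′) (λ b → f (a , b)))     ≤⟨ ∑-⊆ A⊆ _ ⟩
    ∑ (elems A′) (λ a → ∑ (elems B′) (λ b → f (a , b)))    ≡⟨ ∑-product (elems A′) (elems B′) f ⟨
    ∑ (pairs A′ B′) f                                      ∎
    where open ≤-Reasoning

  ⊡-mono : ∀ {A B c} → A ⊆ B → c ⊡ A ⊆ c ⊡ B
  ⊡-mono A⊆B x∈ = let a , a∈A , eq = ∈-⊡⁻ x∈ in ∈-⊡⁺ (A⊆B a∈A) eq

  form : Fin p → Fin p × Fin p → Fin p
  form η (u , v) = u ∔ (η · v)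

  energy : Subset p → Subset p → Fin p → ℕ
  energy V W η = ∑ (pairs V W) (λ i → ∑ (pairs V W) (λ j → 𝟙 (form η i ≟ form η j)))

  energy-mono : ∀ {V V′ W W′ η} → V ⊆ V′ → W ⊆ W′ → energy V W η ≤ energy V′ W′ η
  energy-mono {V} {V′} {W} {W′} {η} V⊆ W⊆ = ≤-trans
    (∑-mono (pairs V W) λ {i} _ → ∑-pairs-⊆ V⊆ W⊆ (λ j → 𝟙 (form η i ≟ form η j)))
    (∑-pairs-⊆ V⊆ W⊆ _)

  -- Summed over all η, a pair collides with itself p times, while distinct pairs collide for at
  -- most one η. With l = |U|² the total is at most p l + l², and l ≤ k p makes the average at most
  -- (k + 1) l.
  small-energy : ∀ U k → 0 < p → ∣ U ∣ * ∣ U ∣ ≤ k * p →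
    ∃ λ η → energy U U η ≤ (k + 1) * (∣ U ∣ * ∣ U ∣)
  small-energy U k 0<p m²≤kp = finish (average-≤ All (energy U U) (≤-trans 0<p (≤-reflexive (sym length-All))))
    where
    open ≤-Reasoning
    All = elems (⊤ {p})
    P = pairs U U
    l = ∣ U ∣ * ∣ U ∣
    length-All : length All ≡ p
    length-All = trans (length-elems (⊤ {p})) (∣⊤∣≡n p)
    _≟ₚ_ : (i j : Fin p × Fin p) → Dec (i ≡ j)
    _≟ₚ_ = ≡-dec _≟_ _≟_
    agree : ∀ {η η′ u v u′ v′} → form η (u , v) ≡ form η (u′ , v′) → form η′ (u , v) ≡ form η′ (u′ , v′) →
      v ≢ v′ → η ≡ η′
    agree {η} {η′} {u} {v} {u′} {v′} e e′ v≢v′ with domain {η} {η′} {v} {v′} (∔-cancelˡ (u ∔ u′) _ _ rearranged)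
      where
      -- The equation for η added to the reversed equation for η′: after cancelling u + u′ it says
      -- (η - η′)(v - v′) = 0 in the form required by `domain`.
      rearranged : (u ∔ u′) ∔ ((η · v) ∔ (η′ · v′)) ≡ (u ∔ u′) ∔ ((η′ · v) ∔ (η · v′))
      rearranged = trans
        (solveᶠ 4 (λ u u′ x y → (u :+ᶠ u′) :+ᶠ (x :+ᶠ y) :=ᶠ (u :+ᶠ x) :+ᶠ (u′ :+ᶠ y)) refl u u′ (η · v) (η′ · v′))
        (trans (cong₂ _∔_ e (sym e′))
        (solveᶠ 4 (λ u u′ x y → (u′ :+ᶠ y) :+ᶠ (u :+ᶠ x) :=ᶠ (u :+ᶠ u′) :+ᶠ (x :+ᶠ y)) refl u u′ (η′ · v) (η · v′)))
    ... | inj₁ η≡η′ = η≡η′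
    ... | inj₂ v≡v′ = contradiction v≡v′ v≢v′
    per-pair : ∀ i j → ∑ All (λ η → 𝟙 (form η i ≟ form η j)) ≤ p * 𝟙 (i ≟ₚ j) + 1
    per-pair (u , v) (u′ , v′) with (u , v) ≟ₚ (u′ , v′) | v ≟ v′
    ... | yes refl | _ = begin
      ∑ All (λ η → 𝟙 (form η (u , v) ≟ form η (u , v)))  ≤⟨ ∑-mono All (λ {η} _ → 𝟙≤1 (form η (u , v) ≟ form η (u , v))) ⟩
      ∑ All (λ _ → 1)                                    ≡⟨ ∑-const All 1 ⟩
      length All * 1                                     ≡⟨ cong (_* 1) length-All ⟩
      p * 1                                              ≤⟨ m≤m+n (p * 1) 1 ⟩
      p * 1 + 1                                          ∎
    ... | no ≢ | yes refl = ≤-trans (∑-𝟙≤1 (elems-unique ⊤) (λ η → form η (u , v) ≟ form η (u′ , v))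
        λ e _ → contradiction (cong (_, v) (∔-cancelʳ _ _ _ e)) ≢) (m≤n+m 1 (p * 0))
    ... | no _ | no v≢v′ = ≤-trans (∑-𝟙≤1 (elems-unique ⊤) (λ η → form η (u , v) ≟ form η (u′ , v′))
        λ e e′ → agree e e′ v≢v′) (m≤n+m 1 (p * 0))
    total : ∑ All (energy U U) ≤ p * l + l * l
    total = begin
      ∑ All (energy U U)
        ≡⟨ ∑-swap All P _ ⟩
      ∑ P (λ i → ∑ All (λ η → ∑ P (λ j → 𝟙 (form η i ≟ form η j))))
        ≡⟨ ∑-cong P (λ i → ∑-swap All P _) ⟩
      ∑ P (λ i → ∑ P (λ j → ∑ All (λ η → 𝟙 (form η i ≟ form η j))))
        ≤⟨ ∑-mono P (λ {i} _ → ∑-mono P λ {j} _ → per-pair i j) ⟩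
      ∑ P (λ i → ∑ P (λ j → p * 𝟙 (i ≟ₚ j) + 1))
        ≡⟨ ∑-cong P (λ i → trans (∑-+ P (λ j → p * 𝟙 (i ≟ₚ j)) (λ _ → 1)) (cong₂ _+_ (∑-*ˡ P p (λ j → 𝟙 (i ≟ₚ j))) (∑-const P 1))) ⟩
      ∑ P (λ i → p * ∑ P (λ j → 𝟙 (i ≟ₚ j)) + length P * 1)
        ≤⟨ ∑-mono P (λ {i} _ → +-monoˡ-≤ (length P * 1) (*-monoʳ-≤ p
             (∑-𝟙≤1 (pairs-unique U U) (i ≟ₚ_) λ e e′ → trans (sym e) e′))) ⟩
      ∑ P (λ i → p * 1 + length P * 1)
        ≡⟨ ∑-const P _ ⟩
      length P * (p * 1 + length P * 1)
        ≡⟨ cong (λ l → l * (p * 1 + l * 1)) (length-pairs U U) ⟩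
      l * (p * 1 + l * 1)
        ≡⟨ eq l p ⟩
      p * l + l * l ∎
      where
      eq : ∀ l p → l * (p * 1 + l * 1) ≡ p * l + l * l
      eq = solve-∀
    finish : (∃ λ η → η L.∈ All × length All * energy U U η ≤ ∑ All (energy U U)) →
      ∃ λ η → energy U U η ≤ (k + 1) * l
    finish (η , _ , le) = η , *-cancelˡ-≤ p {{>-nonZero 0<p}} (begin
      p * energy U U η               ≡⟨ cong (_* energy U U η) length-All ⟨
      length All * energy U U η      ≤⟨ le ⟩
      ∑ All (energy U U)             ≤⟨ total ⟩
      p * l + l * l                  ≤⟨ +-monoʳ-≤ (p * l) (*-monoˡ-≤ l m²≤kp) ⟩
      p * l + k * p * l              ≡⟨ eq p k l ⟩
      p * ((k + 1) * l)              ∎)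
      where
      eq : ∀ p k l → p * l + k * p * l ≡ p * ((k + 1) * l)
      eq = solve-∀

  -- Inclusion-exclusion: two parts of three quarters each exceed U by one half.
  two-thirds-∩ : ∀ (U V W : Subset p) → V ⊆ U → W ⊆ U → 3 * ∣ U ∣ ≤ 4 * ∣ V ∣ → 3 * ∣ U ∣ ≤ 4 * ∣ W ∣ →
    ∣ U ∣ ≤ 2 * ∣ V ∩ W ∣
  two-thirds-∩ U V W V⊆ W⊆ v w = *-cancelˡ-≤ 2 (+-cancelˡ-≤ (4 * ∣ U ∣) _ _ (begin
    4 * ∣ U ∣ + 2 * ∣ U ∣              ≡⟨ eq₁ ∣ U ∣ ⟩
    3 * ∣ U ∣ + 3 * ∣ U ∣              ≤⟨ +-mono-≤ v w ⟩
    4 * ∣ V ∣ + 4 * ∣ W ∣              ≡⟨ *-distribˡ-+ 4 ∣ V ∣ ∣ W ∣ ⟨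
    4 * (∣ V ∣ + ∣ W ∣)                ≡⟨ cong (4 *_) (∣∪∣+∣∩∣ V W) ⟨
    4 * (∣ V ∪ W ∣ + ∣ V ∩ W ∣)        ≤⟨ *-monoʳ-≤ 4 (+-monoˡ-≤ ∣ V ∩ W ∣ (p⊆q⇒∣p∣≤∣q∣ V∪W⊆U)) ⟩
    4 * (∣ U ∣ + ∣ V ∩ W ∣)            ≡⟨ eq₂ ∣ U ∣ ∣ V ∩ W ∣ ⟩
    4 * ∣ U ∣ + 2 * (2 * ∣ V ∩ W ∣)    ∎))
    where
    open ≤-Reasoning
    V∪W⊆U : V ∪ W ⊆ U
    V∪W⊆U x∈ with x∈p∪q⁻ V W x∈
    ... | inj₁ x∈V = V⊆ x∈V
    ... | inj₂ x∈W = W⊆ x∈W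
    eq₁ : ∀ u → 4 * u + 2 * u ≡ 3 * u + 3 * u
    eq₁ = solve-∀
    eq₂ : ∀ u v → 4 * (u + v) ≡ 4 * u + 2 * (2 * v)
    eq₂ = solve-∀

  -- Quotients of differences

  -- ξ is a quotient (a - b) / (c - d) of differences of U.
  Quotient : Subset p → Fin p → Set
  Quotient U ξ = ∃₂ λ c d → c ∈ U × d ∈ U × c ≢ d × ∃₂ λ a b → a ∈ U × b ∈ U × (ξ · c) ∔ b ≡ (ξ · d) ∔ a

  quotient? : ∀ U ξ → Dec (Quotient U ξ)
  quotient? U ξ = any? λ c → any? λ d → (c ∈? U) ×-dec ((d ∈? U) ×-dec ((¬? (c ≟ d)) ×-dec
    (any? λ a → any? λ b → (a ∈? U) ×-dec ((b ∈? U) ×-dec ((ξ · c) ∔ b ≟ (ξ · d) ∔ a)))))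

  -- A collision with y ≠ y′ would exhibit ξ as the quotient (x′ - x) / (y - y′).
  ¬Quotient⇒injective : ∀ {U ξ x x′ y y′} → ¬ Quotient U ξ → x ∈ U → x′ ∈ U → y ∈ U → y′ ∈ U →
    x ∔ (ξ · y) ≡ x′ ∔ (ξ · y′) → (x , y) ≡ (x′ , y′)
  ¬Quotient⇒injective {ξ = ξ} {x} {x′} {y} {y′} ¬q x∈ x′∈ y∈ y′∈ eq with y ≟ y′
  ... | yes refl = cong (_, y) (∔-cancelʳ _ _ _ eq)
  ... | no  y≢y′ = contradiction (y , y′ , y∈ , y′∈ , y≢y′ , x′ , x , x′∈ , x∈ ,
        trans (F.+-comm _ x) (trans eq (F.+-comm x′ _))) ¬q

  -- Coverings of dilates and the pivot argument

  module Pivot (σ : Fin p) (σ≡±1 : σ ≡ 1ᶠ ⊎ σ ≡ neg 1ᶠ) (σσ≡1 : σ · σ ≡ 1ᶠ)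
    (generates : ∀ (P : Fin p → Set) → P 0ᶠ → (∀ x → P x → P (x ∔ σ)) → ∀ x → P x)
    (X U : Subset p) (U⊆X : U ⊆ X) (neU : Nonempty U) (N M : ℕ) (0<N : 0 < N)
    (∣X+σX∣≤M : ∣ X ⊞ σ ⊡ X ∣ ≤ M)
    (e : Fin p) (e≢0 : e ≢ 0ᶠ) (rich : ∀ {a} → a ∈ U → N ≤ ∣ common X e a ∣) where

    fourfold : Subset p
    fourfold = X ⊞ σ ⊡ X ⊞ σ ⊡ X ⊞ σ ⊡ X

    Cover : (Fin p → Fin p → Fin p → Set) → Set
    Cover ρ = ∃₂ λ T V → V ⊆ U × ∣ T ∣ * N ≤ M * 4 × 3 * ∣ U ∣ ≤ 4 * ∣ V ∣ ×
      (∀ {v} → v ∈ V → ∃₂ λ t x → t ∈ T × x ∈ X × ρ t v x)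

    module _ {a : Fin p} (a∈U : a ∈ U) where

      private
        S = common X e a
        module Tr = Translates σ σσ≡1 X U S U⊆X (∣∣>0⇒Nonempty S (≤-trans 0<N (rich a∈U))) a e e≢0
          (λ s∈ → proj₂ (∈-common⁻ X e a s∈)) M ∣X+σX∣≤M

        weaken : ∀ {ρ : Fin p → Fin p → Fin p → Set} →
          (∃₂ λ T V → V ⊆ U × ∣ T ∣ * N ≤ M * 4 × 3 * ∣ U ∣ ≤ 4 * ∣ V ∣ ×
            (∀ {v} → v ∈ V → ∃₂ λ t s → t ∈ T × s ∈ S × ρ t v s)) → Cover ρ
        weaken (T , V , V⊆U , few , most , f) = T , V , V⊆U , few , most , λ v∈ →
          let t , s , t∈ , s∈ , r = f v∈ in t , s , t∈ , proj₁ (∈-common⁻ X e a s∈) , r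

      cover-plus : Cover (λ t v x → a · v ≡ t ∔ (σ · (e · x)))
      cover-plus = weaken (Covering.cover U S N M neU 0<N (rich a∈U) Tr.plus? Tr.plus-functional Tr.popular-plus)

      cover-minus : Cover (λ t v x → (a · v) ∔ (σ · (e · x)) ≡ t)
      cover-minus = weaken (Covering.cover U S N M neU 0<N (rich a∈U) Tr.minus? Tr.minus-functional Tr.popular-minus)

      -- One of the four summands of `fourfold` is X itself, without σ, so one covering needs the
      -- sign + for either value of σ. For σ = -1 the minus covering provides it, as t - σ e x = t +
      -- e x.
      cover-one : Cover (λ t v x → a · v ≡ t ∔ (e · x))
      cover-one = from-sign σ≡±1
        where
        open ≡-Reasoning
        from-sign : σ ≡ 1ᶠ ⊎ σ ≡ neg 1ᶠ → Cover (λ t v x → a · v ≡ t ∔ (e · x))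
        from-sign (inj₁ σ≡1) = let T , V , V⊆U , few , most , f = cover-plus in T , V , V⊆U , few , most , λ v∈ →
          let t , x , t∈ , x∈ , eq = f v∈ in t , x , t∈ , x∈ ,
          trans eq (cong (t ∔_) (trans (cong (_· (e · x)) σ≡1) (F.*-identityˡ (e · x))))
        from-sign (inj₂ σ≡-1) = let T , V , V⊆U , few , most , f = cover-minus in T , V , V⊆U , few , most , λ {v} v∈ →
          let t , x , t∈ , x∈ , eq = f v∈ in t , x , t∈ , x∈ , sym (begin
            t ∔ (e · x)                                ≡⟨ cong (_∔ (e · x)) eq ⟨
            ((a · v) ∔ (σ · (e · x))) ∔ (e · x)        ≡⟨ F.+-assoc (a · v) _ _ ⟩
            (a · v) ∔ ((σ · (e · x)) ∔ (e · x))        ≡⟨ cong (λ s → (a · v) ∔ ((s · (e · x)) ∔ (e · x))) σ≡-1 ⟩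
            (a · v) ∔ ((neg 1ᶠ · (e · x)) ∔ (e · x))   ≡⟨ cong (λ y → (a · v) ∔ ((neg 1ᶠ · (e · x)) ∔ y)) (F.*-identityˡ (e · x)) ⟨
            (a · v) ∔ ((neg 1ᶠ · (e · x)) ∔ (1ᶠ · (e · x))) ≡⟨ cong ((a · v) ∔_) (F.distribʳ (e · x) (neg 1ᶠ) 1ᶠ) ⟨
            (a · v) ∔ ((neg 1ᶠ ∔ 1ᶠ) · (e · x))        ≡⟨ cong (λ y → (a · v) ∔ (y · (e · x))) (F.-‿inverseˡ 1ᶠ) ⟩
            (a · v) ∔ (0ᶠ · (e · x))                   ≡⟨ cong ((a · v) ∔_) (F.zeroˡ (e · x)) ⟩
            (a · v) ∔ 0ᶠ                               ≡⟨ F.+-identityʳ (a · v) ⟩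
            a · v                                      ∎)

    -- (c - d)(V + ξ W) = (c - d) V + (a - b) W lies in c V - d V + a W - b W, and the signs of the
    -- translates are chosen so that these four sets contribute X, σX, σX, σX.
    quotient-bound : ∀ {ξ} → Quotient U ξ → ∃₂ λ V W → V ⊆ U × W ⊆ U ×
      ∣ U ∣ ≤ 2 * ∣ V ∣ × ∣ U ∣ ≤ 2 * ∣ W ∣ × ∣ V ⊞ ξ ⊡ W ∣ * N ^ 4 ≤ M ^ 4 * ∣ fourfold ∣ * 256
    quotient-bound {ξ} (c , d , c∈ , d∈ , c≢d , a , b , a∈ , b∈ , slope) =
      combine (cover-one c∈) (cover-minus d∈) (cover-plus a∈) (cover-minus b∈)
      where
      combine : Cover (λ t v x → c · v ≡ t ∔ (e · x)) → Cover (λ t v x → (d · v) ∔ (σ · (e · x)) ≡ t) →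
        Cover (λ t v x → a · v ≡ t ∔ (σ · (e · x))) → Cover (λ t v x → (b · v) ∔ (σ · (e · x)) ≡ t) →
        ∃₂ λ V W → V ⊆ U × W ⊆ U ×
          ∣ U ∣ ≤ 2 * ∣ V ∣ × ∣ U ∣ ≤ 2 * ∣ W ∣ × ∣ V ⊞ ξ ⊡ W ∣ * N ^ 4 ≤ M ^ 4 * ∣ fourfold ∣ * 256
      combine (T₁ , V₁ , V₁⊆ , few₁ , most₁ , f₁) (T₂ , V₂ , V₂⊆ , few₂ , most₂ , f₂)
              (T₃ , W₁ , W₁⊆ , few₃ , most₃ , f₃) (T₄ , W₂ , W₂⊆ , few₄ , most₄ , f₄) =
        V , W , V₁⊆ ∘ p∩q⊆p V₁ V₂ , W₁⊆ ∘ p∩q⊆p W₁ W₂ ,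
        two-thirds-∩ U V₁ V₂ V₁⊆ V₂⊆ most₁ most₂ , two-thirds-∩ U W₁ W₂ W₁⊆ W₂⊆ most₃ most₄ , bound
        where
        V = V₁ ∩ V₂
        W = W₁ ∩ W₂
        K = cartesianProduct (cartesianProduct (pairs T₁ T₂) (pairs T₃ T₄)) (elems fourfold)
        -- In terms of differences, (c - d) z = t₁ - t₂ + t₃ - t₄ + e f. Because c ≠ d, the
        -- translates and f determine z.
        R : Fin p → ((Fin p × Fin p) × (Fin p × Fin p)) × Fin p → Set
        R z (((t₁ , t₂) , (t₃ , t₄)) , f) = (c · z) ∔ (t₂ ∔ t₄) ≡ ((d · z) ∔ (t₁ ∔ t₃)) ∔ (e · f)
        R? : ∀ z k → Dec (R z k)
        R? z (((t₁ , t₂) , (t₃ , t₄)) , f) = (c · z) ∔ (t₂ ∔ t₄) ≟ ((d · z) ∔ (t₁ ∔ t₃)) ∔ (e · f)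
        R-injective : ∀ {z z′ k} → R z k → R z′ k → z ≡ z′
        R-injective {z} {z′} {((t₁ , t₂) , (t₃ , t₄)) , f} r r′ with domain {c} {d} {z} {z′} (∔-cancelʳ ((t₂ ∔ t₄) ∔ ((t₁ ∔ t₃) ∔ (e · f))) _ _ (begin
            ((c · z) ∔ (d · z′)) ∔ (k ∔ (l ∔ m))        ≡⟨ solveᶠ 5 (λ x y k l m → (x :+ᶠ y) :+ᶠ (k :+ᶠ (l :+ᶠ m)) :=ᶠ (x :+ᶠ k) :+ᶠ ((y :+ᶠ l) :+ᶠ m)) refl (c · z) (d · z′) k l m ⟩
            ((c · z) ∔ k) ∔ (((d · z′) ∔ l) ∔ m)        ≡⟨ cong₂ _∔_ r (sym r′) ⟩
            (((d · z) ∔ l) ∔ m) ∔ ((c · z′) ∔ k)        ≡⟨ solveᶠ 5 (λ x y k l m → ((x :+ᶠ l) :+ᶠ m) :+ᶠ (y :+ᶠ k) :=ᶠ (x :+ᶠ y) :+ᶠ (k :+ᶠ (l :+ᶠ m))) refl (d · z) (c · z′) k l m ⟩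
            ((d · z) ∔ (c · z′)) ∔ (k ∔ (l ∔ m))        ∎))
          where
          open ≡-Reasoning
          k = t₂ ∔ t₄
          l = t₁ ∔ t₃
          m = e · f
        ... | inj₁ c≡d  = contradiction c≡d c≢d
        ... | inj₂ z≡z′ = z≡z′
        identity : ∀ {v w t₁ t₂ t₃ t₄ x₁ x₂ x₃ x₄} → c · v ≡ t₁ ∔ (e · x₁) → (d · v) ∔ (σ · (e · x₂)) ≡ t₂ →
          a · w ≡ t₃ ∔ (σ · (e · x₃)) → (b · w) ∔ (σ · (e · x₄)) ≡ t₄ →
          R (v ∔ (ξ · w)) (((t₁ , t₂) , (t₃ , t₄)) , ((x₁ ∔ (σ · x₂)) ∔ (σ · x₃)) ∔ (σ · x₄))
        identity {v} {w} {t₁} {_} {t₃} {_} {x₁} {x₂} {x₃} {x₄} cv refl aw refl = begin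
          (c · (v ∔ (ξ · w))) ∔ (((d · v) ∔ s₂) ∔ ((b · w) ∔ s₄))
            ≡⟨ solveᶠ 8 (λ c d b v w ξ s₂ s₄ →
                 (c :*ᶠ (v :+ᶠ (ξ :*ᶠ w))) :+ᶠ (((d :*ᶠ v) :+ᶠ s₂) :+ᶠ ((b :*ᶠ w) :+ᶠ s₄)) :=ᶠ
                 (c :*ᶠ v) :+ᶠ ((((ξ :*ᶠ c) :+ᶠ b) :*ᶠ w) :+ᶠ ((d :*ᶠ v) :+ᶠ (s₂ :+ᶠ s₄)))) refl c d b v w ξ s₂ s₄ ⟩
          -- Here the quotient relation enters: ξ c + b is exchanged for ξ d + a, which trades the
          -- covering of b w for that of a w.
          (c · v) ∔ ((((ξ · c) ∔ b) · w) ∔ ((d · v) ∔ (s₂ ∔ s₄)))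
            ≡⟨ cong₂ (λ x y → x ∔ ((y · w) ∔ ((d · v) ∔ (s₂ ∔ s₄)))) cv slope ⟩
          (t₁ ∔ (e · x₁)) ∔ ((((ξ · d) ∔ a) · w) ∔ ((d · v) ∔ (s₂ ∔ s₄)))
            ≡⟨ cong (λ y → (t₁ ∔ (e · x₁)) ∔ (y ∔ ((d · v) ∔ (s₂ ∔ s₄))))
                 (trans (F.distribʳ w (ξ · d) a) (cong (((ξ · d) · w) ∔_) aw)) ⟩
          (t₁ ∔ (e · x₁)) ∔ ((((ξ · d) · w) ∔ (t₃ ∔ (σ · (e · x₃)))) ∔ ((d · v) ∔ (s₂ ∔ s₄)))
            ≡⟨ solveᶠ 12 (λ d v w ξ t₁ t₃ e σ x₁ x₂ x₃ x₄ →
                 (t₁ :+ᶠ (e :*ᶠ x₁)) :+ᶠ ((((ξ :*ᶠ d) :*ᶠ w) :+ᶠ (t₃ :+ᶠ (σ :*ᶠ (e :*ᶠ x₃)))) :+ᶠ ((d :*ᶠ v) :+ᶠ ((σ :*ᶠ (e :*ᶠ x₂)) :+ᶠ (σ :*ᶠ (e :*ᶠ x₄))))) :=ᶠ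
                 ((d :*ᶠ (v :+ᶠ (ξ :*ᶠ w))) :+ᶠ (t₁ :+ᶠ t₃)) :+ᶠ (e :*ᶠ (((x₁ :+ᶠ (σ :*ᶠ x₂)) :+ᶠ (σ :*ᶠ x₃)) :+ᶠ (σ :*ᶠ x₄)))) refl d v w ξ t₁ t₃ e σ x₁ x₂ x₃ x₄ ⟩
          ((d · (v ∔ (ξ · w))) ∔ (t₁ ∔ t₃)) ∔ (e · (((x₁ ∔ (σ · x₂)) ∔ (σ · x₃)) ∔ (σ · x₄))) ∎
          where
          open ≡-Reasoning
          s₂ = σ · (e · x₂)
          s₄ = σ · (e · x₄)
        total : ∀ {z} → z ∈ V ⊞ ξ ⊡ W → ∃ λ k → k L.∈ K × R z k
        total z∈ with ∈-⊞⁻ z∈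
        ... | v , y , v∈ , y∈ , refl with ∈-⊡⁻ y∈
        ... | w , w∈ , refl =
          let v∈₁ , v∈₂ = x∈p∩q⁻ V₁ V₂ v∈
              w∈₁ , w∈₂ = x∈p∩q⁻ W₁ W₂ w∈
              t₁ , x₁ , t₁∈ , x₁∈ , eq₁ = f₁ v∈₁
              t₂ , x₂ , t₂∈ , x₂∈ , eq₂ = f₂ v∈₂
              t₃ , x₃ , t₃∈ , x₃∈ , eq₃ = f₃ w∈₁
              t₄ , x₄ , t₄∈ , x₄∈ , eq₄ = f₄ w∈₂
          in _ , ∈-cartesianProduct⁺ (∈-cartesianProduct⁺ (∈-pairs⁺ t₁∈ t₂∈) (∈-pairs⁺ t₃∈ t₄∈))
                   (∈-elems⁺ (∈-⊞⁺ (∈-⊞⁺ (∈-⊞⁺ x₁∈ (∈-⊡⁺ x₂∈ refl) refl) (∈-⊡⁺ x₃∈ refl) refl) (∈-⊡⁺ x₄∈ refl) refl))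
               , identity eq₁ eq₂ eq₃ eq₄
        length-K : length K ≡ ((∣ T₁ ∣ * ∣ T₂ ∣) * (∣ T₃ ∣ * ∣ T₄ ∣)) * ∣ fourfold ∣
        length-K = trans (length-product (cartesianProduct (pairs T₁ T₂) (pairs T₃ T₄)) (elems fourfold)) (cong₂ _*_
          (trans (length-product (pairs T₁ T₂) (pairs T₃ T₄)) (cong₂ _*_ (length-pairs T₁ T₂) (length-pairs T₃ T₄)))
          (length-elems fourfold))
        -- Each of the four coverings uses at most 4M / N translates, whence 256 = 4⁴.
        bound : ∣ V ⊞ ξ ⊡ W ∣ * N ^ 4 ≤ M ^ 4 * ∣ fourfold ∣ * 256
        bound = begin
          ∣ V ⊞ ξ ⊡ W ∣ * N ^ 4                                     ≤⟨ *-monoˡ-≤ (N ^ 4) (∣∣≤length (V ⊞ ξ ⊡ W) K R? total (λ {i} {i′} {j} → R-injective {i} {i′} {j})) ⟩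
          length K * N ^ 4                                          ≡⟨ cong (_* N ^ 4) length-K ⟩
          ((∣ T₁ ∣ * ∣ T₂ ∣) * (∣ T₃ ∣ * ∣ T₄ ∣)) * ∣ fourfold ∣ * N ^ 4
            ≡⟨ eq₁ (∣ T₁ ∣) (∣ T₂ ∣) (∣ T₃ ∣) (∣ T₄ ∣) (∣ fourfold ∣) N ⟩
          ((∣ T₁ ∣ * N) * (∣ T₂ ∣ * N)) * ((∣ T₃ ∣ * N) * (∣ T₄ ∣ * N)) * ∣ fourfold ∣
            ≤⟨ *-monoˡ-≤ ∣ fourfold ∣ (*-mono-≤ (*-mono-≤ few₁ few₂) (*-mono-≤ few₃ few₄)) ⟩
          ((M * 4) * (M * 4)) * ((M * 4) * (M * 4)) * ∣ fourfold ∣  ≡⟨ eq₂ M 4 ∣ fourfold ∣ ⟩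
          M ^ 4 * ∣ fourfold ∣ * 256                                ∎
          where
          open ≤-Reasoning
          eq₁ : ∀ a b c d f n → ((a * b) * (c * d)) * f * n ^ 4 ≡ ((a * n) * (b * n)) * ((c * n) * (d * n)) * f
          eq₁ = solve 6 (λ a b c d f n → ((a :* b) :* (c :* d)) :* f :* n :^ 4 :=
            ((a :* n) :* (b :* n)) :* ((c :* n) :* (d :* n)) :* f) refl
          eq₂ : ∀ m q f → ((m * q) * (m * q)) * ((m * q) * (m * q)) * f ≡ m ^ 4 * f * q ^ 4
          eq₂ = solve 3 (λ m q f → ((m :* q) :* (m :* q)) :* ((m :* q) :* (m :* q)) :* f := m :^ 4 :* f :* q :^ 4) refl

    private
      m = ∣ U ∣
      F₄ = ∣ fourfold ∣

      neX : Nonempty X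
      neX = let u , u∈ = neU in u , U⊆X u∈

      0<m : 0 < m
      0<m = Nonempty⇒∣∣>0 neU

      ∣X∣≤M : ∣ X ∣ ≤ M
      ∣X∣≤M = ≤-trans (∣A∣≤∣A⊞B∣ {X} {σ ⊡ X} (let x , x∈ = neX in σ · x , ∈-⊡⁺ x∈ refl)) ∣X+σX∣≤M

      m≤M : m ≤ M
      m≤M = ≤-trans (p⊆q⇒∣p∣≤∣q∣ U⊆X) ∣X∣≤M

      half⇒Nonempty : {V : Subset p} → m ≤ 2 * ∣ V ∣ → Nonempty V
      half⇒Nonempty {V} half = ∣∣>0⇒Nonempty V (n≢0⇒n>0 λ ∣V∣≡0 →
        contradiction (≤-trans 0<m (≤-trans half (≤-reflexive (cong (2 *_) ∣V∣≡0)))) λ ())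

    -- Passing to parts V and W only lowers the energy, so Cauchy-Schwarz on V × W gives |V + η W| ≥
    -- |U|² / 16κ. The further factor |U| is bounded by M to bring the result to the same form as in
    -- the other case; 4096 = 16 · 256.
    energy⇒bound : ∀ {η} κ → Quotient U η → energy U U η ≤ κ * (m * m) → N ^ 4 * m ^ 3 ≤ M ^ 5 * F₄ * (κ * 4096)
    energy⇒bound {η} κ quotient small = finish (quotient-bound quotient)
      where
      open ≤-Reasoning
      finish : (∃₂ λ V W → V ⊆ U × W ⊆ U × m ≤ 2 * ∣ V ∣ × m ≤ 2 * ∣ W ∣ ×
        ∣ V ⊞ η ⊡ W ∣ * N ^ 4 ≤ M ^ 4 * F₄ * 256) → N ^ 4 * m ^ 3 ≤ M ^ 5 * F₄ * (κ * 4096)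
      finish (V , W , V⊆U , W⊆U , half-V , half-W , bound) = begin
        N ^ 4 * m ^ 3                        ≡⟨ eq₁ N m ⟩
        m * m * (m * N ^ 4)                  ≤⟨ *-mono-≤ m²≤ (*-monoˡ-≤ (N ^ 4) m≤M) ⟩
        τ * κ * 16 * (M * N ^ 4)             ≡⟨ eq₂ τ κ 16 M (N ^ 4) ⟩
        τ * N ^ 4 * (M * (κ * 16))           ≤⟨ *-monoˡ-≤ (M * (κ * 16)) bound ⟩
        M ^ 4 * F₄ * 256 * (M * (κ * 16))    ≡⟨ eq₃ M F₄ 256 κ 16 ⟩
        M ^ 5 * F₄ * (κ * 4096)              ∎
        where
        v = ∣ V ∣ ; w = ∣ W ∣ ; τ = ∣ V ⊞ η ⊡ W ∣
        m²≤ : m * m ≤ τ * κ * 16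
        m²≤ = *-cancelʳ-≤ _ _ (m * m) {{>-nonZero (*-mono-< 0<m 0<m)}} (begin
          m * m * (m * m)                    ≤⟨ *-mono-≤ (*-mono-≤ half-V half-W) (*-mono-≤ half-V half-W) ⟩
          2 * v * (2 * w) * (2 * v * (2 * w)) ≡⟨ eq v w ⟩
          v * w * (v * w) * 16               ≤⟨ *-monoˡ-≤ 16 (pairs-collisions V W (V ⊞ η ⊡ W) (form η)
                                                  (λ a∈ b∈ → ∈-⊞⁺ a∈ (∈-⊡⁺ b∈ refl) refl)) ⟩
          τ * energy V W η * 16              ≤⟨ *-monoˡ-≤ 16 (*-monoʳ-≤ τ (≤-trans (energy-mono V⊆U W⊆U) small)) ⟩
          τ * (κ * (m * m)) * 16             ≡⟨ eq′ τ κ (m * m) 16 ⟩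
          τ * κ * 16 * (m * m)               ∎)
          where
          eq : ∀ v w → 2 * v * (2 * w) * (2 * v * (2 * w)) ≡ v * w * (v * w) * 16
          eq = solve-∀
          eq′ : ∀ a b c d → a * (b * c) * d ≡ a * b * d * c
          eq′ = solve-∀
        eq₁ : ∀ n m → n ^ 4 * m ^ 3 ≡ m * m * (m * n ^ 4)
        eq₁ = solve 2 (λ n m → n :^ 4 :* m :^ 3 := m :* m :* (m :* n :^ 4)) refl
        eq₂ : ∀ t k c m n → t * k * c * (m * n) ≡ t * n * (m * (k * c))
        eq₂ = solve-∀
        eq₃ : ∀ m f c k d → m ^ 4 * f * c * (m * (k * d)) ≡ m ^ 5 * f * (k * (c * d))
        eq₃ = solve 5 (λ m f c k d → m :^ 4 :* f :* c :* (m :* (k :* d)) := m :^ 5 :* f :* (k :* (c :* d))) refl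

    -- x + (ξ + σ) y is injective on U × U, and it is a sum of x, σ y and ξ y.
    step⇒bound : ∀ {ξ} → Quotient U ξ → ¬ Quotient U (ξ ∔ σ) → N ^ 4 * m ^ 3 ≤ M ^ 5 * F₄ * 8192
    step⇒bound {ξ} quotient ¬quotient = finish (quotient-bound quotient)
      where
      open ≤-Reasoning
      finish : (∃₂ λ V W → V ⊆ U × W ⊆ U × m ≤ 2 * ∣ V ∣ × m ≤ 2 * ∣ W ∣ ×
        ∣ V ⊞ ξ ⊡ W ∣ * N ^ 4 ≤ M ^ 4 * F₄ * 256) → N ^ 4 * m ^ 3 ≤ M ^ 5 * F₄ * 8192
      finish (V , W , V⊆U , W⊆U , half-V , half-W , bound) = begin
        N ^ 4 * m ^ 3                        ≤⟨ *-monoʳ-≤ (N ^ 4) m³≤ ⟩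
        N ^ 4 * (M * τ * 32)                 ≡⟨ eq₁ (N ^ 4) M τ 32 ⟩
        τ * N ^ 4 * (M * 32)                 ≤⟨ *-monoˡ-≤ (M * 32) bound ⟩
        M ^ 4 * F₄ * 256 * (M * 32)          ≡⟨ eq₂ M F₄ 256 32 ⟩
        M ^ 5 * F₄ * 8192                    ∎
        where
        v = ∣ V ∣ ; w = ∣ W ∣ ; τ = ∣ V ⊞ ξ ⊡ W ∣
        neσW : ∀ c → Nonempty (c ⊡ W)
        neσW c = let y , y∈ = half⇒Nonempty {W} half-W in c · y , ∈-⊡⁺ y∈ refl
        injection : ∀ X′ → X′ ⊆ V → ∣ X′ ∣ * w ≤ ∣ X′ ⊞ σ ⊡ W ⊞ ξ ⊡ W ∣
        injection X′ X′⊆V = ≤-trans (≤-reflexive (sym (length-pairs X′ W))) (≤-trans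
          (length-≤ (pairs-unique X′ W) {R = R} R? total injective) (≤-reflexive (length-elems Z)))
          where
          Z = X′ ⊞ σ ⊡ W ⊞ ξ ⊡ W
          R : Fin p × Fin p → Fin p → Set
          R (x , y) z = x ∈ X′ × y ∈ W × form (ξ ∔ σ) (x , y) ≡ z
          R? : ∀ i z → Dec (R i z)
          R? (x , y) z = (x ∈? X′) ×-dec ((y ∈? W) ×-dec (form (ξ ∔ σ) (x , y) ≟ z))
          total : ∀ {i} → i L.∈ pairs X′ W → ∃ λ z → z L.∈ elems Z × R i z
          total {x , y} i∈ = let x∈ , y∈ = ∈-pairs⁻ X′ W i∈ in
            form (ξ ∔ σ) (x , y) ,
            ∈-elems⁺ (∈-⊞⁺ (∈-⊞⁺ x∈ (∈-⊡⁺ y∈ refl) refl) (∈-⊡⁺ y∈ refl)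
              (solveᶠ 4 (λ x y ξ σ → (x :+ᶠ σ :*ᶠ y) :+ᶠ ξ :*ᶠ y :=ᶠ x :+ᶠ (ξ :+ᶠ σ) :*ᶠ y) refl x y ξ σ)) ,
            x∈ , y∈ , refl
          injective : ∀ {i i′ z} → R i z → R i′ z → i ≡ i′
          injective {x , y} {x′ , y′} (x∈ , y∈ , e) (x′∈ , y′∈ , e′) = ¬Quotient⇒injective ¬quotient
            (V⊆U (X′⊆V x∈)) (V⊆U (X′⊆V x′∈)) (W⊆U y∈) (W⊆U y′∈) (trans e (sym e′))
        -- The subset X′ may be very small, but injectivity gives the triple sumset at least |X′|
        -- |W| elements, so |X′| cancels.
        v²w≤ : (∃ λ X′ → X′ ⊆ V × Nonempty X′ ×
          v ^ 2 * ∣ X′ ⊞ σ ⊡ W ⊞ ξ ⊡ W ∣ ≤ 4 * (∣ V ⊞ σ ⊡ W ∣ * τ * ∣ X′ ∣)) → v ^ 2 * w ≤ 4 * (M * τ)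
        v²w≤ (X′ , X′⊆V , neX′ , le) = *-cancelˡ-≤ ∣ X′ ∣ {{>-nonZero (Nonempty⇒∣∣>0 neX′)}} (begin
          ∣ X′ ∣ * (v ^ 2 * w)                         ≡⟨ eq (∣ X′ ∣) (v ^ 2) w ⟩
          v ^ 2 * (∣ X′ ∣ * w)                         ≤⟨ *-monoʳ-≤ (v ^ 2) (injection X′ X′⊆V) ⟩
          v ^ 2 * ∣ X′ ⊞ σ ⊡ W ⊞ ξ ⊡ W ∣               ≤⟨ le ⟩
          4 * (∣ V ⊞ σ ⊡ W ∣ * τ * ∣ X′ ∣)             ≤⟨ *-monoʳ-≤ 4 (*-monoˡ-≤ ∣ X′ ∣ (*-monoˡ-≤ τ V+σW≤M)) ⟩
          4 * (M * τ * ∣ X′ ∣)                         ≡⟨ eq′ M τ ∣ X′ ∣ ⟩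
          ∣ X′ ∣ * (4 * (M * τ))                       ∎)
          where
          V+σW≤M : ∣ V ⊞ σ ⊡ W ∣ ≤ M
          V+σW≤M = ≤-trans (p⊆q⇒∣p∣≤∣q∣ (⊞-mono {V} {X} {σ ⊡ W} {σ ⊡ X} (λ v∈ → U⊆X (V⊆U v∈)) (⊡-mono λ w∈ → U⊆X (W⊆U w∈)))) ∣X+σX∣≤M
          eq : ∀ x v w → x * (v * w) ≡ v * (x * w)
          eq = solve-∀
          eq′ : ∀ m t x → 4 * (m * t * x) ≡ x * (4 * (m * t))
          eq′ = solve-∀
        -- The factor 32 is 2³ for replacing U by its halves V, V, W, times 4 from `plünnecke-two`.
        m³≤ : m ^ 3 ≤ M * τ * 32
        m³≤ = begin
          m ^ 3                              ≡⟨ eq₃ m ⟩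
          m * m * m                          ≤⟨ *-mono-≤ (*-mono-≤ half-V half-V) half-W ⟩
          2 * v * (2 * v) * (2 * w)          ≡⟨ eq₄ v w ⟩
          8 * (v ^ 2 * w)                    ≤⟨ *-monoʳ-≤ 8 (v²w≤ (plünnecke-two V (σ ⊡ W) (ξ ⊡ W) (half⇒Nonempty {V} half-V) (neσW σ) (neσW ξ))) ⟩
          8 * (4 * (M * τ))                  ≡⟨ eq₅ M τ ⟩
          M * τ * 32                         ∎
          where
          eq₃ : ∀ m → m ^ 3 ≡ m * m * m
          eq₃ = solve 1 (λ m → m :^ 3 := m :* m :* m) refl
          eq₄ : ∀ v w → 2 * v * (2 * v) * (2 * w) ≡ 8 * (v ^ 2 * w)
          eq₄ = solve 2 (λ v w → con 2 :* v :* (con 2 :* v) :* (con 2 :* w) := con 8 :* (v :^ 2 :* w)) refl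
          eq₅ : ∀ m t → 8 * (4 * (m * t)) ≡ m * t * 32
          eq₅ = solve-∀
        eq₁ : ∀ n m t c → n * (m * t * c) ≡ t * n * (m * c)
        eq₁ = solve-∀
        eq₂ : ∀ m f c d → m ^ 4 * f * c * (m * d) ≡ m ^ 5 * f * (c * d)
        eq₂ = solve 4 (λ m f c d → m :^ 4 :* f :* c :* (m :* d) := m :^ 5 :* f :* (c :* d)) refl

    -- If U has at most one element there are no quotients at all, not even 0, and the bound is
    -- immediate from N ≤ M. Otherwise 0 is a quotient, and whether η is one decides between the two
    -- bounds.
    pivot : ∀ k → 0 < p → N ≤ M → 0 < F₄ → m * m ≤ k * p → N ^ 4 * m ^ 3 ≤ M ^ 5 * F₄ * ((k + 1) * 8192)
    pivot k 0<p N≤M 0<F₄ m²≤kp = by-distinct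
        (any? λ c → any? λ d → (c ∈? U) ×-dec ((d ∈? U) ×-dec ¬? (c ≟ d)))
      where
      open ≤-Reasoning
      0<M = ≤-trans 0<N N≤M
      by-distinct : Dec (∃₂ λ c d → c ∈ U × d ∈ U × c ≢ d) → N ^ 4 * m ^ 3 ≤ M ^ 5 * F₄ * ((k + 1) * 8192)
      by-distinct (no none) = begin
        N ^ 4 * m ^ 3                      ≤⟨ *-mono-≤ (^-monoˡ-≤ 4 N≤M) (^-monoˡ-≤ 3 m≤1) ⟩
        M ^ 4 * 1                          ≤⟨ *-monoʳ-≤ (M ^ 4) (*-mono-≤ (*-mono-≤ 0<M 0<F₄) (*-mono-≤ (m≤n+m 1 k) (s≤s (z≤n {8191})))) ⟩
        M ^ 4 * (M * F₄ * ((k + 1) * 8192)) ≡⟨ eq M F₄ ((k + 1) * 8192) ⟩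
        M ^ 5 * F₄ * ((k + 1) * 8192)      ∎
        where
        eq : ∀ m f c → m ^ 4 * (m * f * c) ≡ m ^ 5 * f * c
        eq = solve 3 (λ m f c → m :^ 4 :* (m :* f :* c) := m :^ 5 :* f :* c) refl
        same : ∀ {c d} → c ∈ U → d ∈ U → Dec (c ≡ d) → c ≡ d
        same c∈ d∈ (yes eq) = eq
        same c∈ d∈ (no ≢)   = contradiction (_ , _ , c∈ , d∈ , ≢) none
        m≤1 : m ≤ 1
        m≤1 = ∣∣≤length U (0ᶠ ∷ []) {R = λ c _ → c ∈ U} (λ c _ → c ∈? U)
          (λ c∈ → 0ᶠ , here refl , c∈) (λ {c} {d} c∈ d∈ → same c∈ d∈ (c ≟ d))
      by-distinct (yes (c , d , c∈ , d∈ , c≢d)) = by-energy (small-energy U k 0<p m²≤kp)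
        where
        zero-quotient : Quotient U 0ᶠ
        zero-quotient = c , d , c∈ , d∈ , c≢d , c , c , c∈ , c∈ ,
          cong (_∔ c) (trans (F.zeroˡ c) (sym (F.zeroˡ d)))
        by-step : ∀ {η} → ¬ Quotient U η → Dec (∃ λ ξ → Quotient U ξ × ¬ Quotient U (ξ ∔ σ)) →
          N ^ 4 * m ^ 3 ≤ M ^ 5 * F₄ * ((k + 1) * 8192)
        by-step ¬q (yes (ξ , q , ¬q′)) = ≤-trans (step⇒bound q ¬q′)
          (*-monoʳ-≤ (M ^ 5 * F₄) (≤-trans (≤-reflexive (sym (*-identityˡ 8192))) (*-monoˡ-≤ 8192 (m≤n+m 1 k))))
        -- If no step by σ left the quotients, they would be closed under it and, containing 0,
        -- would contain η.
        by-step {η} ¬q (no none) = contradiction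
          (generates (Quotient U) zero-quotient (λ ξ q → stable ξ q (quotient? U (ξ ∔ σ))) η) ¬q
          where
          stable : ∀ ξ → Quotient U ξ → Dec (Quotient U (ξ ∔ σ)) → Quotient U (ξ ∔ σ)
          stable ξ q (yes q′) = q′
          stable ξ q (no ¬q′) = contradiction (ξ , q , ¬q′) none
        by-quotient : ∀ {η} → energy U U η ≤ (k + 1) * (m * m) → Dec (Quotient U η) →
          N ^ 4 * m ^ 3 ≤ M ^ 5 * F₄ * ((k + 1) * 8192)
        by-quotient small (yes q) = ≤-trans (energy⇒bound (k + 1) q small)
          (*-monoʳ-≤ (M ^ 5 * F₄) (*-monoʳ-≤ (k + 1) (m≤m+n 4096 4096)))
        by-quotient small (no ¬q) = by-step ¬q (any? λ ξ → quotient? U ξ ×-dec ¬? (quotient? U (ξ ∔ σ)))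
        by-energy : (∃ λ η → energy U U η ≤ (k + 1) * (m * m)) → N ^ 4 * m ^ 3 ≤ M ^ 5 * F₄ * ((k + 1) * 8192)
        by-energy (η , small) = by-quotient small (quotient? U η)

  -- Multiplying the bounds

  combine-bounds : ∀ {n x N l M f} K → n ≤ 2 * x → 0 < x →
    x ^ 11 ≤ N ^ 4 * l ^ 3 * M ^ 4 * 2000 → N ^ 4 * l ^ 3 ≤ M ^ 5 * f * K → f * n ^ 3 ≤ M ^ 3 * x * 64 →
    n ^ 13 ≤ M ^ 12 * (K * (2000 * 64 * 1024))
  combine-bounds {n} {x} {N} {l} {M} {f} K n≤2x 0<x popular pivotal fourfold = begin
    n ^ 13                                   ≡⟨ ^-distribˡ-+-* n 10 3 ⟩
    n ^ 10 * n ^ 3                           ≤⟨ *-monoˡ-≤ (n ^ 3) (^-monoˡ-≤ 10 n≤2x) ⟩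
    (2 * x) ^ 10 * n ^ 3                     ≡⟨ cong (_* n ^ 3) (eq₀ 2 x) ⟩
    2 ^ 10 * x ^ 10 * n ^ 3                  ≡⟨ eq₁ (2 ^ 10) (x ^ 10) (n ^ 3) ⟩
    x ^ 10 * n ^ 3 * 2 ^ 10                  ≤⟨ *-monoˡ-≤ (2 ^ 10) tenth ⟩
    M ^ 12 * (K * (2000 * 64)) * 2 ^ 10      ≡⟨ eq₂ (M ^ 12) K (2000 * 64) (2 ^ 10) ⟩
    M ^ 12 * (K * (2000 * 64 * 1024))        ∎
    where
    open ≤-Reasoning
    eq₀ : ∀ a x → (a * x) ^ 10 ≡ a ^ 10 * x ^ 10
    eq₀ = solve 2 (λ a x → (a :* x) :^ 10 := a :^ 10 :* x :^ 10) refl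
    eq₁ : ∀ a b c → a * b * c ≡ b * c * a
    eq₁ = solve-∀
    eq₂ : ∀ a b c d → a * (b * c) * d ≡ a * (b * (c * d))
    eq₂ = solve-∀
    eq₃ : ∀ x n → x * (x ^ 10 * n ^ 3) ≡ x ^ 11 * n ^ 3
    eq₃ = solve 2 (λ x n → x :* (x :^ 10 :* n :^ 3) := x :^ 11 :* n :^ 3) refl
    eq₄ : ∀ f K M n a → M ^ 5 * f * K * M ^ 4 * a * n ^ 3 ≡ M ^ 9 * (K * a) * (f * n ^ 3)
    eq₄ = solve 5 (λ f K M n a → M :^ 5 :* f :* K :* M :^ 4 :* a :* n :^ 3 := M :^ 9 :* (K :* a) :* (f :* n :^ 3)) refl
    eq₅ : ∀ M K x a b → M ^ 9 * (K * a) * (M ^ 3 * x * b) ≡ x * (M ^ 12 * (K * (a * b)))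
    eq₅ = solve 5 (λ M K x a b → M :^ 9 :* (K :* a) :* (M :^ 3 :* x :* b) := x :* (M :^ 12 :* (K :* (a :* b)))) refl
    -- The unknown N⁴ l³ is eliminated between the first two bounds and f between the result and the
    -- third. One factor x cancels; the other ten become n at the price of 2¹⁰ = 1024.
    tenth : x ^ 10 * n ^ 3 ≤ M ^ 12 * (K * (2000 * 64))
    tenth = *-cancelˡ-≤ x {{>-nonZero 0<x}} (begin
      x * (x ^ 10 * n ^ 3)                     ≡⟨ eq₃ x n ⟩
      x ^ 11 * n ^ 3                           ≤⟨ *-monoˡ-≤ (n ^ 3) popular ⟩
      N ^ 4 * l ^ 3 * M ^ 4 * 2000 * n ^ 3     ≤⟨ *-monoˡ-≤ (n ^ 3) (*-monoˡ-≤ 2000 (*-monoˡ-≤ (M ^ 4) pivotal)) ⟩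
      M ^ 5 * f * K * M ^ 4 * 2000 * n ^ 3     ≡⟨ eq₄ f K M n 2000 ⟩
      M ^ 9 * (K * 2000) * (f * n ^ 3)         ≤⟨ *-monoʳ-≤ (M ^ 9 * (K * 2000)) fourfold ⟩
      M ^ 9 * (K * 2000) * (M ^ 3 * x * 64)    ≡⟨ eq₅ M K x 2000 64 ⟩
      x * (M ^ 12 * (K * (2000 * 64)))         ∎)

  module _ (σ : Fin p) (σ≡±1 : σ ≡ 1ᶠ ⊎ σ ≡ neg 1ᶠ) (σσ≡1 : σ · σ ≡ 1ᶠ)
    (generates : ∀ (P : Fin p → Set) → P 0ᶠ → (∀ x → P x → P (x ∔ σ)) → ∀ x → P x)
    (A : Subset p) (neA : Nonempty A) (0∉A : 0ᶠ ∉ A) (M k : ℕ)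
    (∣A+σA∣≤M : ∣ A ⊞ σ ⊡ A ∣ ≤ M) (∣AA∣≤M : ∣ setOp _·_ A A ∣ ≤ M) (n²≤kp : ∣ A ∣ * ∣ A ∣ ≤ k * p) where

    sum-product : ∣ A ∣ ^ 13 ≤ M ^ 12 * constant k
    sum-product = ≤constant k {y = M ^ 12} (with-large (plünnecke-large A (σ ⊡ A) neA (let a , a∈ = neA in σ · a , ∈-⊡⁺ a∈ refl)))
      where
      open ≤-Reasoning
      n = ∣ A ∣
      Goal : Set
      Goal = n ^ 13 ≤ M ^ 12 * ((k + 1) * 8192 * (2000 * 64 * 1024))
      0<n = Nonempty⇒∣∣>0 neA
      0<p : 0 < p
      0<p = ≤-trans 0<n (∣p∣≤n A)
      with-large : (∃ λ X → X ⊆ A × n ≤ 2 * ∣ X ∣ ×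
        ∣ X ⊞ σ ⊡ A ⊞ σ ⊡ A ⊞ σ ⊡ A ∣ * n ^ 3 ≤ ∣ A ⊞ σ ⊡ A ∣ ^ 3 * ∣ X ∣ * 64) → Goal
      with-large (X , X⊆A , n≤2x , large) = with-energy (multiplicative-energy X neX 0∉X)
        where
        x = ∣ X ∣
        0<x : 0 < x
        0<x = n≢0⇒n>0 λ x≡0 → contradiction (≤-trans 0<n (≤-trans n≤2x (≤-reflexive (cong (2 *_) x≡0)))) λ ()
        neX : Nonempty X
        neX = ∣∣>0⇒Nonempty X 0<x
        0∉X : 0ᶠ ∉ X
        0∉X 0∈X = 0∉A (X⊆A 0∈X)
        σX⊆σA : σ ⊡ X ⊆ σ ⊡ A
        σX⊆σA = ⊡-mono X⊆A
        neσX : Nonempty (σ ⊡ X)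
        neσX = let y , y∈ = neX in σ · y , ∈-⊡⁺ y∈ refl
        ∣X+σX∣≤M : ∣ X ⊞ σ ⊡ X ∣ ≤ M
        ∣X+σX∣≤M = ≤-trans (p⊆q⇒∣p∣≤∣q∣ (⊞-mono X⊆A σX⊆σA)) ∣A+σA∣≤M
        ∣X∣≤M : x ≤ M
        ∣X∣≤M = ≤-trans (∣A∣≤∣A⊞B∣ {X} neσX) ∣X+σX∣≤M
        0<M = ≤-trans 0<x ∣X∣≤M
        ∣XX∣≤M : ∣ setOp _·_ X X ∣ ≤ M
        ∣XX∣≤M = ≤-trans (p⊆q⇒∣p∣≤∣q∣ (setOp-mono _·_ X⊆A X⊆A)) ∣AA∣≤M
        fourX : Subset p
        fourX = X ⊞ σ ⊡ X ⊞ σ ⊡ X ⊞ σ ⊡ X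
        fourX-bound : ∣ fourX ∣ * n ^ 3 ≤ M ^ 3 * x * 64
        fourX-bound = begin
          ∣ fourX ∣ * n ^ 3                                   ≤⟨ *-monoˡ-≤ (n ^ 3) (p⊆q⇒∣p∣≤∣q∣ (⊞-mono (⊞-mono (⊞-mono (λ {y} y∈ → y∈) σX⊆σA) σX⊆σA) σX⊆σA)) ⟩
          ∣ X ⊞ σ ⊡ A ⊞ σ ⊡ A ⊞ σ ⊡ A ∣ * n ^ 3               ≤⟨ large ⟩
          ∣ A ⊞ σ ⊡ A ∣ ^ 3 * x * 64                          ≤⟨ *-monoˡ-≤ 64 (*-monoˡ-≤ x (^-monoˡ-≤ 3 ∣A+σA∣≤M)) ⟩
          M ^ 3 * x * 64                                      ∎
        0<fourX : 0 < ∣ fourX ∣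
        0<fourX = ≤-trans 0<x (≤-trans (∣A∣≤∣A⊞B∣ {X} neσX)
          (≤-trans (∣A∣≤∣A⊞B∣ {X ⊞ σ ⊡ X} neσX) (∣A∣≤∣A⊞B∣ {X ⊞ σ ⊡ X ⊞ σ ⊡ X} neσX)))
        with-energy : (∃ λ e → e ∈ X × x ^ 3 ≤ ∣ setOp _·_ X X ∣ * ∑ (elems X) (λ a → ∣ common X e a ∣)) → Goal
        with-energy (e , e∈X , energy) = with-level (popular-level (elems X) r M
            (≤-trans 0<x (≤-reflexive (sym (length-elems X)))) 0<M
            (≤-trans (≤-reflexive (cong (_^ 3) (length-elems X))) (≤-trans energy (*-monoˡ-≤ _ ∣XX∣≤M))))
          where
          r : Fin p → ℕ
          r a = ∣ common X e a ∣
          with-level : (∃ λ N → length (elems X) ^ 11 ≤ N ^ 4 * ∑ (elems X) (λ a → 𝟙 (N ≤? r a)) ^ 3 * M ^ 4 * 2000) → Goal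
          with-level (N , popular) = combine-bounds {n} {x} {N} {∣ U ∣} {M} {∣ fourX ∣} ((k + 1) * 8192) n≤2x 0<x popular′
              (Pivot.pivot σ σ≡±1 σσ≡1 generates X U U⊆X neU N M 0<N ∣X+σX∣≤M e
                (λ e≡0 → 0∉X (subst (_∈ X) e≡0 e∈X)) (λ a∈ → proj₂ (∈-sift⁻ (λ a → N ≤? r a) a∈))
                k 0<p N≤M 0<fourX m²≤kp)
              fourX-bound
            where
            U = sift X (λ a → N ≤? r a)
            U⊆X : U ⊆ X
            U⊆X = sift⊆ X (λ a → N ≤? r a)
            popular′ : x ^ 11 ≤ N ^ 4 * ∣ U ∣ ^ 3 * M ^ 4 * 2000
            popular′ = ≤-trans (≤-reflexive (cong (_^ 11) (sym (length-elems X)))) (≤-trans popular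
              (*-monoˡ-≤ 2000 (*-monoˡ-≤ (M ^ 4) (*-monoʳ-≤ (N ^ 4) (^-monoˡ-≤ 3 (∑-sift (λ a → N ≤? r a)))))))
            0<x¹¹ : 0 < x ^ 11
            0<x¹¹ = m^n>0 x {{>-nonZero 0<x}} 11
            -- N = 0 or an empty U would make the right side of `popular′` vanish.
            0<N : 0 < N
            0<N = n≢0⇒n>0 λ N≡0 → contradiction (≤-trans 0<x¹¹ (≤-trans popular′
              (≤-reflexive (cong (λ N → N ^ 4 * ∣ U ∣ ^ 3 * M ^ 4 * 2000) N≡0)))) λ ()
            neU : Nonempty U
            neU = ∣∣>0⇒Nonempty U (n≢0⇒n>0 λ U≡0 → contradiction (≤-trans 0<x¹¹ (≤-trans popular′
              (≤-reflexive (trans (cong (λ m → N ^ 4 * m ^ 3 * M ^ 4 * 2000) U≡0)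
                (cong (λ y → y * M ^ 4 * 2000) (*-zeroʳ (N ^ 4))))))) λ ())
            N≤M : N ≤ M
            N≤M = let a , a∈ = neU in ≤-trans (proj₂ (∈-sift⁻ (λ a → N ≤? r a) a∈))
              (≤-trans (p⊆q⇒∣p∣≤∣q∣ λ t∈ → proj₁ (∈-common⁻ X e a t∈)) ∣X∣≤M)
            m²≤kp : ∣ U ∣ * ∣ U ∣ ≤ k * p
            m²≤kp = ≤-trans (*-mono-≤ ∣U∣≤n ∣U∣≤n) n²≤kp
              where
              ∣U∣≤n : ∣ U ∣ ≤ n
              ∣U∣≤n = p⊆q⇒∣p∣≤∣q∣ λ u∈ → X⊆A (U⊆X u∈)

  -- Steps by -1 for P are steps by 1 for `P ∘ neg`.
  neg-one-generates : (∀ (P : Fin p → Set) → P 0ᶠ → (∀ x → P x → P (x ∔ 1ᶠ)) → ∀ x → P x) →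
    ∀ (P : Fin p → Set) → P 0ᶠ → (∀ x → P x → P (x ∔ neg 1ᶠ)) → ∀ x → P x
  neg-one-generates generates P P0 step x = subst P (-‿involutive x) (generates (P ∘ neg)
    (subst P (sym -0#≈0#) P0) (λ y Py → subst P (-‿+-comm y 1ᶠ) (step (neg y) Py)) (neg x))

  neg-one² : neg 1ᶠ · neg 1ᶠ ≡ 1ᶠ
  neg-one² = trans (-1*x≈-x (neg 1ᶠ)) (-‿involutive 1ᶠ)

  A+1A⊆A+A : ∀ A → A ⊞ 1ᶠ ⊡ A ⊆ setOp _∔_ A A
  A+1A⊆A+A A {x} x∈ with ∈-⊞⁻ x∈
  ... | a , y , a∈ , y∈ , refl with ∈-⊡⁻ y∈
  ... | b , b∈ , refl = ∈-setOp⁺ _∔_ a∈ b∈ (cong (a ∔_) (sym (F.*-identityˡ b)))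

  A-1A⊆A-A : ∀ A (_minus_ : Fin p → Fin p → Fin p) → (∀ a b → a minus b ≡ a ∔ neg b) →
    A ⊞ neg 1ᶠ ⊡ A ⊆ setOp _minus_ A A
  A-1A⊆A-A A _minus_ minus-neg x∈ with ∈-⊞⁻ x∈
  ... | a , y , a∈ , y∈ , refl with ∈-⊡⁻ y∈
  ... | b , b∈ , refl = ∈-setOp⁺ _minus_ a∈ b∈ (trans (minus-neg a b) (cong (a ∔_) (sym (-1*x≈-x b))))

-- The residues modulo a prime

module Residues (n : ℕ) where

  private
    q = suc n
    red = reduce n

  toℕ-reduce : ∀ m → toℕ (red m) ≡ m % q
  toℕ-reduce m = toℕ-fromℕ< (m%n<n m q)

  reduce-cong : ∀ a b → a % q ≡ b % q → red a ≡ red b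
  reduce-cong a b eq = toℕ-injective (trans (toℕ-reduce a) (trans eq (sym (toℕ-reduce b))))

  reduce-toℕ : ∀ x → red (toℕ x) ≡ x
  reduce-toℕ x = toℕ-injective (trans (toℕ-reduce (toℕ x)) (m<n⇒m%n≡m (toℕ<n x)))

  reduce-+ : ∀ a b → red a +ₚ red b ≡ red (a + b)
  reduce-+ a b = reduce-cong (toℕ (red a) + toℕ (red b)) (a + b)
    (trans (cong (_% q) (cong₂ _+_ (toℕ-reduce a) (toℕ-reduce b))) (sym (%-distribˡ-+ a b q)))

  reduce-* : ∀ a b → red a *ₚ red b ≡ red (a * b)
  reduce-* a b = reduce-cong (toℕ (red a) * toℕ (red b)) (a * b)
    (trans (cong (_% q) (cong₂ _*_ (toℕ-reduce a) (toℕ-reduce b))) (sym (%-distribˡ-* a b q)))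

  -- Every residue is the reduction of its representative, so a ring law need only be checked on
  -- reductions, where it becomes the same law in ℕ.
  reduced : {P : Fin q → Set} → (∀ a → P (red a)) → ∀ x → P x
  reduced {P} h x = subst P (reduce-toℕ x) (h (toℕ x))

  negₚ : Fin q → Fin q
  negₚ x = red (q ∸ toℕ x)

  minus-neg : ∀ x y → x -ₚ y ≡ x +ₚ negₚ y
  minus-neg x y = trans (sym (reduce-+ (toℕ x) (q ∸ toℕ y))) (cong (_+ₚ negₚ y) (reduce-toℕ x))

  open ≡-Reasoning

  +-inverseʳ : ∀ x → x +ₚ negₚ x ≡ red 0
  +-inverseʳ x = begin
    x +ₚ negₚ x                     ≡⟨ cong (_+ₚ negₚ x) (reduce-toℕ x) ⟨
    red (toℕ x) +ₚ negₚ x           ≡⟨ reduce-+ (toℕ x) (q ∸ toℕ x) ⟩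
    red (toℕ x + (q ∸ toℕ x))       ≡⟨ cong red (m+[n∸m]≡n (<⇒≤ (toℕ<n x))) ⟩
    red q                           ≡⟨ reduce-cong q 0 (n%n≡0 q) ⟩
    red 0                           ∎

  +ₚ-comm : ∀ x y → x +ₚ y ≡ y +ₚ x
  +ₚ-comm x y = cong red (+-comm (toℕ x) (toℕ y))

  *ₚ-comm : ∀ x y → x *ₚ y ≡ y *ₚ x
  *ₚ-comm x y = cong red (*-comm (toℕ x) (toℕ y))

  +ₚ-identityˡ : ∀ x → red 0 +ₚ x ≡ x
  +ₚ-identityˡ = reduced (reduce-+ 0)

  *ₚ-identityˡ : ∀ x → red 1 *ₚ x ≡ x
  *ₚ-identityˡ = reduced λ a → trans (reduce-* 1 a) (cong red (*-identityˡ a))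

  +ₚ-assoc : ∀ x y z → (x +ₚ y) +ₚ z ≡ x +ₚ (y +ₚ z)
  +ₚ-assoc = reduced λ a → reduced λ b → reduced λ c → begin
    (red a +ₚ red b) +ₚ red c     ≡⟨ cong (_+ₚ red c) (reduce-+ a b) ⟩
    red (a + b) +ₚ red c          ≡⟨ reduce-+ (a + b) c ⟩
    red (a + b + c)               ≡⟨ cong red (+-assoc a b c) ⟩
    red (a + (b + c))             ≡⟨ reduce-+ a (b + c) ⟨
    red a +ₚ red (b + c)          ≡⟨ cong (red a +ₚ_) (reduce-+ b c) ⟨
    red a +ₚ (red b +ₚ red c)     ∎

  *ₚ-assoc : ∀ x y z → (x *ₚ y) *ₚ z ≡ x *ₚ (y *ₚ z)
  *ₚ-assoc = reduced λ a → reduced λ b → reduced λ c → begin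
    (red a *ₚ red b) *ₚ red c     ≡⟨ cong (_*ₚ red c) (reduce-* a b) ⟩
    red (a * b) *ₚ red c          ≡⟨ reduce-* (a * b) c ⟩
    red (a * b * c)               ≡⟨ cong red (*-assoc a b c) ⟩
    red (a * (b * c))             ≡⟨ reduce-* a (b * c) ⟨
    red a *ₚ red (b * c)          ≡⟨ cong (red a *ₚ_) (reduce-* b c) ⟨
    red a *ₚ (red b *ₚ red c)     ∎

  *ₚ-distribˡ : ∀ x y z → x *ₚ (y +ₚ z) ≡ (x *ₚ y) +ₚ (x *ₚ z)
  *ₚ-distribˡ = reduced λ a → reduced λ b → reduced λ c → begin
    red a *ₚ (red b +ₚ red c)               ≡⟨ cong (red a *ₚ_) (reduce-+ b c) ⟩
    red a *ₚ red (b + c)                    ≡⟨ reduce-* a (b + c) ⟩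
    red (a * (b + c))                       ≡⟨ cong red (*-distribˡ-+ a b c) ⟩
    red (a * b + a * c)                     ≡⟨ reduce-+ (a * b) (a * c) ⟨
    red (a * b) +ₚ red (a * c)              ≡⟨ cong₂ _+ₚ_ (reduce-* a b) (reduce-* a c) ⟨
    (red a *ₚ red b) +ₚ (red a *ₚ red c)    ∎

  isCommutativeRing : IsCommutativeRing _≡_ _+ₚ_ _*ₚ_ negₚ (red 0) (red 1)
  isCommutativeRing = record
    { isRing = record
      { +-isAbelianGroup = record
        { isGroup = record
          { isMonoid = record
            { isSemigroup = record
              { isMagma = record { isEquivalence = isEquivalence ; ∙-cong = cong₂ _+ₚ_ }
              ; assoc   = +ₚ-assoc
              }
            ; identity = +ₚ-identityˡ , λ x → trans (+ₚ-comm x (red 0)) (+ₚ-identityˡ x)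
            }
          ; inverse = (λ x → trans (+ₚ-comm (negₚ x) x) (+-inverseʳ x)) , +-inverseʳ
          ; ⁻¹-cong = cong negₚ
          }
        ; comm = +ₚ-comm
        }
      ; *-cong     = cong₂ _*ₚ_
      ; *-assoc    = *ₚ-assoc
      ; *-identity = *ₚ-identityˡ , λ x → trans (*ₚ-comm x (red 1)) (*ₚ-identityˡ x)
      ; distrib    = *ₚ-distribˡ , λ x y z → trans (*ₚ-comm (y +ₚ z) x)
          (trans (*ₚ-distribˡ x y z) (cong₂ _+ₚ_ (*ₚ-comm x y) (*ₚ-comm x z)))
      }
    ; *-comm = *ₚ-comm
    }

  one-generates : ∀ (P : Fin q → Set) → P (red 0) → (∀ x → P x → P (x +ₚ red 1)) → ∀ x → P x
  one-generates P P0 step = reduced go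
    where
    go : ∀ m → P (red m)
    go zero    = P0
    go (suc m) = subst P (trans (reduce-+ m 1) (cong red (+-comm m 1))) (step (red m) (go m))

  [a+b]%q≡a%q⇒q∣b : ∀ a b → (a + b) % q ≡ a % q → q ∣ b
  [a+b]%q≡a%q⇒q∣b a b eq = ∣m+n∣m⇒∣n (subst (q ∣_) quotients (n∣m*n ((a + b) / q))) (n∣m*n (a / q))
    where
    quotients : (a + b) / q * q ≡ a / q * q + b
    quotients = +-cancelˡ-≡ (a % q) _ _ (begin
      a % q + (a + b) / q * q           ≡⟨ cong (_+ (a + b) / q * q) eq ⟨
      (a + b) % q + (a + b) / q * q     ≡⟨ m≡m%n+[m/n]*n (a + b) q ⟨
      a + b                             ≡⟨ cong (_+ b) (m≡m%n+[m/n]*n a q) ⟩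
      a % q + a / q * q + b             ≡⟨ +-assoc (a % q) (a / q * q) b ⟩
      a % q + (a / q * q + b)           ∎)

  module _ (q-prime : Prime q) where

    -- The equation bounds e by a representative below q, and 0 is the only multiple of q there.
    divides-small : ∀ {a e} (d : Fin q) → toℕ d ≡ a + e → q ∣ e → e ≡ 0
    divides-small {e = zero}  d eq q∣e = refl
    divides-small {a} {suc e} d eq q∣e = contradiction (toℕ<n d)
      (≤⇒≯ (≤-trans (∣⇒≤ q∣e) (≤-trans (m≤n+m (suc e) a) (≤-reflexive (sym eq)))))

    -- With representatives d = c + e and y = x + f, the two sides differ by exactly e f in ℕ. So q
    -- divides e f, and by Euclid's lemma it divides e or f. The assumed order makes e and f honest
    -- differences.
    domain-≤ : ∀ {c d x y} → toℕ c ≤ toℕ d → toℕ x ≤ toℕ y →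
      (c *ₚ x) +ₚ (d *ₚ y) ≡ (d *ₚ x) +ₚ (c *ₚ y) → c ≡ d ⊎ x ≡ y
    domain-≤ {c} {d} {x} {y} c≤d x≤y eq = conclude (euclidsLemma e f q-prime q∣ef)
      where
      c′ = toℕ c ; x′ = toℕ x ; e = toℕ d ∸ c′ ; f = toℕ y ∸ x′
      d≡ : toℕ d ≡ c′ + e
      d≡ = sym (m+[n∸m]≡n c≤d)
      y≡ : toℕ y ≡ x′ + f
      y≡ = sym (m+[n∸m]≡n x≤y)
      b = (c′ + e) * x′ + c′ * (x′ + f)
      expand : ∀ c e x f → c * x + (c + e) * (x + f) ≡ (c + e) * x + c * (x + f) + e * f
      expand = solve-∀
      red-eq : red (b + e * f) ≡ red b
      red-eq = begin
        red (b + e * f)                          ≡⟨ cong red (expand c′ e x′ f) ⟨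
        red (c′ * x′ + (c′ + e) * (x′ + f))      ≡⟨ cong₂ (λ d y → red (c′ * x′ + d * y)) d≡ y≡ ⟨
        red (c′ * x′ + toℕ d * toℕ y)            ≡⟨ reduce-+ (c′ * x′) (toℕ d * toℕ y) ⟨
        (c *ₚ x) +ₚ (d *ₚ y)                     ≡⟨ eq ⟩
        (d *ₚ x) +ₚ (c *ₚ y)                     ≡⟨ reduce-+ (toℕ d * x′) (c′ * toℕ y) ⟩
        red (toℕ d * x′ + c′ * toℕ y)            ≡⟨ cong₂ (λ d y → red (d * x′ + c′ * y)) d≡ y≡ ⟩
        red b                                    ∎
      q∣ef : q ∣ e * f
      q∣ef = [a+b]%q≡a%q⇒q∣b b (e * f)
        (trans (sym (toℕ-reduce (b + e * f))) (trans (cong toℕ red-eq) (toℕ-reduce b)))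
      conclude : (q ∣ e) ⊎ (q ∣ f) → c ≡ d ⊎ x ≡ y
      conclude (inj₁ q∣e) = inj₁ (toℕ-injective (sym (trans d≡ (trans (cong (c′ +_) (divides-small {c′} d d≡ q∣e)) (+-identityʳ c′)))))
      conclude (inj₂ q∣f) = inj₂ (toℕ-injective (sym (trans y≡ (trans (cong (x′ +_) (divides-small {x′} y y≡ q∣f)) (+-identityʳ x′)))))

    domain : ∀ {c d x y} → (c *ₚ x) +ₚ (d *ₚ y) ≡ (d *ₚ x) +ₚ (c *ₚ y) → c ≡ d ⊎ x ≡ y
    domain {c} {d} {x} {y} eq with ≤-total (toℕ c) (toℕ d) | ≤-total (toℕ x) (toℕ y)
    ... | inj₁ c≤d | inj₁ x≤y = domain-≤ c≤d x≤y eq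
    ... | inj₂ d≤c | inj₁ x≤y = flip-c (domain-≤ d≤c x≤y (sym eq))
      where
      flip-c : d ≡ c ⊎ x ≡ y → c ≡ d ⊎ x ≡ y
      flip-c (inj₁ e) = inj₁ (sym e)
      flip-c (inj₂ e) = inj₂ e
    ... | inj₁ c≤d | inj₂ y≤x = flip-x (domain-≤ c≤d y≤x (trans (+ₚ-comm (c *ₚ y) _) (trans (sym eq) (+ₚ-comm (c *ₚ x) _))))
      where
      flip-x : c ≡ d ⊎ y ≡ x → c ≡ d ⊎ x ≡ y
      flip-x (inj₁ e) = inj₁ e
      flip-x (inj₂ e) = inj₂ (sym e)
    ... | inj₂ d≤c | inj₂ y≤x = flip-both (domain-≤ d≤c y≤x (trans (+ₚ-comm (d *ₚ y) _) (trans eq (+ₚ-comm (d *ₚ x) _))))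
      where
      flip-both : d ≡ c ⊎ y ≡ x → c ≡ d ⊎ x ≡ y
      flip-both (inj₁ e) = inj₁ (sym e)
      flip-both (inj₂ e) = inj₂ (sym e)

-- Restoring zero, and the theorem

m≤m^12 : ∀ m → 0 < m → m ≤ m ^ 12
m≤m^12 m 0<m = ≤-trans (≤-reflexive (sym (*-identityʳ m))) (*-monoʳ-≤ m (m^n>0 m {{>-nonZero 0<m}} 11))

-- Removing 0 costs at most one element: either nothing is left and a ≤ 1, or a ≤ 2b, which costs
-- 2¹³ = 8192. The constant is then moved inside the twelfth power by the crude `m≤m^12`.
restore-zero : ∀ {a b M} C₀ → 0 < C₀ → 0 < M → a ≤ suc b → (0 < b → b ^ 13 ≤ M ^ 12 * C₀) →
  a ^ 13 ≤ (C₀ * 8192 * M) ^ 12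
restore-zero {a} {b} {M} C₀ 0<C₀ 0<M a≤1+b bound = by-cases (n≡0∨n>0 b)
  where
  open ≤-Reasoning
  n≡0∨n>0 : ∀ n → n ≡ 0 ⊎ 0 < n
  n≡0∨n>0 zero    = inj₁ refl
  n≡0∨n>0 (suc n) = inj₂ (s≤s z≤n)
  eq₁ : ∀ a b → (a * b) ^ 13 ≡ b ^ 13 * a ^ 13
  eq₁ = solve 2 (λ a b → (a :* b) :^ 13 := b :^ 13 :* a :^ 13) refl
  eq₂ : ∀ M C → M ^ 12 * C ^ 12 ≡ (C * M) ^ 12
  eq₂ = solve 2 (λ M C → M :^ 12 :* C :^ 12 := (C :* M) :^ 12) refl
  0<C : 0 < C₀ * 8192
  0<C = *-mono-< 0<C₀ (s≤s (z≤n {8191}))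
  by-cases : b ≡ 0 ⊎ 0 < b → a ^ 13 ≤ (C₀ * 8192 * M) ^ 12
  by-cases (inj₁ b≡0) = begin
    a ^ 13                            ≤⟨ ^-monoˡ-≤ 13 (≤-trans a≤1+b (≤-reflexive (cong suc b≡0))) ⟩
    1                                 ≤⟨ m^n>0 (C₀ * 8192 * M) {{>-nonZero (*-mono-< 0<C 0<M)}} 12 ⟩
    (C₀ * 8192 * M) ^ 12              ∎
  by-cases (inj₂ 0<b) = begin
    a ^ 13                            ≤⟨ ^-monoˡ-≤ 13 (≤-trans a≤1+b (+-monoˡ-≤ b 0<b)) ⟩
    (b + b) ^ 13                      ≡⟨ cong (λ c → (b + c) ^ 13) (+-identityʳ b) ⟨
    (2 * b) ^ 13                      ≡⟨ eq₁ 2 b ⟩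
    b ^ 13 * 2 ^ 13                   ≤⟨ *-monoˡ-≤ (2 ^ 13) (bound 0<b) ⟩
    M ^ 12 * C₀ * 2 ^ 13              ≡⟨ *-assoc (M ^ 12) C₀ (2 ^ 13) ⟩
    M ^ 12 * (C₀ * 8192)              ≤⟨ *-monoʳ-≤ (M ^ 12) (m≤m^12 (C₀ * 8192) 0<C) ⟩
    M ^ 12 * (C₀ * 8192) ^ 12         ≡⟨ eq₂ M (C₀ * 8192) ⟩
    (C₀ * 8192 * M) ^ 12              ∎

module PrimeField (n : ℕ) (q-prime : Prime (suc n)) (A : Subset (suc n)) (neA : Nonempty A)
  (k : ℕ) (∣A∣²≤ : ∣ A ∣ * ∣ A ∣ ≤ k * suc n) where

  open Residues n
  open SumProduct _+ₚ_ _*ₚ_ negₚ (reduce n 0) (reduce n 1) isCommutativeRing (domain q-prime)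

  private
    0ₚ = reduce n 0
    1ₚ = reduce n 1
    -- The energy count and the coverings cancel elements of the set as factors, so 0 is set aside.
    A′ = A ─ ⁅ 0ₚ ⁆

    A′⊆A : A′ ⊆ A
    A′⊆A = p─q⊆p A ⁅ 0ₚ ⁆

    0∉A′ : 0ₚ ∉ A′
    0∉A′ 0∈A′ = ─-notin A ⁅ 0ₚ ⁆ 0∈A′ (x∈⁅x⁆ 0ₚ)

    ∣A∣≤1+∣A′∣ : ∣ A ∣ ≤ suc ∣ A′ ∣
    ∣A∣≤1+∣A′∣ = begin
      ∣ A ∣                          ≡⟨ ∣─∣+∣∩∣ A ⁅ 0ₚ ⁆ ⟨
      ∣ A′ ∣ + ∣ A ∩ ⁅ 0ₚ ⁆ ∣        ≤⟨ +-monoʳ-≤ ∣ A′ ∣ (≤-trans (∣p∩q∣≤∣q∣ A ⁅ 0ₚ ⁆) (≤-reflexive (∣⁅x⁆∣≡1 0ₚ))) ⟩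
      ∣ A′ ∣ + 1                     ≡⟨ +-comm ∣ A′ ∣ 1 ⟩
      suc ∣ A′ ∣                     ∎
      where open ≤-Reasoning

    ∣A′∣²≤ : ∣ A′ ∣ * ∣ A′ ∣ ≤ k * suc n
    ∣A′∣²≤ = ≤-trans (*-mono-≤ (p⊆q⇒∣p∣≤∣q∣ A′⊆A) (p⊆q⇒∣p∣≤∣q∣ A′⊆A)) ∣A∣²≤

    bound : (_±_ : Fin (suc n) → Fin (suc n) → Fin (suc n)) (σ : Fin (suc n)) → σ ≡ 1ₚ ⊎ σ ≡ negₚ 1ₚ →
      σ *ₚ σ ≡ 1ₚ → (∀ (P : Fin (suc n) → Set) → P 0ₚ → (∀ x → P x → P (x +ₚ σ)) → ∀ x → P x) →
      A′ ⊞ σ ⊡ A′ ⊆ setOp _±_ A′ A′ →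
      ∣ A ∣ ^ 13 ≤ (constant k * 8192 * (∣ setOp _±_ A A ∣ ⊔ ∣ A ⊗ A ∣)) ^ 12
    bound _±_ σ σ≡±1 σσ≡1 generates A′+σA′⊆ = restore-zero (constant k) (0<constant k) 0<M ∣A∣≤1+∣A′∣ λ 0<∣A′∣ →
      sum-product σ σ≡±1 σσ≡1 generates A′ (∣∣>0⇒Nonempty A′ 0<∣A′∣) 0∉A′ M k
        (≤-trans (p⊆q⇒∣p∣≤∣q∣ λ x∈ → setOp-mono _±_ A′⊆A A′⊆A (A′+σA′⊆ x∈)) (m≤m⊔n ∣ setOp _±_ A A ∣ ∣ A ⊗ A ∣))
        (≤-trans (p⊆q⇒∣p∣≤∣q∣ (setOp-mono _*ₚ_ A′⊆A A′⊆A)) (m≤n⊔m ∣ setOp _±_ A A ∣ ∣ A ⊗ A ∣))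
        ∣A′∣²≤
      where
      M = ∣ setOp _±_ A A ∣ ⊔ ∣ A ⊗ A ∣
      0<M : 0 < M
      0<M = let a , a∈ = neA in
        ≤-trans (Nonempty⇒∣∣>0 (_ , ∈-setOp⁺ _±_ a∈ a∈ refl)) (m≤m⊔n ∣ setOp _±_ A A ∣ ∣ A ⊗ A ∣)

  sum-bound : ∣ A ∣ ^ 13 ≤ (constant k * 8192 * (∣ A ⊕ A ∣ ⊔ ∣ A ⊗ A ∣)) ^ 12
  sum-bound = bound _+ₚ_ 1ₚ (inj₁ refl) (*ₚ-identityˡ 1ₚ) one-generates (A+1A⊆A+A A′)

  difference-bound : ∣ A ∣ ^ 13 ≤ (constant k * 8192 * (∣ A ⊖ A ∣ ⊔ ∣ A ⊗ A ∣)) ^ 12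
  difference-bound = bound _-ₚ_ (negₚ 1ₚ) (inj₂ refl) neg-one² (neg-one-generates one-generates)
    (A-1A⊆A-A A′ _-ₚ_ minus-neg)

theorem1p1 : (c : ℕ) → c > 0 →
    Σ ℕ λ C → C > 0 ×
    ((p : ℕ) → Prime p → (A : Subset p) → Nonempty A →
    ∣ A ∣ ^ 2 ≤ (c ^ 2) * p →
    (∣ A ∣ ^ 13 ≤ (C * (∣ A ⊕ A ∣ ⊔ ∣ A ⊗ A ∣)) ^ 12)
    × (∣ A ∣ ^ 13 ≤ (C * (∣ A ⊖ A ∣ ⊔ ∣ A ⊗ A ∣)) ^ 12))
-- The size hypothesis is squared, so c² is the parameter k on which the constant depends.
theorem1p1 c _ = constant (c ^ 2) * 8192 , *-mono-< (0<constant (c ^ 2)) (s≤s (z≤n {8191})) , bounds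
  where
  bounds : (p : ℕ) → Prime p → (A : Subset p) → Nonempty A → ∣ A ∣ ^ 2 ≤ (c ^ 2) * p →
    (∣ A ∣ ^ 13 ≤ (constant (c ^ 2) * 8192 * (∣ A ⊕ A ∣ ⊔ ∣ A ⊗ A ∣)) ^ 12)
    × (∣ A ∣ ^ 13 ≤ (constant (c ^ 2) * 8192 * (∣ A ⊖ A ∣ ⊔ ∣ A ⊗ A ∣)) ^ 12)
  bounds zero    _     A (() , _)
  bounds (suc n) q-prime A neA ∣A∣²≤ = sum-bound , difference-bound
    where
    open PrimeField n q-prime A neA (c ^ 2) (≤-trans (≤-reflexive (cong (∣ A ∣ *_) (sym (*-identityʳ ∣ A ∣)))) ∣A∣²≤)
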